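{- For every $v\equiv 1\pmod{10}$ with $v>11$ and $v\neq 91$, there exists a super-simple $2$-$(v,5,1)$DD $\mathcal{D}$ with $f(\mathcal{D})\geq\frac12$.
   Context: A $2$-$(v,5,1)$ directed design ($2$-$(v,5,1)$DD) is a pair $(V,\mathcal{B})$ where $|V|=v$ and $\mathcal{B}$ is a collection of ordered $5$-tuples of distinct elements of $V$ (blocks) such that every ordered pair $(x,y)$ of distinct elements of $V$ occurs in exactly one block as a subsequence. It is super-simple if, after forgetting the order in blocks (giving a $2$-$(v,5,2)$-BIBD), any two blocks intersect in at most two points. A defining set of a $2$-$(v,5,1)$DD $\mathcal{D}=(V,\mathcal{B})$ is a subset $S\subseteq\mathcal{B}$ such that $\mathcal{D}$ is the unique $2$-$(v,5,1)$DD on $V$ whose block collection contains $S$. Define $f(\mathcal{D})$ as the number of blocks in a smallest defining set of $\mathcal{D}$ divided by $|\mathcal{B}|$. -}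

module Defs where

open import Data.Nat using (ℕ; _≤_; _*_; _<_)
open import Data.Fin using (Fin; _≟_) renaming (_<_ to _<ᶠ_)
open import Data.Vec using (Vec; lookup)
import Data.Vec.Membership.DecPropositional as VecMem
open import Data.List using (List; length; filter; allFin) renaming (lookup to lookupL)
open import Data.List.Membership.Propositional using (_∈_)
open import Data.List.Relation.Binary.Sublist.Propositional using (_⊆_)
open import Data.List.Relation.Binary.Permutation.Propositional using (_↭_)
open import Data.Product using (Σ; _×_; ∃)
open import Relation.Binary.PropositionalEquality using (_≡_; _≢_)
open import Relation.Nullary.Decidable using (_×-dec_)

Block : ℕ → Set
Block v = Vec (Fin v) 5

DistinctEntries : ∀ {v} → Block v → Set
DistinctEntries b = ∀ i j → lookup b i ≡ lookup b j → i ≡ j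

OccursIn : ∀ {v} → Fin v → Fin v → Block v → Set
OccursIn x y b = Σ (Fin 5) λ i → Σ (Fin 5) λ j →
  (i <ᶠ j) × (lookup b i ≡ x) × (lookup b j ≡ y)

-- A 2-(v,5,1) directed design on V = Fin v, with block collection given as a
-- list (a multiset, up to order): every block has distinct entries, and every
-- ordered pair of distinct points occurs in exactly one block (counted with
-- multiplicity, i.e. at exactly one position of the list).
IsDD : (v : ℕ) → List (Block v) → Set
IsDD v B =
  (∀ (k : Fin (length B)) → DistinctEntries (lookupL B k)) ×
  (∀ (x y : Fin v) → x ≢ y →
     Σ (Fin (length B)) λ k → OccursIn x y (lookupL B k) ×
       (∀ (k′ : Fin (length B)) → OccursIn x y (lookupL B k′) → k′ ≡ k))

commonPoints : ∀ {v} → Block v → Block v → ℕ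
commonPoints {v} b c = length (filter (λ x → (x ∈ᵥ? b) ×-dec (x ∈ᵥ? c)) (allFin v))
  where open VecMem (_≟_ {v}) using () renaming (_∈?_ to _∈ᵥ?_)

SuperSimple : ∀ {v} → List (Block v) → Set
SuperSimple B = ∀ (k k′ : Fin (length B)) → k ≢ k′ →
  commonPoints (lookupL B k) (lookupL B k′) ≤ 2

-- S (a sub-multiset of the blocks of B) is a defining set of the DD B:
-- every DD on V whose block collection contains S has the same block
-- collection as B (equality of multisets = permutation).
IsDefiningSet : (v : ℕ) → List (Block v) → List (Block v) → Set
IsDefiningSet v B S = S ⊆ B ×
  (∀ (B′ : List (Block v)) → IsDD v B′ → (∀ s → s ∈ S → s ∈ B′) → B′ ↭ B)

-- f(D) ≥ 1/2, i.e. a smallest defining set has at least |B|/2 blocks,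
-- i.e. every defining set S satisfies 2·|S| ≥ |B|.
HalfDefiningRatio : (v : ℕ) → List (Block v) → Set
HalfDefiningRatio v B = ∀ (S : List (Block v)) → IsDefiningSet v B S →
  length B ≤ 2 * length S

{-# OPTIONS --safe #-}
module Submission where

-- Every block i gets a partner π i, with π injective, such that some two points are adjacent
-- in both blocks, in opposite orders. Exchanging these points in both blocks gives another
-- directed design, so every defining set contains block i or block π i, and injectivity of π
-- turns this into the bound 1/2. Such designs are glued from pieces covering disjoint symmetric
-- relations: a triple of points in two blocks would have to be reversed from one to the other,
-- and both orders of a pair lie in one piece, so super-simplicity is a condition on each piece.
--
-- Write v = 10 n + 1. Inflating by 10 the points of a transversal design TD(8,M) over ℤ/M with
-- three groups truncated to a, b, c points, replacing each line (of 5 to 8 points) by a directed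
-- group divisible design, and filling the groups together with one new point, gives
-- n = 5 M + a + b + c from M, a, b, c. What is left are finitely many n, for which base blocks
-- are listed and verified by evaluation.

open import Defs
open import Data.Bool using (Bool; true; false; not; _∧_; _∨_)
open import Data.Bool.Properties using (T-≡)
open import Data.Empty using (⊥; ⊥-elim)
open import Data.Fin using (Fin; zero; suc; toℕ; inject₁; inject≤; fromℕ<; cast; combine; remQuot; splitAt; _↑ˡ_; _↑ʳ_) renaming (_<_ to _<ᶠ_; _≟_ to _≟ᶠ_)
import Data.Fin.Properties as Finₚ
open import Data.List using (List; []; _∷_; _++_; length; filter; map; concatMap; allFin; tabulate) renaming (lookup to lookupL)
import Data.List.Properties as Listₚ
import Data.List.Membership.DecPropositional as DecMembership
open import Data.List.Membership.Propositional using (_∈_)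
open import Data.List.Membership.Propositional.Properties using (∈-tabulate⁺; ∈-tabulate⁻; ∈-filter⁺; ∈-filter⁻; ∈-allFin; ∈-lookup)
open import Data.List.Relation.Binary.Permutation.Propositional.Properties using (∈-resp-↭)
open import Data.List.Relation.Binary.Sublist.Propositional using () renaming (lookup to ⊆-lookup)
open import Data.List.Relation.Unary.All as All using (All; []; _∷_)
open import Data.List.Relation.Unary.All.Properties using (all-filter)
open import Data.List.Relation.Unary.AllPairs using ([]; _∷_)
open import Data.List.Relation.Unary.Any using (index)
open import Data.List.Relation.Unary.Any.Properties using (lookup-index)
open import Data.List.Relation.Unary.Unique.Propositional using (Unique)
import Data.List.Relation.Unary.Unique.Propositional.Properties as Uniqueₚ
open import Data.Maybe using (Maybe; just; nothing; is-just; is-nothing; _<∣>_)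
open import Data.Maybe.Properties using (just-injective)
open import Data.Nat using (ℕ; zero; suc; _+_; _*_; _∸_; _≤_; _<_; _≤?_; _<?_; _≟_; _≡ᵇ_; _<ᵇ_; _%_; _/_; z≤n; s≤s; z<s; s<s)
open import Data.Nat.DivMod using (_mod_; m%n<n; %-distribˡ-+; m<n⇒m%n≡m; [m+n]%n≡m%n; [m+kn]%n≡m%n; m≡m%n+[m/n]*n)
open import Data.Nat.Induction using (<-rec)
import Data.Nat.Properties as ℕₚ
open import Data.Nat.Tactic.RingSolver using (solve-∀)
open import Data.Product using (Σ; _×_; _,_; proj₁; proj₂)
open import Data.Product.Function.Dependent.Propositional using (Σ-↔)
open import Data.Product.Function.NonDependent.Propositional using (_×-↔_)
open import Data.Sum using (_⊎_; inj₁; inj₂)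
open import Data.Unit using (⊤; tt)
import Data.Vec as Vec
open Vec using (Vec; []; _∷_; lookup)
open import Data.Vec.Membership.Propositional using () renaming (_∈_ to _∈ᵛ_)
import Data.Vec.Properties as Vecₚ
import Data.Vec.Relation.Unary.Any as VecAny
import Data.Vec.Relation.Unary.Any.Properties as VecAnyₚ
open import Function using (_∘_; _↔_; Inverse; Equivalence; mk↔ₛ′)
open import Function.Properties.Inverse using (↔-refl; ↔-sym; ↔-trans)
open import Relation.Binary using (tri<; tri≈; tri>)
open import Relation.Binary.PropositionalEquality using (_≡_; _≢_; refl; sym; trans; cong; cong₂; subst; ≢-sym; module ≡-Reasoning)
open import Relation.Nullary using (¬_; Dec; yes; no; does; contradiction)
open import Relation.Nullary.Decidable using (_×-dec_; ¬?)

-- Directed designs with a partner map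

-- The map π is only asked to be injective. It has no fixed point, so the edges from i to π i form
-- cycles, and a set that meets every edge of a cycle contains at least half of its vertices. An
-- involution would be too much to ask: for odd n the number of blocks, n (10 n + 1), is odd. Two
-- obstacles shape the recursion. Lines over ℤ/M form a transversal design only if the differences
-- of the columns in use, which go up to 6, are invertible; so M is prime to 6, and also to 5 as
-- soon as the second or third truncated group is nonempty. Moreover the orders 11 and 91 cannot
-- serve as fillings, so none of M, a, b, c may be 1 or 9. This decides which splittings of n - 5 M
-- are usable and leaves gaps among the small n, such as 26 = 5 * 5 + 1 and 36 = 5 * 7 + 1, that
-- require designs of their own.

Occurs : {X : Set} → (Fin 5 → X) → X → X → Set
Occurs β x y = Σ (Fin 5) λ p → Σ (Fin 5) λ q → p <ᶠ q × β p ≡ x × β q ≡ y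

record Design {X : Set} (R : X → X → Set) : Set₁ where
  field
    Index : Set
    finite : Σ ℕ λ b → Index ↔ Fin b
    block : Index → Fin 5 → X
    sound : ∀ i {p q} → p <ᶠ q → R (block i p) (block i q)
    cover : ∀ {x y} → R x y → Σ Index λ i → Occurs (block i) x y
    unique : ∀ {i j p q p′ q′} → p <ᶠ q → p′ <ᶠ q′ →
      block i p ≡ block j p′ → block i q ≡ block j q′ → i ≡ j
    noReversal : ∀ {i j p q r p′ q′ r′} → p <ᶠ q → q <ᶠ r → p′ <ᶠ q′ → q′ <ᶠ r′ →
      block i p ≡ block j r′ → block i q ≡ block j q′ → block i r ≡ block j p′ → ⊥
    partner : Index → Index
    partner-injective : ∀ {i j} → partner i ≡ partner j → i ≡ j
    partner-swap : ∀ i → Σ (Fin 4) λ p → Σ (Fin 4) λ q →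
      block i (inject₁ p) ≡ block (partner i) (suc q) ×
      block i (suc p) ≡ block (partner i) (inject₁ q)

sumFin : (n : ℕ) → (Fin n → ℕ) → ℕ
sumFin zero    s = 0
sumFin (suc n) s = s zero + sumFin n (s ∘ suc)

Σ-Fin↔ : ∀ n (s : Fin n → ℕ) → Σ (Fin n) (Fin ∘ s) ↔ Fin (sumFin n s)
Σ-Fin↔ n s = mk↔ₛ′ (encode n s) (decode n s) (encode-decode n s) (decode-encode n s)
  where
  encode : ∀ n (s : Fin n → ℕ) → Σ (Fin n) (Fin ∘ s) → Fin (sumFin n s)
  encode (suc n) s (zero  , x) = x ↑ˡ sumFin n (s ∘ suc)
  encode (suc n) s (suc i , x) = s zero ↑ʳ encode n (s ∘ suc) (i , x)

  tail : ∀ {n} {s : Fin (suc n) → ℕ} → Σ (Fin n) (Fin ∘ s ∘ suc) → Σ (Fin (suc n)) (Fin ∘ s)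
  tail (i , x) = suc i , x

  decode : ∀ n (s : Fin n → ℕ) → Fin (sumFin n s) → Σ (Fin n) (Fin ∘ s)
  decode (suc n) s k with splitAt (s zero) k
  ... | inj₁ x = zero , x
  ... | inj₂ y = tail (decode n (s ∘ suc) y)

  decode-encode : ∀ n (s : Fin n → ℕ) x → decode n s (encode n s x) ≡ x
  decode-encode (suc n) s (zero , x)
    rewrite Finₚ.splitAt-↑ˡ (s zero) x (sumFin n (s ∘ suc)) = refl
  decode-encode (suc n) s (suc i , x)
    rewrite Finₚ.splitAt-↑ʳ (s zero) (sumFin n (s ∘ suc)) (encode n (s ∘ suc) (i , x)) =
    cong tail (decode-encode n (s ∘ suc) (i , x))

  encode-decode : ∀ n (s : Fin n → ℕ) k → encode n s (decode n s k) ≡ k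
  encode-decode (suc n) s k with splitAt (s zero) k in eq
  ... | inj₁ x = Finₚ.splitAt⁻¹-↑ˡ eq
  ... | inj₂ y = trans (cong (s zero ↑ʳ_) (encode-decode n (s ∘ suc) y)) (Finₚ.splitAt⁻¹-↑ʳ eq)

Finite : Set → Set
Finite A = Σ ℕ λ n → A ↔ Fin n

Σ-finite : ∀ {A : Set} {B : A → Set} → Finite A → (∀ a → Finite (B a)) → Finite (Σ A B)
Σ-finite {A} {B} (n , A↔) finite = _ ,
  ↔-trans (Σ-↔ A↔ (λ {a} → subst (λ a′ → B a ↔ Fin (size a′)) (sym (strictlyInverseʳ a)) (proj₂ (finite a))))
          (Σ-Fin↔ n (size ∘ from))
  where
  open Inverse A↔
  size : A → ℕ
  size a = proj₁ (finite a)

×-finite : ∀ {A B : Set} → Finite A → Finite B → Finite (A × B)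
×-finite (m , A↔) (n , B↔) = m * n , ↔-trans (A↔ ×-↔ B↔) (↔-sym Finₚ.*↔×)

Σ-injectiveʳ : ∀ {A : Set} {B : A → Set} {a} {b b′ : B a} → _≡_ {A = Σ A B} (a , b) (a , b′) → b ≡ b′
Σ-injectiveʳ refl = refl

-- Pieces may share single points but no related pair. This disjointness is expressed by `owner`,
-- which recovers the piece from a pair of points; it is constrained on related pairs only, so any
-- default serves elsewhere.
glue : {J X : Set} {R : X → X → Set} → Finite J →
  {Y : J → Set} {Q : ∀ j → Y j → Y j → Set} → (∀ j → Design (Q j)) →
  (f : ∀ j → Y j → X) → (∀ j {y z} → f j y ≡ f j z → y ≡ z) →
  (∀ j {y z} → Q j y z → Q j z y) →
  (∀ j {y z} → Q j y z → R (f j y) (f j z)) →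
  (∀ {x x′} → R x x′ → Σ J λ j → Σ (Y j) λ y → Σ (Y j) λ y′ → f j y ≡ x × f j y′ ≡ x′ × Q j y y′) →
  (owner : X → X → J) → (∀ {j y z} → Q j y z → owner (f j y) (f j z) ≡ j) →
  Design R
glue {J} {X} {R} J-finite {Y} {Q} D f f-injective Q-sym Q⇒R R⇒Q owner owner-correct = record
  { Index = Σ J λ j → Index (D j)
  ; finite = Σ-finite J-finite (λ j → finite (D j))
  ; block = B
  ; sound = λ (j , i) p<q → Q⇒R j (sound (D j) i p<q)
  ; cover = λ r → cov (R⇒Q r)
  ; unique = uniq
  ; noReversal = noRev
  ; partner = λ (j , i) → j , partner (D j) i
  ; partner-injective = inj
  ; partner-swap = λ (j , i) → let p , q , e , e′ = partner-swap (D j) i in p , q , cong (f j) e , cong (f j) e′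
  }
  where
  open Design
  B : (Σ J λ j → Index (D j)) → Fin 5 → X
  B (j , i) p = f j (block (D j) i p)
  disjoint : ∀ {j k y y′ z z′} → Q j y y′ → Q k z z′ → f j y ≡ f k z → f j y′ ≡ f k z′ → j ≡ k
  disjoint q q′ e e′ = trans (sym (owner-correct q)) (trans (cong₂ owner e e′) (owner-correct q′))
  cov : ∀ {x x′} → (Σ J λ j → Σ (Y j) λ y → Σ (Y j) λ y′ → f j y ≡ x × f j y′ ≡ x′ × Q j y y′) →
    Σ (Σ J λ j → Index (D j)) λ i → Occurs (B i) x x′
  cov (j , y , y′ , refl , refl , q) with cover (D j) q
  ... | i , p , p′ , p<p′ , refl , refl = (j , i) , p , p′ , p<p′ , refl , refl
  uniq : ∀ {i j p q p′ q′} → p <ᶠ q → p′ <ᶠ q′ → B i p ≡ B j p′ → B i q ≡ B j q′ → i ≡ j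
  uniq {j , i} {j′ , i′} p<q p′<q′ e e′
    with disjoint (sound (D j) i p<q) (sound (D j′) i′ p′<q′) e e′
  ... | refl = cong (j ,_) (unique (D j) p<q p′<q′ (f-injective j e) (f-injective j e′))
  noRev : ∀ {i j p q r p′ q′ r′} → p <ᶠ q → q <ᶠ r → p′ <ᶠ q′ → q′ <ᶠ r′ →
    B i p ≡ B j r′ → B i q ≡ B j q′ → B i r ≡ B j p′ → ⊥
  noRev {j , i} {j′ , i′} p<q q<r p′<q′ q′<r′ e e′ e″
    -- The shared pair is read backwards in the second block, so the symmetry of `Q` is what puts
    -- both blocks into the same piece.
    with disjoint (sound (D j) i p<q) (Q-sym j′ (sound (D j′) i′ q′<r′)) e e′
  ... | refl = noReversal (D j) p<q q<r p′<q′ q′<r′ (f-injective j e) (f-injective j e′) (f-injective j e″)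
  inj : ∀ {i j : Σ J λ j → Index (D j)} →
    (proj₁ i , partner (D (proj₁ i)) (proj₂ i)) ≡ (proj₁ j , partner (D (proj₁ j)) (proj₂ j)) → i ≡ j
  inj {j , i} {j′ , i′} e with cong proj₁ e
  ... | refl = cong (j ,_) (partner-injective (D j) (Σ-injectiveʳ {B = λ j → Index (D j)} e))

-- Super-simplicity and defining sets

-- This is `IsDD` for blocks indexed by a number instead of by a position in a list, so that a trade
-- can alter two blocks in place.
record IsFamily {b v : ℕ} (f : Fin b → Fin 5 → Fin v) : Set where
  field
    distinct : ∀ k {p q} → f k p ≡ f k q → p ≡ q
    occurs   : ∀ {x y} → x ≢ y → Σ (Fin b) λ k → Occurs (f k) x y
    once     : ∀ {k l x y} → Occurs (f k) x y → Occurs (f l) x y → k ≡ l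

blocks : ∀ {b v} → (Fin b → Fin 5 → Fin v) → List (Block v)
blocks f = tabulate (Vec.tabulate ∘ f)

module _ {b v : ℕ} (f : Fin b → Fin 5 → Fin v) where

  position : Fin (length (blocks f)) → Fin b
  position = cast (Listₚ.length-tabulate (Vec.tabulate ∘ f))

  position⁻¹ : Fin b → Fin (length (blocks f))
  position⁻¹ = cast (sym (Listₚ.length-tabulate (Vec.tabulate ∘ f)))

  position⁻¹-position : ∀ k → position⁻¹ (position k) ≡ k
  position⁻¹-position k = Finₚ.cast-involutive (sym eq) eq k
    where eq = Listₚ.length-tabulate (Vec.tabulate ∘ f)

  position-injective : ∀ {k l} → position k ≡ position l → k ≡ l
  position-injective e =
    trans (sym (position⁻¹-position _)) (trans (cong position⁻¹ e) (position⁻¹-position _))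

  lookup-position⁻¹ : ∀ k → lookupL (blocks f) (position⁻¹ k) ≡ Vec.tabulate (f k)
  lookup-position⁻¹ = Listₚ.lookup-tabulate (Vec.tabulate ∘ f)

  lookup-blocks : ∀ k p → Vec.lookup (lookupL (blocks f) k) p ≡ f (position k) p
  lookup-blocks k p = trans
    (cong (λ B → Vec.lookup B p)
      (trans (cong (lookupL (blocks f)) (sym (position⁻¹-position k))) (lookup-position⁻¹ (position k))))
    (Vecₚ.lookup∘tabulate (f (position k)) p)

  occursIn⇒occurs : ∀ {k x y} → OccursIn x y (lookupL (blocks f) k) → Occurs (f (position k)) x y
  occursIn⇒occurs {k} (p , q , p<q , ex , ey) =
    p , q , p<q , trans (sym (lookup-blocks k p)) ex , trans (sym (lookup-blocks k q)) ey

  occurs⇒occursIn : ∀ {k x y} → Occurs (f k) x y → OccursIn x y (lookupL (blocks f) (position⁻¹ k))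
  occurs⇒occursIn {k} (p , q , p<q , ex , ey) = p , q , p<q , trans (at p) ex , trans (at q) ey
    where
    at : ∀ p → Vec.lookup (lookupL (blocks f) (position⁻¹ k)) p ≡ f k p
    at p = trans (cong (λ B → Vec.lookup B p) (lookup-position⁻¹ k)) (Vecₚ.lookup∘tabulate (f k) p)

  isDD : IsFamily f → IsDD v (blocks f)
  isDD F = (λ k p q e → F.distinct (position k) (trans (sym (lookup-blocks k p)) (trans e (lookup-blocks k q))))
         , λ x y x≢y → let k , o = F.occurs x≢y in
             position⁻¹ k , occurs⇒occursIn o ,
             λ l o′ → position-injective (F.once (occursIn⇒occurs o′) (occursIn⇒occurs (occurs⇒occursIn o)))
    where module F = IsFamily F

-- Trading an adjacent pair between two blocks

swap : ∀ {n} → Fin n → Fin (suc n) → Fin (suc n)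
swap zero    zero          = suc zero
swap zero    (suc zero)    = zero
swap zero    (suc (suc a)) = suc (suc a)
swap (suc p) zero          = zero
swap (suc p) (suc a)       = suc (swap p a)

swap-involutive : ∀ {n} (p : Fin n) a → swap p (swap p a) ≡ a
swap-involutive zero    zero          = refl
swap-involutive zero    (suc zero)    = refl
swap-involutive zero    (suc (suc a)) = refl
swap-involutive (suc p) zero          = refl
swap-involutive (suc p) (suc a)       = cong suc (swap-involutive p a)

swap-inject₁ : ∀ {n} (p : Fin n) → swap p (inject₁ p) ≡ suc p
swap-inject₁ zero    = refl
swap-inject₁ (suc p) = cong suc (swap-inject₁ p)

swap-suc : ∀ {n} (p : Fin n) → swap p (suc p) ≡ inject₁ p
swap-suc zero    = refl
swap-suc (suc p) = cong suc (swap-suc p)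

-- Nothing lies between neighbouring positions, so their transposition has a single inversion. This
-- is why partners have to share a pair that is adjacent in both blocks.
swap-< : ∀ {n} (p : Fin n) {a b} → a <ᶠ b → (a ≡ inject₁ p × b ≡ suc p) ⊎ swap p a <ᶠ swap p b
swap-< zero    {zero}        {suc zero}    _         = inj₁ (refl , refl)
swap-< zero    {zero}        {suc (suc b)} _         = inj₂ (s<s z<s)
swap-< zero    {suc zero}    {suc zero}    (s<s ())
swap-< zero    {suc zero}    {suc (suc b)} _         = inj₂ z<s
swap-< zero    {suc (suc a)} {suc (suc b)} a<b       = inj₂ a<b
swap-< zero    {suc (suc a)} {suc zero}    (s<s ())
swap-< (suc p) {zero}        {suc b}       _         = inj₂ z<s
swap-< (suc p) {suc a}       {suc b}       (s<s a<b) with swap-< p a<b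
... | inj₁ (refl , refl) = inj₁ (refl , refl)
... | inj₂ lt            = inj₂ (s<s lt)

inject₁<suc : ∀ {n} (p : Fin n) → inject₁ p <ᶠ suc p
inject₁<suc p = s≤s (ℕₚ.≤-reflexive (Finₚ.toℕ-inject₁ p))

module Trade {b v : ℕ} {f : Fin b → Fin 5 → Fin v} (F : IsFamily f) {i j : Fin b} {p q : Fin 4}
  (e : f i (inject₁ p) ≡ f j (suc q)) (e′ : f i (suc p) ≡ f j (inject₁ q)) where
  open IsFamily F

  -- In one block with distinct entries, the same two positions would have to be increasing and
  -- decreasing.
  i≢j : i ≢ j
  i≢j refl = ℕₚ.<-asym {toℕ (inject₁ p)} {toℕ (suc p)} (inject₁<suc p)
    (subst (suc p <ᶠ_) (sym (distinct i e)) (subst (_<ᶠ suc q) (sym (distinct i e′)) (inject₁<suc q)))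

  u w : Fin v
  u = f i (inject₁ p)
  w = f i (suc p)

  u≢w : u ≢ w
  u≢w u≡w = Finₚ.<⇒≢ (inject₁<suc p) (distinct i u≡w)

  uw : Occurs (f i) u w
  uw = inject₁ p , suc p , inject₁<suc p , refl , refl

  wu : Occurs (f j) w u
  wu = inject₁ q , suc q , inject₁<suc q , sym e′ , sym e

  data View : Fin b → Set where
    first  : View i
    second : View j
    other  : ∀ {k} → k ≢ i → k ≢ j → View k

  view : ∀ k → View k
  view k with k ≟ᶠ i | k ≟ᶠ j
  ... | yes refl | _        = first
  ... | no _     | yes refl = second
  ... | no k≢i   | no k≢j   = other k≢i k≢j

  exchange : ∀ {k} → View k → Fin 5 → Fin 5
  exchange first       = swap p
  exchange second      = swap q
  exchange (other _ _) = λ a → a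

  traded : Fin b → Fin 5 → Fin v
  traded k = f k ∘ exchange (view k)

  exchange-involutive : ∀ {k} (V : View k) a → exchange V (exchange V a) ≡ a
  exchange-involutive first       = swap-involutive p
  exchange-involutive second      = swap-involutive q
  exchange-involutive (other _ _) = λ _ → refl

  Traded : Fin v → Fin v → Set
  Traded x y = (x ≡ u × y ≡ w) ⊎ (x ≡ w × y ≡ u)

  -- A pair of a traded block is one of the two new occurrences or an old one. An old occurrence
  -- cannot be a traded pair: by `distinct` it would sit at the exchanged positions, or by `once` in
  -- the other of the two blocks.
  reflect : ∀ {k} (V : View k) {x y} → Occurs (f k ∘ exchange V) x y →
    (k ≡ i × x ≡ w × y ≡ u) ⊎ (k ≡ j × x ≡ u × y ≡ w) ⊎ (Occurs (f k) x y × ¬ Traded x y)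
  reflect first (a , c , a<c , refl , refl) with swap-< p a<c
  ... | inj₁ (refl , refl) = inj₁ (refl , cong (f i) (swap-inject₁ p) , cong (f i) (swap-suc p))
  ... | inj₂ lt = inj₂ (inj₂ (o , λ
      { (inj₁ (eu , ew)) → ℕₚ.<-asym a<c (subst₂< (swap-at eu (swap-inject₁ p)) (swap-at ew (swap-suc p)))
      ; (inj₂ (ew , eu)) → i≢j (once o (subst₂-occurs (sym ew) (sym eu) wu)) }))
    where
    o = swap p a , swap p c , lt , refl , refl
    swap-at : ∀ {a c d} → f i (swap p a) ≡ f i c → swap p c ≡ d → a ≡ d
    swap-at {a} eq eq′ = trans (sym (swap-involutive p a)) (trans (cong (swap p) (distinct i eq)) eq′)
    subst₂< : a ≡ suc p → c ≡ inject₁ p → c <ᶠ a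
    subst₂< refl refl = inject₁<suc p
    subst₂-occurs : ∀ {x x′ y y′} → x ≡ x′ → y ≡ y′ → Occurs (f j) x y → Occurs (f j) x′ y′
    subst₂-occurs refl refl o = o
  reflect second (a , c , a<c , refl , refl) with swap-< q a<c
  ... | inj₁ (refl , refl) = inj₂ (inj₁ (refl , trans (cong (f j) (swap-inject₁ q)) (sym e) , trans (cong (f j) (swap-suc q)) (sym e′)))
  ... | inj₂ lt = inj₂ (inj₂ (o , λ
      { (inj₂ (ew , eu)) → ℕₚ.<-asym a<c (subst₂< (swap-at (trans ew e′) (swap-inject₁ q)) (swap-at (trans eu e) (swap-suc q)))
      ; (inj₁ (eu , ew)) → i≢j (once (subst₂-occurs (sym eu) (sym ew) uw) o) }))
    where
    o = swap q a , swap q c , lt , refl , refl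
    swap-at : ∀ {a c d} → f j (swap q a) ≡ f j c → swap q c ≡ d → a ≡ d
    swap-at {a} eq eq′ = trans (sym (swap-involutive q a)) (trans (cong (swap q) (distinct j eq)) eq′)
    subst₂< : a ≡ suc q → c ≡ inject₁ q → c <ᶠ a
    subst₂< refl refl = inject₁<suc q
    subst₂-occurs : ∀ {x x′ y y′} → x ≡ x′ → y ≡ y′ → Occurs (f i) x y → Occurs (f i) x′ y′
    subst₂-occurs refl refl o = o
  reflect (other k≢i k≢j) o = inj₂ (inj₂ (o , λ
    { (inj₁ (refl , refl)) → k≢i (once o uw)
    ; (inj₂ (refl , refl)) → k≢j (once o wu) }))

  preserve : ∀ {k} (V : View k) {x y} → ¬ Traded x y → Occurs (f k) x y → Occurs (f k ∘ exchange V) x y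
  preserve {k} V {x} {y} ¬t (a , c , a<c , ex , ey) =
    exchange V a , exchange V c , ordered V , back ex , back ey
    where
    back : ∀ {a x} → f k a ≡ x → f k (exchange V (exchange V a)) ≡ x
    back {a} eq = trans (cong (f k) (exchange-involutive V a)) eq
    ordered : (V : View k) → exchange V a <ᶠ exchange V c
    ordered first with swap-< p a<c
    ... | inj₁ (refl , refl) = contradiction (inj₁ (sym ex , sym ey)) ¬t
    ... | inj₂ lt = lt
    ordered second with swap-< q a<c
    ... | inj₁ (refl , refl) = contradiction (inj₂ (trans (sym ex) (sym e′) , trans (sym ey) (sym e))) ¬t
    ... | inj₂ lt = lt
    ordered (other _ _) = a<c

  wu′ : Occurs (traded i) w u
  wu′ with view i
  ... | first       = inject₁ p , suc p , inject₁<suc p , cong (f i) (swap-inject₁ p) , cong (f i) (swap-suc p)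
  ... | second      = contradiction refl i≢j
  ... | other i≢i _ = contradiction refl i≢i

  uw′ : Occurs (traded j) u w
  uw′ with view j
  ... | first       = contradiction refl i≢j
  ... | second      = inject₁ q , suc q , inject₁<suc q ,
                      trans (cong (f j) (swap-inject₁ q)) (sym e) , trans (cong (f j) (swap-suc q)) (sym e′)
  ... | other _ j≢j = contradiction refl j≢j

  traded-unchanged : ∀ {k} → k ≢ i → k ≢ j → ∀ a → traded k a ≡ f k a
  traded-unchanged {k} k≢i k≢j a with view k
  ... | first     = contradiction refl k≢i
  ... | second    = contradiction refl k≢j
  ... | other _ _ = refl

  traded-isFamily : IsFamily traded
  traded-isFamily = record
    { distinct = λ k {a} {c} eq → trans (sym (exchange-involutive (view k) a))
        (trans (cong (exchange (view k)) (distinct k eq)) (exchange-involutive (view k) c))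
    ; occurs = occurs′
    ; once = λ {k} {l} o o′ → once′ (reflect (view k) o) (reflect (view l) o′)
    }
    where
    occurs′ : ∀ {x y} → x ≢ y → Σ (Fin b) λ k → Occurs (traded k) x y
    occurs′ {x} {y} x≢y with (x ≟ᶠ u) ×-dec (y ≟ᶠ w) | (x ≟ᶠ w) ×-dec (y ≟ᶠ u)
    ... | yes (refl , refl) | _ = j , uw′
    ... | no _ | yes (refl , refl) = i , wu′
    ... | no ¬uw | no ¬wu = let k , o = occurs x≢y in
      k , preserve (view k) (λ { (inj₁ t) → ¬uw t ; (inj₂ t) → ¬wu t }) o
    once′ : ∀ {k l x y} →
      (k ≡ i × x ≡ w × y ≡ u) ⊎ (k ≡ j × x ≡ u × y ≡ w) ⊎ (Occurs (f k) x y × ¬ Traded x y) →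
      (l ≡ i × x ≡ w × y ≡ u) ⊎ (l ≡ j × x ≡ u × y ≡ w) ⊎ (Occurs (f l) x y × ¬ Traded x y) → k ≡ l
    once′ (inj₁ (refl , _)) (inj₁ (refl , _)) = refl
    once′ (inj₁ (_ , ew , _)) (inj₂ (inj₁ (_ , eu , _))) = contradiction (trans (sym eu) ew) u≢w
    once′ (inj₁ (_ , t)) (inj₂ (inj₂ (_ , ¬t))) = contradiction (inj₂ t) ¬t
    once′ (inj₂ (inj₁ (_ , eu , _))) (inj₁ (_ , ew , _)) = contradiction (trans (sym eu) ew) u≢w
    once′ (inj₂ (inj₁ (refl , _))) (inj₂ (inj₁ (refl , _))) = refl
    once′ (inj₂ (inj₁ (_ , t))) (inj₂ (inj₂ (_ , ¬t))) = contradiction (inj₁ t) ¬t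
    once′ (inj₂ (inj₂ (_ , ¬t))) (inj₁ (_ , t)) = contradiction (inj₂ t) ¬t
    once′ (inj₂ (inj₂ (_ , ¬t))) (inj₂ (inj₁ (_ , t))) = contradiction (inj₁ t) ¬t
    once′ (inj₂ (inj₂ (o , _))) (inj₂ (inj₂ (o′ , _))) = once o o′

  -- The trade reverses one pair only, so the first block keeps another pair in
  -- its old order; being a block of the original family, it would be that block.
  traded-new : ∀ k → ¬ (∀ a → traded i a ≡ f k a)
  traded-new k same with once {k} {j} (move wu′) wu
    where
    move : ∀ {x y} → Occurs (traded i) x y → Occurs (f k) x y
    move (a , c , a<c , ex , ey) = a , c , a<c , trans (sym (same a)) ex , trans (sym (same c)) ey
  ... | refl = i≢j (once {i} {j} {f i (proj₁ kept)} {f i (proj₁ (proj₂ kept))}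
      (proj₁ kept , proj₁ (proj₂ kept) , proj₁ (proj₂ (proj₂ kept)) , refl , refl)
      (swap p (proj₁ kept) , swap p (proj₁ (proj₂ kept)) , proj₂ (proj₂ (proj₂ kept)) , at _ , at _))
    where
    keep : (p : Fin 4) → Σ (Fin 5) λ a → Σ (Fin 5) λ c → a <ᶠ c × swap p a <ᶠ swap p c
    keep zero          = zero , suc (suc zero) , z<s , s<s z<s
    keep (suc zero)    = zero , suc zero , z<s , z<s
    keep (suc (suc p)) = zero , suc zero , z<s , z<s
    kept = keep p
    unfold : ∀ a → traded i a ≡ f i (swap p a)
    unfold a with view i
    ... | first       = refl
    ... | second      = contradiction refl i≢j
    ... | other i≢i _ = contradiction refl i≢i
    at : ∀ a → f j (swap p a) ≡ f i a
    at a = trans (sym (same (swap p a))) (trans (unfold (swap p a)) (cong (f i) (swap-involutive p a)))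

length≤2 : ∀ {A : Set} {P : A → Set} {xs} → Unique xs → All P xs →
  (∀ {x y z} → P x → P y → P z → x ≢ y → y ≢ z → x ≢ z → ⊥) → length xs ≤ 2
length≤2 {xs = []}        _ _ _ = z≤n
length≤2 {xs = _ ∷ []}    _ _ _ = s≤s z≤n
length≤2 {xs = _ ∷ _ ∷ []} _ _ _ = s≤s (s≤s z≤n)
length≤2 {xs = _ ∷ _ ∷ _ ∷ _} ((x≢y ∷ x≢z ∷ _) ∷ (y≢z ∷ _) ∷ _) (px ∷ py ∷ pz ∷ _) ¬three =
  ⊥-elim (¬three px py pz x≢y y≢z x≢z)

module Realise {v : ℕ} (D : Design {Fin v} _≢_) where
  open Design D

  b : ℕ
  b = proj₁ finite

  open Inverse (proj₂ finite) using (to; from; strictlyInverseˡ; strictlyInverseʳ)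

  f : Fin b → Fin 5 → Fin v
  f k = block (from k)

  from-injective : ∀ {k l} → from k ≡ from l → k ≡ l
  from-injective e = trans (sym (strictlyInverseˡ _)) (trans (cong to e) (strictlyInverseˡ _))

  f-isFamily : IsFamily f
  f-isFamily = record
    { distinct = λ k → dist k
    ; occurs = λ {x} {y} x≢y → let i , o = cover x≢y in
        to i , subst (λ i → Occurs (block i) x y) (sym (strictlyInverseʳ i)) o
    ; once = λ (p , q , p<q , ex , ey) (p′ , q′ , p′<q′ , ex′ , ey′) →
        from-injective (unique p<q p′<q′ (trans ex (sym ex′)) (trans ey (sym ey′)))
    }
    where
    dist : ∀ k {p q} → f k p ≡ f k q → p ≡ q
    dist k {p} {q} e with Finₚ.<-cmp p q
    ... | tri< p<q _ _ = contradiction e (sound (from k) p<q)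
    ... | tri≈ _ p≡q _ = p≡q
    ... | tri> _ _ q<p = contradiction (sym e) (sound (from k) q<p)

  open IsFamily f-isFamily

  -- By `once`, two different blocks hold two common points in opposite orders. With the three
  -- positions sorted in block `k`, the triple is thus reversed in block `l`, which `noReversal`
  -- forbids.
  blocks-meet-in-two : ∀ {k l} → k ≢ l → ∀ {p q r p′ q′ r′} →
    f k p ≡ f l p′ → f k q ≡ f l q′ → f k r ≡ f l r′ → p ≢ q → q ≢ r → p ≢ r → ⊥
  blocks-meet-in-two {k} {l} k≢l ep eq er p≢q q≢r p≢r = sorted (cmp p≢q) (cmp q≢r) (cmp p≢r)
    where
    cmp : ∀ {p q : Fin 5} → p ≢ q → p <ᶠ q ⊎ q <ᶠ p
    cmp {p} {q} p≢q with Finₚ.<-cmp p q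
    ... | tri< p<q _ _ = inj₁ p<q
    ... | tri≈ _ p≡q _ = contradiction p≡q p≢q
    ... | tri> _ _ q<p = inj₂ q<p
    opposite : ∀ {p q p′ q′} → p <ᶠ q → f k p ≡ f l p′ → f k q ≡ f l q′ → q′ <ᶠ p′
    opposite {p} {q} {p′} {q′} p<q ep eq with Finₚ.<-cmp p′ q′
    ... | tri< p′<q′ _ _ = contradiction (once (p , q , p<q , refl , refl) (p′ , q′ , p′<q′ , sym ep , sym eq)) k≢l
    ... | tri≈ _ refl _ = contradiction (distinct k (trans ep (sym eq))) (Finₚ.<⇒≢ p<q)
    ... | tri> _ _ q′<p′ = q′<p′
    core : ∀ {p q r p′ q′ r′} → p <ᶠ q → q <ᶠ r → f k p ≡ f l p′ → f k q ≡ f l q′ → f k r ≡ f l r′ → ⊥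
    core p<q q<r ep eq er = noReversal p<q q<r (opposite q<r eq er) (opposite p<q ep eq) ep eq er
    sorted : _ <ᶠ _ ⊎ _ <ᶠ _ → _ <ᶠ _ ⊎ _ <ᶠ _ → _ <ᶠ _ ⊎ _ <ᶠ _ → ⊥
    sorted (inj₁ p<q) (inj₁ q<r) _          = core p<q q<r ep eq er
    sorted (inj₁ p<q) (inj₂ r<q) (inj₁ p<r) = core p<r r<q ep er eq
    sorted (inj₁ p<q) (inj₂ r<q) (inj₂ r<p) = core r<p p<q er ep eq
    sorted (inj₂ q<p) (inj₁ q<r) (inj₁ p<r) = core q<p p<r eq ep er
    sorted (inj₂ q<p) (inj₁ q<r) (inj₂ r<p) = core q<r r<p eq er ep
    sorted (inj₂ q<p) (inj₂ r<q) _          = core r<q q<p er eq ep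

  B : List (Block v)
  B = blocks f

  position-of : ∀ {x} k → x ∈ᵛ lookupL B k → Σ (Fin 5) λ p → f (position f k) p ≡ x
  position-of k x∈ = VecAny.index x∈ ,
    trans (sym (lookup-blocks f k _)) (sym (VecAnyₚ.lookup-index x∈))

  superSimple : SuperSimple B
  superSimple k l k≢l = length≤2 (Uniqueₚ.filter⁺ _ (Uniqueₚ.allFin⁺ v)) (all-filter _ (allFin v)) three
    where
    three : ∀ {x y z} →
      (x ∈ᵛ lookupL B k × x ∈ᵛ lookupL B l) → (y ∈ᵛ lookupL B k × y ∈ᵛ lookupL B l) →
      (z ∈ᵛ lookupL B k × z ∈ᵛ lookupL B l) → x ≢ y → y ≢ z → x ≢ z → ⊥
    three (xk , xl) (yk , yl) (zk , zl) x≢y y≢z x≢z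
      with position-of k xk | position-of l xl | position-of k yk | position-of l yl
         | position-of k zk | position-of l zl
    ... | p , ep | p′ , ep′ | q , eq | q′ , eq′ | r , er | r′ , er′ =
      blocks-meet-in-two (k≢l ∘ position-injective f)
        (trans ep (sym ep′)) (trans eq (sym eq′)) (trans er (sym er′))
        (λ { refl → x≢y (trans (sym ep) eq) }) (λ { refl → y≢z (trans (sym eq) er) })
        (λ { refl → x≢z (trans (sym ep) er) })

  π : Fin b → Fin b
  π k = to (partner (from k))

  π-injective : ∀ {k l} → π k ≡ π l → k ≡ l
  π-injective e = from-injective (partner-injective
    (trans (sym (strictlyInverseʳ _)) (trans (cong from e) (strictlyInverseʳ _))))

  open DecMembership {A = Block v} (Vecₚ.≡-dec _≟ᶠ_) using (_∈?_)

  blockOf : Fin b → Block v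
  blockOf k = Vec.tabulate (f k)

  -- The first two entries, as an ordered pair, already determine the block.
  blockOf-injective : ∀ {k l} → blockOf k ≡ blockOf l → k ≡ l
  blockOf-injective {k} {l} e = once (zero , suc zero , z<s , refl , refl) (zero , suc zero , z<s , at zero , at (suc zero))
    where
    at : ∀ a → f l a ≡ f k a
    at a = trans (sym (Vecₚ.lookup∘tabulate (f l) a))
      (trans (cong (λ V → Vec.lookup V a) (sym e)) (Vecₚ.lookup∘tabulate (f k) a))

  module _ {S : List (Block v)} (defining : IsDefiningSet v B S) where

    -- If both blocks were missing from `S`, the trade between them would leave `S` intact. Since
    -- `S` is defining, the traded family would then be a permutation of `B`, although by
    -- `traded-new` its block `k` does not occur in `B`.
    hit : ∀ k → blockOf k ∈ S ⊎ blockOf (π k) ∈ S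
    hit k with blockOf k ∈? S | blockOf (π k) ∈? S
    ... | yes k∈S | _ = inj₁ k∈S
    ... | no _ | yes πk∈S = inj₂ πk∈S
    ... | no k∉S | no πk∉S = ⊥-elim (new (∈-tabulate⁻
            (∈-resp-↭ (proj₂ defining (blocks traded) (isDD traded traded-isFamily) S⊆)
              (∈-tabulate⁺ {f = Vec.tabulate ∘ traded} k))))
      where
      exchange-at : Σ (Fin 4) λ p → Σ (Fin 4) λ q →
        f k (inject₁ p) ≡ f (π k) (suc q) × f k (suc p) ≡ f (π k) (inject₁ q)
      exchange-at with partner-swap (from k)
      ... | p , q , e , e′ = p , q , trans e (move (suc q)) , trans e′ (move (inject₁ q))
        where
        move : ∀ a → block (partner (from k)) a ≡ f (π k) a
        move a = cong (λ i → block i a) (sym (strictlyInverseʳ _))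
      open Trade f-isFamily (proj₁ (proj₂ (proj₂ exchange-at))) (proj₂ (proj₂ (proj₂ exchange-at)))
        using (traded; traded-isFamily; traded-unchanged; traded-new)
      S⊆ : ∀ s → s ∈ S → s ∈ blocks traded
      S⊆ s s∈S with ∈-tabulate⁻ (⊆-lookup (proj₁ defining) s∈S)
      ... | l , refl = subst (_∈ blocks traded)
          (Vecₚ.tabulate-cong (traded-unchanged (λ { refl → k∉S s∈S }) (λ { refl → πk∉S s∈S })))
          (∈-tabulate⁺ {f = Vec.tabulate ∘ traded} l)
      new : Σ (Fin b) (λ l → Vec.tabulate (traded k) ≡ Vec.tabulate (f l)) → ⊥
      new (l , e) = traded-new l λ a → trans (sym (Vecₚ.lookup∘tabulate (traded k) a))
        (trans (cong (λ V → Vec.lookup V a) e) (Vecₚ.lookup∘tabulate (f l) a))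

    -- The tag tells whether the block itself or its partner was found in `S`. A place of `S` is
    -- therefore used at most twice, once for its own block and once for a block that π sends there;
    -- this is the factor 2.
    slot : ∀ {k} → blockOf k ∈ S ⊎ blockOf (π k) ∈ S → Fin 2 × Fin (length S)
    slot (inj₁ k∈S)  = zero , index k∈S
    slot (inj₂ πk∈S) = suc zero , index πk∈S

    index-injective : ∀ {x y} (x∈S : x ∈ S) (y∈S : y ∈ S) → index x∈S ≡ index y∈S → x ≡ y
    index-injective x∈S y∈S e = trans (lookup-index x∈S) (trans (cong (lookupL S) e) (sym (lookup-index y∈S)))

    slot-injective : ∀ {k l} (h : blockOf k ∈ S ⊎ blockOf (π k) ∈ S) (h′ : blockOf l ∈ S ⊎ blockOf (π l) ∈ S) →
      slot h ≡ slot h′ → k ≡ l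
    slot-injective (inj₁ m) (inj₁ m′) e = blockOf-injective (index-injective m m′ (cong proj₂ e))
    slot-injective (inj₁ m) (inj₂ m′) ()
    slot-injective (inj₂ m) (inj₁ m′) ()
    slot-injective (inj₂ m) (inj₂ m′) e = π-injective (blockOf-injective (index-injective m m′ (cong proj₂ e)))

    half : b ≤ 2 * length S
    half = Finₚ.injective⇒≤ {f = λ k → let x , y = slot (hit k) in combine x y}
      λ {k} {l} e → slot-injective (hit k) (hit l)
        (let e₁ , e₂ = Finₚ.combine-injective _ _ _ _ e in cong₂ _,_ e₁ e₂)

  halfDefiningRatio : HalfDefiningRatio v B
  halfDefiningRatio S defining =
    subst (_≤ 2 * length S) (sym (Listₚ.length-tabulate blockOf)) (half defining)

  realise : Σ (List (Block v)) λ B → IsDD v B × SuperSimple B × HalfDefiningRatio v B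
  realise = B , isDD f f-isFamily , superSimple , halfDefiningRatio

-- Residues and tries

module Residues (m : ℕ) where

  M : ℕ
  M = suc m

  infixl 6 _⊕_ _⊖_

  _⊕_ _⊖_ : Fin M → Fin M → Fin M
  x ⊕ y = (toℕ x + toℕ y) mod M
  x ⊖ y = (toℕ x + (M ∸ toℕ y)) mod M

  toℕ-mod : ∀ k → toℕ (k mod M) ≡ k % M
  toℕ-mod k = Finₚ.toℕ-fromℕ< (m%n<n k M)

  toℕ%M : ∀ (x : Fin M) → toℕ x % M ≡ toℕ x
  toℕ%M x = m<n⇒m%n≡m (Finₚ.toℕ<n x)

  mod-cong : ∀ k l → k % M ≡ l % M → k mod M ≡ l mod M
  mod-cong k l e = Finₚ.toℕ-injective (trans (toℕ-mod k) (trans e (sym (toℕ-mod l))))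

  mod-toℕ : ∀ (x : Fin M) → toℕ x mod M ≡ x
  mod-toℕ x = Finₚ.toℕ-injective (trans (toℕ-mod (toℕ x)) (toℕ%M x))

  mod-⊕ : ∀ k l → (k mod M) ⊕ (l mod M) ≡ (k + l) mod M
  mod-⊕ k l = mod-cong (toℕ (k mod M) + toℕ (l mod M)) (k + l) (begin
    (toℕ (k mod M) + toℕ (l mod M)) % M ≡⟨ cong₂ (λ a b → (a + b) % M) (toℕ-mod k) (toℕ-mod l) ⟩
    (k % M + l % M) % M                 ≡⟨ %-distribˡ-+ k l M ⟨
    (k + l) % M                         ∎)
    where open ≡-Reasoning

  ⊕-comm : ∀ x y → x ⊕ y ≡ y ⊕ x
  ⊕-comm x y = cong (_mod M) (ℕₚ.+-comm (toℕ x) (toℕ y))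

  ⊕-assoc : ∀ x y z → (x ⊕ y) ⊕ z ≡ x ⊕ (y ⊕ z)
  ⊕-assoc x y z = begin
    (x ⊕ y) ⊕ z                               ≡⟨ cong ((x ⊕ y) ⊕_) (mod-toℕ z) ⟨
    (x ⊕ y) ⊕ (toℕ z mod M)                   ≡⟨ mod-⊕ (toℕ x + toℕ y) (toℕ z) ⟩
    (toℕ x + toℕ y + toℕ z) mod M             ≡⟨ cong (_mod M) (ℕₚ.+-assoc (toℕ x) (toℕ y) (toℕ z)) ⟩
    (toℕ x + (toℕ y + toℕ z)) mod M           ≡⟨ mod-⊕ (toℕ x) (toℕ y + toℕ z) ⟨
    (toℕ x mod M) ⊕ (y ⊕ z)                   ≡⟨ cong (_⊕ (y ⊕ z)) (mod-toℕ x) ⟩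
    x ⊕ (y ⊕ z)                               ∎
    where open ≡-Reasoning

  ⊕-⊖ : ∀ x y → x ⊕ (y ⊖ x) ≡ y
  ⊕-⊖ x y = begin
    x ⊕ (y ⊖ x)                               ≡⟨ cong (_⊕ (y ⊖ x)) (mod-toℕ x) ⟨
    (toℕ x mod M) ⊕ (y ⊖ x)                   ≡⟨ mod-⊕ (toℕ x) (toℕ y + (M ∸ toℕ x)) ⟩
    (toℕ x + (toℕ y + (M ∸ toℕ x))) mod M     ≡⟨ cong (_mod M) shuffle ⟩
    (toℕ y + M) mod M                         ≡⟨ mod-cong (toℕ y + M) (toℕ y) ([m+n]%n≡m%n (toℕ y) M) ⟩
    toℕ y mod M                               ≡⟨ mod-toℕ y ⟩
    y                                         ∎
    where
    open ≡-Reasoning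
    shuffle : toℕ x + (toℕ y + (M ∸ toℕ x)) ≡ toℕ y + M
    shuffle = begin
      toℕ x + (toℕ y + (M ∸ toℕ x)) ≡⟨ ℕₚ.+-assoc (toℕ x) (toℕ y) _ ⟨
      toℕ x + toℕ y + (M ∸ toℕ x)   ≡⟨ cong (_+ (M ∸ toℕ x)) (ℕₚ.+-comm (toℕ x) (toℕ y)) ⟩
      toℕ y + toℕ x + (M ∸ toℕ x)   ≡⟨ ℕₚ.+-assoc (toℕ y) (toℕ x) _ ⟩
      toℕ y + (toℕ x + (M ∸ toℕ x)) ≡⟨ cong (toℕ y +_) (ℕₚ.m+[n∸m]≡n (ℕₚ.<⇒≤ (Finₚ.toℕ<n x))) ⟩
      toℕ y + M                     ∎

  ⊖-⊕ : ∀ x y → (y ⊖ x) ⊕ x ≡ y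
  ⊖-⊕ x y = trans (⊕-comm (y ⊖ x) x) (⊕-⊖ x y)

  ⊕-cancelˡ : ∀ x y z → x ⊕ y ≡ x ⊕ z → y ≡ z
  ⊕-cancelˡ x y z e = trans (sym (back y)) (trans (cong ((zero ⊖ x) ⊕_) e) (back z))
    where
    0⊕ : ∀ y → zero ⊕ y ≡ y
    0⊕ = mod-toℕ
    back : ∀ y → (zero ⊖ x) ⊕ (x ⊕ y) ≡ y
    back y = trans (sym (⊕-assoc (zero ⊖ x) x y)) (trans (cong (_⊕ y) (⊖-⊕ x zero)) (0⊕ y))

  ⊕-cancelʳ : ∀ x y z → y ⊕ x ≡ z ⊕ x → y ≡ z
  ⊕-cancelʳ x y z e = ⊕-cancelˡ x y z (trans (⊕-comm x y) (trans e (⊕-comm z x)))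

  ⊖-unique : ∀ x y z → x ⊕ z ≡ y → y ⊖ x ≡ z
  ⊖-unique x y z e = ⊕-cancelˡ x (y ⊖ x) z (trans (⊕-⊖ x y) (sym e))

  ⊖-translate : ∀ x y s → (y ⊕ s) ⊖ (x ⊕ s) ≡ y ⊖ x
  ⊖-translate x y s = ⊖-unique (x ⊕ s) (y ⊕ s) (y ⊖ x) (begin
    (x ⊕ s) ⊕ (y ⊖ x)   ≡⟨ ⊕-assoc x s (y ⊖ x) ⟩
    x ⊕ (s ⊕ (y ⊖ x))   ≡⟨ cong (x ⊕_) (⊕-comm s (y ⊖ x)) ⟩
    x ⊕ ((y ⊖ x) ⊕ s)   ≡⟨ ⊕-assoc x (y ⊖ x) s ⟨
    (x ⊕ (y ⊖ x)) ⊕ s   ≡⟨ cong (_⊕ s) (⊕-⊖ x y) ⟩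
    y ⊕ s               ∎)
    where open ≡-Reasoning

-- The binary digits of the key, lowest first, choose the branch, which keeps lookups short during
-- evaluation. The soundness proofs below rest on congruence alone: equal keys have equal lookups,
-- whatever the table contains, and the checks compare what is found with what is expected.
data Trie (A : Set) : Set where
  leaf : Trie A
  node : Maybe A → Trie A → Trie A → Trie A

insert : {A : Set} → ℕ → ℕ → A → Trie A → Trie A
insert zero    k a t = t
insert (suc f) k a t with k ≡ᵇ 0 | k % 2 ≡ᵇ 0 | t
... | true  | _     | leaf       = node (just a) leaf leaf
... | true  | _     | node _ l r = node (just a) l r
... | false | true  | leaf       = node nothing (insert f (k / 2) a leaf) leaf
... | false | true  | node b l r = node b (insert f (k / 2) a l) r
... | false | false | leaf       = node nothing leaf (insert f (k / 2) a leaf)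
... | false | false | node b l r = node b l (insert f (k / 2) a r)

find : {A : Set} → ℕ → ℕ → Trie A → Maybe A
find zero    k t          = nothing
find (suc f) k leaf       = nothing
find (suc f) k (node b l r) with k ≡ᵇ 0 | k % 2 ≡ᵇ 0
... | true  | _     = b
... | false | true  = find f (k / 2) l
... | false | false = find f (k / 2) r

-- More than the number of binary digits of any key that occurs.
fuel : ℕ
fuel = 64

tabulateTrie : {A : Set} → List (ℕ × A) → Trie A
tabulateTrie []             = leaf
tabulateTrie ((k , a) ∷ xs) = insert fuel k a (tabulateTrie xs)

_⟨_⟩ : {A : Set} → Trie A → ℕ → Maybe A
t ⟨ k ⟩ = find fuel k t

every : ∀ n → (Fin n → Bool) → Bool
every zero    P = true
every (suc n) P = P zero ∧ every n (P ∘ suc)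

∧-elim : ∀ {a b} → a ∧ b ≡ true → a ≡ true × b ≡ true
∧-elim {true} {true} _ = refl , refl

every-sound : ∀ n P → every n P ≡ true → ∀ i → P i ≡ true
every-sound (suc n) P e zero    = proj₁ (∧-elim e)
every-sound (suc n) P e (suc i) = every-sound n (P ∘ suc) (proj₂ (∧-elim e)) i

everyᵛ : ∀ {A : Set} {n} → Vec A n → (Fin n → A → Bool) → Bool
everyᵛ []       P = true
everyᵛ (a ∷ as) P = P zero a ∧ everyᵛ as (P ∘ suc)

everyᵛ-sound : ∀ {A : Set} {n} (as : Vec A n) P → everyᵛ as P ≡ true → ∀ i → P i (lookup as i) ≡ true
everyᵛ-sound (a ∷ as) P e zero    = proj₁ (∧-elim e)
everyᵛ-sound (a ∷ as) P e (suc i) = everyᵛ-sound as (P ∘ suc) (proj₂ (∧-elim e)) i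

-- Developing base blocks

-- Up to translation, the points number p and p + 1 of a row are the points number q + 1 and q
-- of the row number `partner`.
record Row : Set where
  constructor row
  field
    points  : Vec ℕ 5
    partner : ℕ
    p q     : ℕ

≡ᵇ-sound : ∀ {m n} → (m ≡ᵇ n) ≡ true → m ≡ n
≡ᵇ-sound {m} {n} e = ℕₚ.≡ᵇ⇒≡ m n (Equivalence.from T-≡ e)

does-sound : ∀ {A : Set} (d : Dec A) → does d ≡ true → A
does-sound (yes a) _ = a

_<?ᵇ_ : ∀ {n} → Fin n → Fin n → Bool
p <?ᵇ q = toℕ p <ᵇ toℕ q

<?ᵇ-complete : ∀ {n} {p q : Fin n} → p <ᶠ q → p <?ᵇ q ≡ true
<?ᵇ-complete p<q = Equivalence.to T-≡ (ℕₚ.<⇒<ᵇ p<q)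

<?ᵇ-sound : ∀ {n} {p q : Fin n} → p <?ᵇ q ≡ true → p <ᶠ q
<?ᵇ-sound {p = p} {q} e = ℕₚ.<ᵇ⇒< (toℕ p) (toℕ q) (Equivalence.from T-≡ e)

_⇒ᵇ_ : Bool → Bool → Bool
a ⇒ᵇ b = not a ∨ b

modus-ponens : ∀ {a b} → a ⇒ᵇ b ≡ true → a ≡ true → b ≡ true
modus-ponens e refl = e

collect : ∀ {A B : Set} {n} → (Fin n → A → List B) → Vec A n → List B
collect f []       = []
collect f (a ∷ as) = f zero a ++ collect (f ∘ suc) as

increasingPairs : List (Fin 5 × Fin 5)
increasingPairs = concatMap (λ q → map (_, q) (below q)) (below′ 5)
  where
  below′ : ∀ n → List (Fin n)
  below′ zero    = []
  below′ (suc n) = zero ∷ map suc (below′ n)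
  below : ∀ {n} → Fin n → List (Fin n)
  below zero    = []
  below (suc p) = zero ∷ map suc (below p)

-- Points are pairs (o , y) with y a residue modulo M; the code of (o , y) is o * M + y.
-- The blocks are the translates of the rows in the second coordinate.
module Development (c m r : ℕ) (required : ℕ → ℕ → ℕ → Bool) where
  open Residues m

  C R : ℕ
  C = suc c
  R = suc r

  -- A `Key` is the complete invariant of an ordered pair of points under translation: the two
  -- orbits and the difference. An `Entry` tells where a key occurs: the number of the row and the
  -- two positions.
  Point Key Entry : Set
  Point = Fin C × Fin M
  Key   = Fin C × Fin C × Fin M
  Entry = ℕ × Fin 5 × Fin 5

  orbit : ℕ → ℕ
  orbit x = x / M % C

  diff code : ℕ → ℕ → ℕ
  diff x y = (y % M + (M ∸ x % M)) % M
  code x y = (orbit x * C + orbit y) * M + diff x y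

  -- Up to translation a triple is given by the keys of its two consecutive pairs. Every code of a
  -- pair is below `C * C * M`, the base used here.
  code₃ : ℕ → ℕ → ℕ → ℕ
  code₃ x y z = code x y * (C * C * M) + code y z

  codeOf : Key → ℕ
  codeOf (o , o′ , d) = (toℕ o * C + toℕ o′) * M + toℕ d

  point : ℕ → Point
  point x = (x / M) mod C , x mod M

  key : Point → Point → Key
  key (o , x) (o′ , y) = o , o′ , y ⊖ x

  hasKey : ℕ → ℕ → Key → Bool
  hasKey x y (o , o′ , d) = (orbit x ≡ᵇ toℕ o) ∧ (orbit y ≡ᵇ toℕ o′) ∧ (diff x y ≡ᵇ toℕ d)

  sameKey : ℕ → ℕ → ℕ → ℕ → Bool
  sameKey x y x′ y′ = (orbit x ≡ᵇ orbit x′) ∧ (orbit y ≡ᵇ orbit y′) ∧ (diff x y ≡ᵇ diff x′ y′)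

  toℕ-orbit : ∀ x → toℕ ((x / M) mod C) ≡ orbit x
  toℕ-orbit x = Finₚ.toℕ-fromℕ< (m%n<n (x / M) C)

  toℕ-diff : ∀ x y → toℕ ((y mod M) ⊖ (x mod M)) ≡ diff x y
  toℕ-diff x y = trans (toℕ-mod (toℕ (y mod M) + (M ∸ toℕ (x mod M))))
    (cong₂ (λ a b → (a + (M ∸ b)) % M) (toℕ-mod y) (toℕ-mod x))

  codeOf-key : ∀ x y → codeOf (key (point x) (point y)) ≡ code x y
  codeOf-key x y = cong₂ (λ a b → a * M + b)
    (cong₂ (λ a b → a * C + b) (toℕ-orbit x) (toℕ-orbit y)) (toℕ-diff x y)

  key-≡ : ∀ x y {o o′ d} → orbit x ≡ toℕ o → orbit y ≡ toℕ o′ → diff x y ≡ toℕ d →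
    key (point x) (point y) ≡ (o , o′ , d)
  key-≡ x y e e′ e″ = cong₂ _,_ (Finₚ.toℕ-injective (trans (toℕ-orbit x) e))
    (cong₂ _,_ (Finₚ.toℕ-injective (trans (toℕ-orbit y) e′)) (Finₚ.toℕ-injective (trans (toℕ-diff x y) e″)))

  hasKey-sound : ∀ x y k → hasKey x y k ≡ true → key (point x) (point y) ≡ k
  hasKey-sound x y (o , o′ , d) e = let e₁ , e₂₃ = ∧-elim e ; e₂ , e₃ = ∧-elim e₂₃ in
    key-≡ x y (≡ᵇ-sound e₁) (≡ᵇ-sound e₂) (≡ᵇ-sound e₃)

  sameKey-sound : ∀ x y x′ y′ → sameKey x y x′ y′ ≡ true → key (point x) (point y) ≡ key (point x′) (point y′)
  sameKey-sound x y x′ y′ e = let e₁ , e₂₃ = ∧-elim e ; e₂ , e₃ = ∧-elim e₂₃ in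
    key-≡ x y (trans (≡ᵇ-sound e₁) (sym (toℕ-orbit x′))) (trans (≡ᵇ-sound e₂) (sym (toℕ-orbit y′)))
      (trans (≡ᵇ-sound e₃) (sym (toℕ-diff x′ y′)))

  isEntry : Entry → Maybe Entry → Bool
  isEntry _           nothing               = false
  isEntry (i , p , q) (just (j , p′ , q′)) = (i ≡ᵇ j) ∧ does (p ≟ᶠ p′) ∧ does (q ≟ᶠ q′)

  isEntry-sound : ∀ {e x} → isEntry e x ≡ true → x ≡ just e
  isEntry-sound {i , p , q} {just (j , p′ , q′)} e = let e₁ , e₂₃ = ∧-elim e ; e₂ , e₃ = ∧-elim e₂₃ in
    cong just (sym (cong₂ _,_ (≡ᵇ-sound e₁) (cong₂ _,_ (does-sound (p ≟ᶠ p′) e₂) (does-sound (q ≟ᶠ q′) e₃))))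

  isNumber : ℕ → Maybe ℕ → Bool
  isNumber _ nothing  = false
  isNumber i (just j) = i ≡ᵇ j

  isNumber-sound : ∀ {i x} → isNumber i x ≡ true → x ≡ just i
  isNumber-sound {x = just j} e = cong just (sym (≡ᵇ-sound e))

  module Check (rows : Vec Row R) where

    at : Fin R → Fin 5 → ℕ
    at i p = lookup (Row.points (lookup rows i)) p

    partnerRow : Row → Fin R
    partnerRow ρ = Row.partner ρ mod R

    leftSwap rightSwap : Row → Fin 4
    leftSwap  ρ = Row.p ρ mod 4
    rightSwap ρ = Row.q ρ mod 4

    pairEntries : Fin R → Row → List (ℕ × Entry)
    pairEntries i ρ = (λ n → map (λ (p , q) → code (lookup (Row.points ρ) p) (lookup (Row.points ρ) q) , n , p , q) increasingPairs) (toℕ i)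

    tripleEntries : Fin R → Row → List (ℕ × ⊤)
    tripleEntries i (row (a ∷ b ∷ c ∷ d ∷ e ∷ []) _ _ _) = map (λ k → k , tt)
      (code₃ a b c ∷ code₃ a b d ∷ code₃ a b e ∷ code₃ a c d ∷ code₃ a c e ∷ code₃ a d e ∷
       code₃ b c d ∷ code₃ b c e ∷ code₃ b d e ∷ code₃ c d e ∷ [])

    -- Each pair has to find itself under its own key. Two pairs with the same key would get the
    -- same answer from the table, so they are the same pair of the same row.
    uniqueTest : Trie Entry → ℕ → Row → Fin 5 → Fin 5 → Bool
    uniqueTest t i ρ p q = (p <?ᵇ q) ⇒ᵇ
      (let x = lookup (Row.points ρ) p ; y = lookup (Row.points ρ) q in
       required (orbit x) (orbit y) (diff x y) ∧ isEntry (i , p , q) (t ⟨ code x y ⟩))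

    uniqueRow : Trie Entry → ℕ → Row → Bool
    uniqueRow t i ρ = every 5 λ p → every 5 (uniqueTest t i ρ p)

    uniqueCheck : Trie Entry → Bool
    uniqueCheck t = everyᵛ rows λ i ρ → uniqueRow t (toℕ i) ρ

    -- The entry found is taken as a hint: the pair that it names is compared with the key anew.
    covered : Key → Maybe Entry → Bool
    covered k nothing            = false
    covered k (just (n , p , q)) = (p <?ᵇ q) ∧ hasKey (at (n mod R) p) (at (n mod R) q) k

    coverTest : Trie Entry → Fin C → Fin C → Fin M → Bool
    coverTest t o o′ d = required (toℕ o) (toℕ o′) (toℕ d) ⇒ᵇ covered (o , o′ , d) (t ⟨ codeOf (o , o′ , d) ⟩)

    coverCheck : Trie Entry → Bool
    coverCheck t = every C λ o → every C λ o′ → every M (coverTest t o o′)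

    -- Each triple has to be present and its reversal absent. If a triple were, up to translation,
    -- the reversal of another one, the same lookup would have to succeed and to fail.
    reversalTest : Trie ⊤ → Row → Fin 5 → Fin 5 → Fin 5 → Bool
    reversalTest t ρ p q s = ((p <?ᵇ q) ∧ (q <?ᵇ s)) ⇒ᵇ
      (let x = lookup (Row.points ρ) p ; y = lookup (Row.points ρ) q ; z = lookup (Row.points ρ) s in
       not (is-nothing (t ⟨ code₃ x y z ⟩)) ∧ is-nothing (t ⟨ code₃ z y x ⟩))

    reversalCheck : Trie ⊤ → Bool
    reversalCheck t = everyᵛ rows λ i ρ → every 5 λ p → every 5 λ q → every 5 (reversalTest t ρ p q)

    -- Looking up the partner returns the row itself, so the table is a left inverse of the map from
    -- rows to partners, which is thereby injective.
    partnerTest : Trie ℕ → Fin R → Row → Bool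
    partnerTest t i ρ = isNumber (toℕ i) (t ⟨ toℕ (partnerRow ρ) ⟩) ∧
      sameKey (lookup (Row.points ρ) (inject₁ (leftSwap ρ))) (lookup (Row.points ρ) (suc (leftSwap ρ)))
              (at (partnerRow ρ) (suc (rightSwap ρ))) (at (partnerRow ρ) (inject₁ (rightSwap ρ)))

    partnerCheck : Trie ℕ → Bool
    partnerCheck t = everyᵛ rows (partnerTest t)

    pairTable : Trie Entry
    pairTable = tabulateTrie (collect pairEntries rows)

    tripleTable : Trie ⊤
    tripleTable = tabulateTrie (collect tripleEntries rows)

    partnerTable : Trie ℕ
    partnerTable = tabulateTrie (collect (λ i ρ → (toℕ (partnerRow ρ) , toℕ i) ∷ []) rows)

    pairCheck : Trie Entry → Bool
    pairCheck t = uniqueCheck t ∧ coverCheck t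

  check : Vec Row R → Bool
  check rows = pairCheck pairTable ∧ reversalCheck tripleTable ∧ partnerCheck partnerTable
    where open Check rows

  module _ (Q : Point → Point → Set)
    (sound    : ∀ P P′ → required (toℕ (proj₁ P)) (toℕ (proj₁ P′)) (toℕ (proj₂ P′ ⊖ proj₂ P)) ≡ true → Q P P′)
    (complete : ∀ P P′ → Q P P′ → required (toℕ (proj₁ P)) (toℕ (proj₁ P′)) (toℕ (proj₂ P′ ⊖ proj₂ P)) ≡ true)
    (rows : Vec Row R) (ok : check rows ≡ true) where
    open Check rows

    private
      ok₁ = ∧-elim {pairCheck pairTable} ok
      ok₂ = ∧-elim {uniqueCheck pairTable} (proj₁ ok₁)
      ok₃ = ∧-elim {reversalCheck tripleTable} (proj₂ ok₁)

      translate : Point → Fin M → Point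
      translate (o , y) s = o , y ⊕ s

      B : Fin R × Fin M → Fin 5 → Point
      B (i , s) p = translate (point (at i p)) s

      K : Fin R → Fin 5 → Fin 5 → Key
      K i p q = key (point (at i p)) (point (at i q))

      key-B : ∀ i s p q → key (B (i , s) p) (B (i , s) q) ≡ K i p q
      key-B i s p q = cong (λ d → proj₁ (point (at i p)) , proj₁ (point (at i q)) , d)
        (⊖-translate (proj₂ (point (at i p))) (proj₂ (point (at i q))) s)

      uniqueAt : ∀ i {p q} → p <ᶠ q →
        required (orbit (at i p)) (orbit (at i q)) (diff (at i p) (at i q)) ≡ true ×
        pairTable ⟨ code (at i p) (at i q) ⟩ ≡ just (toℕ i , p , q)
      uniqueAt i {p} {q} p<q =
        let e = modus-ponens
              (every-sound 5 (uniqueTest pairTable (toℕ i) (lookup rows i) p)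
                (every-sound 5 (λ p → every 5 (uniqueTest pairTable (toℕ i) (lookup rows i) p)) (everyᵛ-sound rows _ (proj₁ ok₂) i) p) q) (<?ᵇ-complete p<q)
            e₁ , e₂ = ∧-elim e
        in e₁ , isEntry-sound e₂

      reversalAt : ∀ i {p q s} → p <ᶠ q → q <ᶠ s →
        is-nothing (tripleTable ⟨ code₃ (at i p) (at i q) (at i s) ⟩) ≡ false ×
        is-nothing (tripleTable ⟨ code₃ (at i s) (at i q) (at i p) ⟩) ≡ true
      reversalAt i {p} {q} {s} p<q q<s =
        let e = modus-ponens
                  (every-sound 5 (reversalTest tripleTable (lookup rows i) p q)
                    (every-sound 5 (λ q → every 5 (reversalTest tripleTable (lookup rows i) p q))
                      (every-sound 5 (λ p → every 5 λ q → every 5 (reversalTest tripleTable (lookup rows i) p q))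
                        (everyᵛ-sound rows _ (proj₁ ok₃) i) p) q) s)
                  (cong₂ _∧_ (<?ᵇ-complete p<q) (<?ᵇ-complete q<s))
            e₁ , e₂ = ∧-elim e
        in flip e₁ , e₂
        where
        flip : ∀ {b} → not b ≡ true → b ≡ false
        flip {false} _ = refl

      partnerAt : ∀ i → let ρ = lookup rows i ; j = partnerRow ρ in
        partnerTable ⟨ toℕ j ⟩ ≡ just (toℕ i) ×
        K i (inject₁ (leftSwap ρ)) (suc (leftSwap ρ)) ≡ K j (suc (rightSwap ρ)) (inject₁ (rightSwap ρ))
      partnerAt i = let e₁ , e₂ = ∧-elim (everyᵛ-sound rows (partnerTest partnerTable) (proj₂ ok₃) i) in
        isNumber-sound e₁ ,
        sameKey-sound (at i (inject₁ (leftSwap (lookup rows i)))) (at i (suc (leftSwap (lookup rows i))))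
          (at (partnerRow (lookup rows i)) (suc (rightSwap (lookup rows i))))
          (at (partnerRow (lookup rows i)) (inject₁ (rightSwap (lookup rows i)))) e₂

      K-injective : ∀ {i j p q p′ q′} → p <ᶠ q → p′ <ᶠ q′ → K i p q ≡ K j p′ q′ → _≡_ {A = Entry} (toℕ i , p , q) (toℕ j , p′ , q′)
      K-injective {i} {j} {p} {q} {p′} {q′} p<q p′<q′ e = just-injective (begin
        just (toℕ i , p , q)                           ≡⟨ proj₂ (uniqueAt i p<q) ⟨
        pairTable ⟨ code (at i p) (at i q) ⟩           ≡⟨ cong (pairTable ⟨_⟩) (codeOf-key (at i p) (at i q)) ⟨
        pairTable ⟨ codeOf (K i p q) ⟩                 ≡⟨ cong (λ k → pairTable ⟨ codeOf k ⟩) e ⟩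
        pairTable ⟨ codeOf (K j p′ q′) ⟩               ≡⟨ cong (pairTable ⟨_⟩) (codeOf-key (at j p′) (at j q′)) ⟩
        pairTable ⟨ code (at j p′) (at j q′) ⟩         ≡⟨ proj₂ (uniqueAt j p′<q′) ⟩
        just (toℕ j , p′ , q′)                         ∎)
        where open ≡-Reasoning

      K-B : ∀ {i s j t p q p′ q′} → B (i , s) p ≡ B (j , t) p′ → B (i , s) q ≡ B (j , t) q′ → K i p q ≡ K j p′ q′
      K-B {i} {s} {j} {t} {p} {q} {p′} {q′} e e′ = trans (sym (key-B i s p q)) (trans (cong₂ key e e′) (key-B j t p′ q′))

      translation-unique : ∀ P s t → translate P s ≡ translate P t → s ≡ t
      translation-unique (o , y) s t e = ⊕-cancelˡ y s t (cong proj₂ e)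

      sameBlock : ∀ {i j p p′ s t} → i ≡ j → p ≡ p′ → B (i , s) p ≡ B (j , t) p′ → (i , s) ≡ (j , t)
      sameBlock {i} {p = p} {s = s} {t} refl refl e = cong (i ,_) (translation-unique (point (at i p)) s t e)

      unique′ : ∀ {i j p q p′ q′} → p <ᶠ q → p′ <ᶠ q′ → B i p ≡ B j p′ → B i q ≡ B j q′ → i ≡ j
      unique′ p<q p′<q′ e e′ = let k = K-injective p<q p′<q′ (K-B e e′) in
        sameBlock (Finₚ.toℕ-injective (cong proj₁ k)) (cong (proj₁ ∘ proj₂) k) e

      coverKey : ∀ k → required (toℕ (proj₁ k)) (toℕ (proj₁ (proj₂ k))) (toℕ (proj₂ (proj₂ k))) ≡ true →
        Σ (Fin R) λ i → Σ (Fin 5) λ p → Σ (Fin 5) λ q → p <ᶠ q × K i p q ≡ k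
      coverKey k@(o , o′ , d) req = found (pairTable ⟨ codeOf k ⟩)
        (modus-ponens (every-sound M (coverTest pairTable o o′)
          (every-sound C (λ o′ → every M (coverTest pairTable o o′))
            (every-sound C (λ o → every C λ o′ → every M (coverTest pairTable o o′)) (proj₂ ok₂) o) o′) d) req)
        where
        found : ∀ x → covered k x ≡ true → Σ (Fin R) λ i → Σ (Fin 5) λ p → Σ (Fin 5) λ q → p <ᶠ q × K i p q ≡ k
        found (just (n , p , q)) e = let e₁ , e₂ = ∧-elim e in
          n mod R , p , q , <?ᵇ-sound e₁ , hasKey-sound (at (n mod R) p) (at (n mod R) q) k e₂

      reachSecond : ∀ x y x′ y′ → y ⊖ x ≡ y′ ⊖ x′ → y ⊕ (x′ ⊖ x) ≡ y′
      reachSecond x y x′ y′ d = begin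
        y ⊕ s                   ≡⟨ cong (_⊕ s) (⊕-⊖ x y) ⟨
        (x ⊕ (y ⊖ x)) ⊕ s       ≡⟨ ⊕-assoc x (y ⊖ x) s ⟩
        x ⊕ ((y ⊖ x) ⊕ s)       ≡⟨ cong (x ⊕_) (⊕-comm (y ⊖ x) s) ⟩
        x ⊕ (s ⊕ (y ⊖ x))       ≡⟨ ⊕-assoc x s (y ⊖ x) ⟨
        (x ⊕ s) ⊕ (y ⊖ x)       ≡⟨ cong₂ _⊕_ (⊕-⊖ x x′) d ⟩
        x′ ⊕ (y′ ⊖ x′)          ≡⟨ ⊕-⊖ x′ y′ ⟩
        y′                      ∎
        where
        open ≡-Reasoning
        s = x′ ⊖ x

      reach : ∀ P Q P′ Q′ → key P Q ≡ key P′ Q′ →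
        let s = proj₂ P′ ⊖ proj₂ P in translate P s ≡ P′ × translate Q s ≡ Q′
      reach (o , x) (o′ , y) (o₁ , x′) (o₁′ , y′) e =
        cong₂ _,_ (cong proj₁ e) (⊕-⊖ x x′) ,
        cong₂ _,_ (cong (proj₁ ∘ proj₂) e) (reachSecond x y x′ y′ (cong (proj₂ ∘ proj₂) e))

      code₃-K : ∀ i p q s → code₃ (at i p) (at i q) (at i s) ≡ codeOf (K i p q) * (C * C * M) + codeOf (K i q s)
      code₃-K i p q s = sym (cong₂ (λ a b → a * (C * C * M) + b) (codeOf-key (at i p) (at i q)) (codeOf-key (at i q) (at i s)))

      -- The translation that carries the exchanged pair of the partner row onto that of row `i`.
      -- Adding it to the translation of a block makes the partners agree on actual points, not only
      -- up to translation.
      shift : Fin R → Fin M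
      shift i = let ρ = lookup rows i in
        proj₂ (point (at i (inject₁ (leftSwap ρ)))) ⊖ proj₂ (point (at (partnerRow ρ) (suc (rightSwap ρ))))

    design : Design Q
    design = record
      { Index = Fin R × Fin M
      ; finite = ×-finite (R , ↔-refl) (M , ↔-refl)
      ; block = B
      ; sound = λ (i , s) {p} {q} p<q → sound _ _ (requiredB i s p<q)
      ; cover = λ {P} {P′} r → cover′ P P′ (complete P P′ r)
      ; unique = unique′
      ; noReversal = noRev
      ; partner = λ (i , s) → partnerRow (lookup rows i) , shift i ⊕ s
      ; partner-injective = λ {i} {j} → inj {i} {j}
      ; partner-swap = λ (i , s) → let ρ = lookup rows i ; p = leftSwap ρ ; q = rightSwap ρ
                                       j = partnerRow ρ
                                       e , e′ = reach (point (at j (suc q))) (point (at j (inject₁ q)))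
                                                      (point (at i (inject₁ p))) (point (at i (suc p)))
                                                      (sym (proj₂ (partnerAt i)))
                                   in p , q , shifted (point (at j (suc q))) e s , shifted (point (at j (inject₁ q))) e′ s
      }
      where
      requiredB : ∀ i s {p q} → p <ᶠ q →
        required (toℕ (proj₁ (B (i , s) p))) (toℕ (proj₁ (B (i , s) q))) (toℕ (proj₂ (B (i , s) q) ⊖ proj₂ (B (i , s) p))) ≡ true
      requiredB i s {p} {q} p<q = trans (cong (λ (o , o′ , d) → required (toℕ o) (toℕ o′) (toℕ d)) (key-B i s p q))
        (trans (cong₂ (λ f d → f d) (cong₂ required (toℕ-orbit (at i p)) (toℕ-orbit (at i q))) (toℕ-diff (at i p) (at i q)))
          (proj₁ (uniqueAt i p<q)))
      cover′ : ∀ P P′ → required (toℕ (proj₁ P)) (toℕ (proj₁ P′)) (toℕ (proj₂ P′ ⊖ proj₂ P)) ≡ true →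
        Σ (Fin R × Fin M) λ i → Occurs (B i) P P′
      cover′ P P′ r with coverKey (key P P′) r
      ... | i , p , q , p<q , e = (i , _) , p , q , p<q , reach (point (at i p)) (point (at i q)) P P′ e
      noRev : ∀ {i j p q r p′ q′ r′} → p <ᶠ q → q <ᶠ r → p′ <ᶠ q′ → q′ <ᶠ r′ →
        B i p ≡ B j r′ → B i q ≡ B j q′ → B i r ≡ B j p′ → ⊥
      noRev {i , s} {j , t} {p} {q} {r} {p′} {q′} {r′} p<q q<r p′<q′ q′<r′ e e′ e″ =
        contradiction (trans (sym (proj₁ (reversalAt i p<q q<r)))
          (trans (cong (λ k → is-nothing (tripleTable ⟨ k ⟩)) same) (proj₂ (reversalAt j p′<q′ q′<r′)))) λ ()
        where
        same : code₃ (at i p) (at i q) (at i r) ≡ code₃ (at j r′) (at j q′) (at j p′)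
        same = trans (code₃-K i p q r) (trans
          (cong₂ (λ k l → codeOf k * (C * C * M) + codeOf l)
            (K-B {i} {s} {j} {t} {p} {q} {r′} {q′} e e′) (K-B {i} {s} {j} {t} {q} {r} {q′} {p′} e′ e″))
          (sym (code₃-K j r′ q′ p′)))
      inj : ∀ {i j : Fin R × Fin M} →
        (partnerRow (lookup rows (proj₁ i)) , shift (proj₁ i) ⊕ proj₂ i) ≡
        (partnerRow (lookup rows (proj₁ j)) , shift (proj₁ j) ⊕ proj₂ j) → i ≡ j
      inj {i , s} {j , t} e = sameShift (Finₚ.toℕ-injective (just-injective (trans (sym (proj₁ (partnerAt i)))
        (trans (cong (λ x → partnerTable ⟨ toℕ (proj₁ x) ⟩) e) (proj₁ (partnerAt j)))))) (cong proj₂ e)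
        where
        sameShift : ∀ {i j} → i ≡ j → shift i ⊕ s ≡ shift j ⊕ t → (i , s) ≡ (j , t)
        sameShift {i} refl e = cong (i ,_) (⊕-cancelˡ (shift i) s t e)
      shifted : ∀ P {u P′} → translate P u ≡ P′ → ∀ s → translate P′ s ≡ translate P (u ⊕ s)
      shifted (o , y) {u} refl s = cong (o ,_) (⊕-assoc y u s)

-- Cyclic designs and group divisible designs

lookup-injective : ∀ {A : Set} {xs : List A} → Unique xs → ∀ i j → lookupL xs i ≡ lookupL xs j → i ≡ j
lookup-injective (_ ∷ _)   zero    zero    _ = refl
lookup-injective (x∉ ∷ _)  zero    (suc j) e = contradiction e (All.lookup x∉ (∈-lookup j))
lookup-injective (x∉ ∷ _)  (suc i) zero    e = contradiction (sym e) (All.lookup x∉ (∈-lookup i))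
lookup-injective (_ ∷ xs!) (suc i) (suc j) e = cong suc (lookup-injective xs! i j e)

DD : ℕ → Set₁
DD v = Design {Fin v} _≢_

GDD : ∀ {k} → (Fin k → ℕ) → Set₁
GDD {k} size = Design {Σ (Fin k) (Fin ∘ size)} (λ P Q → proj₁ P ≢ proj₁ Q)

≢⇒not≡ᵇ : ∀ m n → m ≢ n → not (m ≡ᵇ n) ≡ true
≢⇒not≡ᵇ m n m≢n with m ≡ᵇ n in e
... | true  = contradiction (≡ᵇ-sound {m} {n} e) m≢n
... | false = refl

not≡ᵇ⇒≢ : ∀ m n → not (m ≡ᵇ n) ≡ true → m ≢ n
not≡ᵇ⇒≢ m .m e refl with m ≡ᵇ m | ℕₚ.≡⇒≡ᵇ m m refl
not≡ᵇ⇒≢ m .m () refl | true | _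

nonzero crossing : ℕ → ℕ → ℕ → Bool
nonzero  _ _ d  = not (d ≡ᵇ 0)
crossing o o′ _ = not (o ≡ᵇ o′)

module _ (m r : ℕ) (rows : Vec Row (suc r)) (ok : Development.check 0 m r nonzero rows ≡ true) where
  open Residues m

  private
    ⊖-self : ∀ x → x ⊖ x ≡ zero
    ⊖-self x = ⊖-unique x x zero (trans (⊕-comm x zero) (mod-toℕ x))

    D : Design {Fin 1 × Fin M} _≢_
    D = Development.design 0 m r nonzero _≢_
      (λ { (zero , x) (zero , .x) e refl → not≡ᵇ⇒≢ (toℕ (x ⊖ x)) 0 e (cong toℕ (⊖-self x)) })
      (λ { (zero , x) (zero , y) P≢P′ → ≢⇒not≡ᵇ (toℕ (y ⊖ x)) 0 λ e → P≢P′ (cong (zero ,_)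
        (trans (sym (trans (⊕-comm x zero) (mod-toℕ x))) (trans (cong (x ⊕_) (sym (Finₚ.toℕ-injective {i = y ⊖ x} {j = zero} e))) (⊕-⊖ x y)))) })
      rows ok

  -- Here `glue`, applied to a single piece, only renames the points `Fin 1 × Fin M` to `Fin M`.
  cyclicDD : DD (suc m)
  cyclicDD = glue {J = Fin 1} (1 , ↔-refl) (λ _ → D) (λ _ → proj₂) (λ { _ {zero , _} {zero , _} → cong (zero ,_) })
    (λ _ → ≢-sym) (λ { _ {zero , _} {zero , _} P≢P′ e → P≢P′ (cong (zero ,_) e) })
    (λ {x} {y} x≢y → zero , (zero , x) , (zero , y) , refl , refl , λ e → x≢y (cong proj₂ e))
    (λ _ _ → zero) (λ { {zero} _ → refl })

developedGDD : ∀ c m r (rows : Vec Row (suc r)) → Development.check c m r crossing rows ≡ true →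
  GDD {suc c} (λ _ → suc m)
developedGDD c m r rows ok = Development.design c m r crossing (λ P P′ → proj₁ P ≢ proj₁ P′)
  (λ P P′ e e′ → not≡ᵇ⇒≢ (toℕ (proj₁ P)) (toℕ (proj₁ P′)) e (cong toℕ e′))
  (λ P P′ ≢ → ≢⇒not≡ᵇ (toℕ (proj₁ P)) (toℕ (proj₁ P′)) (≢ ∘ Finₚ.toℕ-injective))
  rows ok

-- Rows over a larger group: 0, …, c-1 act on the points by `act`, and `ratio x y t` is the
-- element that carries y to where t carries x, up to translation of the second coordinate.
develop : ∀ n c → (act : ℕ → ℕ → ℕ) → (ratio : ℕ → ℕ → ℕ → ℕ) → Vec Row (suc n) → Vec Row (suc n * c)
develop n c act ratio rows = Vec.concat (Vec.map images rows)
  where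
  images : Row → Vec Row c
  images (row points partner p q) = Vec.map image (Vec.tabulate toℕ)
    where
    x y : ℕ
    x = lookup points (inject₁ (p mod 4))
    y = lookup (Row.points (lookup rows (partner mod suc n))) (suc (q mod 4))
    image : ℕ → Row
    -- The images of row number n are numbered from n * c on, one for each group element; `ratio`
    -- selects the image of the partner row that contains the moved pair. That it does so is left to
    -- `check`, which is run on the whole resulting list.
    image t = row (Vec.map (act t) points) (partner * c + ratio x y t) p q

-- ℤ/((k+1)(m+1)) as k+1 orbits of the subgroup generated by k+1.
cyclicAct : (k m : ℕ) → ℕ → ℕ → ℕ
cyclicAct k m t x = let z = (x + t) % (suc k * suc m) in z % suc k * suc m + z / suc k

cyclicRatio : (k m : ℕ) → ℕ → ℕ → ℕ → ℕ
cyclicRatio k m x y t = (x + t + (suc k * suc m ∸ y)) % suc k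

-- ℤ/(k+1) × ℤ/(m+1).
productAct : (k m : ℕ) → ℕ → ℕ → ℕ
productAct k m t x = (x / suc m + t) % suc k * suc m + x % suc m

productRatio : (k m : ℕ) → ℕ → ℕ → ℕ → ℕ
productRatio k m x y t = (x / suc m + t + (suc k ∸ y / suc m)) % suc k

xor : (bits : ℕ) → ℕ → ℕ → ℕ
xor zero       a b = 0
xor (suc bits) a b = (a + b) % 2 + 2 * xor bits (a / 2) (b / 2)

-- (ℤ/2)³ × ℤ/(m+1).
binaryAct : (m : ℕ) → ℕ → ℕ → ℕ
binaryAct m t x = xor 3 (x / suc m) t * suc m + x % suc m

binaryRatio : (m : ℕ) → ℕ → ℕ → ℕ → ℕ
binaryRatio m x y t = xor 3 (xor 3 (x / suc m) (y / suc m)) t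

-- Wilson's construction

-- A transversal design with eight groups of m points, of which only the first s g
-- points of the g-th group are retained; a line is given by its value in each group.
record TruncatedTD (m : ℕ) (s : Fin 8 → ℕ) : Set where
  field
    value : Fin 8 → Fin m × Fin m → ℕ
    join : ∀ {g h} → g ≢ h → Fin (s g) → Fin (s h) → Fin m × Fin m
    join₁ : ∀ {g h} (g≢h : g ≢ h) y z → value g (join g≢h y z) ≡ toℕ y
    join₂ : ∀ {g h} (g≢h : g ≢ h) y z → value h (join g≢h y z) ≡ toℕ z
    meet : ∀ {g h ℓ ℓ′} → g ≢ h → value g ℓ < s g → value h ℓ < s h →
      value g ℓ ≡ value g ℓ′ → value h ℓ ≡ value h ℓ′ → ℓ ≡ ℓ′

-- Invertibility of `δ` modulo `suc m`, with the inverse and the quotient as witnesses, so that a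
-- concrete instance is an equation of numerals.
Unit : ℕ → ℕ → Set
Unit m δ = Σ ℕ λ u → Σ ℕ λ c → u * δ ≡ 1 + c * suc m

Unit-* : ∀ {m δ ε} → Unit m δ → Unit m ε → Unit m (δ * ε)
Unit-* {m} {δ} {ε} (u , c , e) (u′ , c′ , e′) = u * u′ , c + c′ + c * suc m * c′ , (begin
  u * u′ * (δ * ε)                      ≡⟨ ℕₚ.[m*n]*[o*p]≡[m*o]*[n*p] u u′ δ ε ⟩
  u * δ * (u′ * ε)                      ≡⟨ cong₂ _*_ e e′ ⟩
  (1 + c * suc m) * (1 + c′ * suc m)    ≡⟨ expand c c′ (suc m) ⟩
  1 + (c + c′ + c * suc m * c′) * suc m ∎)
  where
  open ≡-Reasoning
  expand : ∀ c c′ m → (1 + c * m) * (1 + c′ * m) ≡ 1 + (c + c′ + c * m * c′) * m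
  expand = solve-∀

module LinearTD (m : ℕ) where
  open Residues m

  infixl 7 _⊙_
  _⊙_ : ℕ → Fin M → Fin M
  n ⊙ x = (n * toℕ x) mod M

  ⊙-distrib : ∀ k l x → (k + l) ⊙ x ≡ k ⊙ x ⊕ l ⊙ x
  ⊙-distrib k l x = trans (cong (_mod M) (ℕₚ.*-distribʳ-+ (toℕ x) k l)) (sym (mod-⊕ (k * toℕ x) (l * toℕ x)))

  ⊙-⊖ : ∀ {i j} → i ≤ j → ∀ x → j ⊙ x ≡ i ⊙ x ⊕ (j ∸ i) ⊙ x
  ⊙-⊖ {i} {j} i≤j x = trans (cong (_⊙ x) (sym (ℕₚ.m+[n∸m]≡n i≤j))) (⊙-distrib i (j ∸ i) x)

  mod-* : ∀ u k → (u * toℕ (k mod M)) mod M ≡ (u * k) mod M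
  mod-* zero    k = refl
  mod-* (suc u) k = begin
    (toℕ (k mod M) + u * toℕ (k mod M)) mod M           ≡⟨ mod-⊕ (toℕ (k mod M)) (u * toℕ (k mod M)) ⟨
    (toℕ (k mod M) mod M) ⊕ (u * toℕ (k mod M)) mod M   ≡⟨ cong₂ _⊕_ (mod-toℕ (k mod M)) (mod-* u k) ⟩
    (k mod M) ⊕ (u * k) mod M                           ≡⟨ mod-⊕ k (u * k) ⟩
    (k + u * k) mod M                                   ∎
    where open ≡-Reasoning

  module _ {δ : ℕ} (U : Unit m δ) where

    private
      u = proj₁ U
      c = proj₁ (proj₂ U)
      e = proj₂ (proj₂ U)

    inverse : ∀ x → u ⊙ (δ ⊙ x) ≡ x
    inverse x = begin
      u ⊙ (δ ⊙ x)                     ≡⟨ mod-* u (δ * toℕ x) ⟩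
      (u * (δ * toℕ x)) mod M         ≡⟨ cong (_mod M) (ℕₚ.*-assoc u δ (toℕ x)) ⟨
      (u * δ * toℕ x) mod M           ≡⟨ cong (λ k → (k * toℕ x) mod M) e ⟩
      (toℕ x + c * M * toℕ x) mod M   ≡⟨ cong (λ k → (toℕ x + k) mod M) (shuffle c M (toℕ x)) ⟩
      (toℕ x + c * toℕ x * M) mod M   ≡⟨ mod-cong (toℕ x + c * toℕ x * M) (toℕ x) ([m+kn]%n≡m%n (toℕ x) (c * toℕ x) M) ⟩
      toℕ x mod M                     ≡⟨ mod-toℕ x ⟩
      x                               ∎
      where
      open ≡-Reasoning
      shuffle : ∀ a b d → a * b * d ≡ a * d * b
      shuffle = solve-∀

    ⊙-comm : ∀ k l x → k ⊙ (l ⊙ x) ≡ l ⊙ (k ⊙ x)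
    ⊙-comm k l x = trans (mod-* k (l * toℕ x)) (trans (cong (_mod M) (exchange k l (toℕ x))) (sym (mod-* l (k * toℕ x))))
      where
      exchange : ∀ a b d → a * (b * d) ≡ b * (a * d)
      exchange = solve-∀

    inverseʳ : ∀ x → δ ⊙ (u ⊙ x) ≡ x
    inverseʳ x = trans (⊙-comm δ u x) (inverse x)

    ⊙-injective : ∀ x y → δ ⊙ x ≡ δ ⊙ y → x ≡ y
    ⊙-injective x y eq = trans (sym (inverse x)) (trans (cong (u ⊙_) eq) (inverse y))

  -- The affine line of slope `a` and intercept `b`: group `zero` records the slope, group `suc i`
  -- the height above the abscissa `i`. Two heights over `i < j` determine the line because j - i
  -- can be divided by.
  line : Fin 8 → Fin M × Fin M → Fin M
  line zero    (a , b) = a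
  line (suc i) (a , b) = b ⊕ toℕ i ⊙ a

  module _ (s : Fin 8 → ℕ) (s≤ : ∀ g → s g ≤ M)
    -- Only columns with points to join count: when the later group is truncated to nothing, its
    -- differences may fail to be invertible.
    (unit : (i j : Fin 7) → i <ᶠ j → 0 < s (suc j) → Unit m (toℕ j ∸ toℕ i)) where

    private
      Solution : ∀ g h → Fin M → Fin M → Set
      Solution g h y z = Σ (Fin M × Fin M) λ ℓ → line g ℓ ≡ y × line h ℓ ≡ z

      solve-slope : ∀ j y z → Solution zero (suc j) y z
      solve-slope j a z = (a , z ⊖ toℕ j ⊙ a) , refl , ⊖-⊕ (toℕ j ⊙ a) z

      solve-columns : ∀ i j → i <ᶠ j → 0 < s (suc j) → ∀ y z → Solution (suc i) (suc j) y z
      solve-columns i j i<j 0<s y z = (a , b) , ⊖-⊕ (toℕ i ⊙ a) y , (begin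
        b ⊕ toℕ j ⊙ a                            ≡⟨ cong (b ⊕_) (⊙-⊖ (ℕₚ.<⇒≤ i<j) a) ⟩
        b ⊕ (toℕ i ⊙ a ⊕ (toℕ j ∸ toℕ i) ⊙ a)    ≡⟨ ⊕-assoc b (toℕ i ⊙ a) ((toℕ j ∸ toℕ i) ⊙ a) ⟨
        b ⊕ toℕ i ⊙ a ⊕ (toℕ j ∸ toℕ i) ⊙ a      ≡⟨ cong₂ _⊕_ (⊖-⊕ (toℕ i ⊙ a) y) (inverseʳ U (z ⊖ y)) ⟩
        y ⊕ (z ⊖ y)                              ≡⟨ ⊕-⊖ y z ⟩
        z                                        ∎)
        where
        open ≡-Reasoning
        U = unit i j i<j 0<s
        -- Subtracting the equations for the two heights leaves (j - i) a = z - y.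
        a = proj₁ U ⊙ (z ⊖ y)
        b = y ⊖ toℕ i ⊙ a

      flip : ∀ {g h y z} → Solution h g z y → Solution g h y z
      flip (ℓ , e , e′) = ℓ , e′ , e

      0<_ : ∀ {n} → Fin n → 0 < n
      0< zero  = ℕₚ.0<1+n
      0< suc _ = ℕₚ.0<1+n

      solve : ∀ {g h} → g ≢ h → (y : Fin (s g)) (z : Fin (s h)) → ∀ y′ z′ → Solution g h y′ z′
      solve {zero}  {zero}  g≢h _ _ _ _ = contradiction refl g≢h
      solve {zero}  {suc j} _ _ _ y′ z′ = solve-slope j y′ z′
      solve {suc i} {zero}  _ _ _ y′ z′ = flip {suc i} {zero} (solve-slope i z′ y′)
      solve {suc i} {suc j} g≢h y z y′ z′ with Finₚ.<-cmp i j
      ... | tri< i<j _ _  = solve-columns i j i<j (0< z) y′ z′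
      ... | tri≈ _ refl _ = contradiction refl g≢h
      ... | tri> _ _ j<i  = flip {suc i} {suc j} (solve-columns j i j<i (0< y) z′ y′)

      meet-slope : ∀ j ℓ ℓ′ → line zero ℓ ≡ line zero ℓ′ → line (suc j) ℓ ≡ line (suc j) ℓ′ → ℓ ≡ ℓ′
      meet-slope j (a , b) (_ , b′) refl e = cong (a ,_) (⊕-cancelʳ (toℕ j ⊙ a) b b′ e)

      meet-columns : ∀ i j → i <ᶠ j → 0 < s (suc j) → ∀ ℓ ℓ′ →
        line (suc i) ℓ ≡ line (suc i) ℓ′ → line (suc j) ℓ ≡ line (suc j) ℓ′ → ℓ ≡ ℓ′
      meet-columns i j i<j 0<s (a , b) (a′ , b′) e e′ = meet-slope i (a , b) (a′ , b′) a≡a′ e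
        where
        open ≡-Reasoning
        δ = toℕ j ∸ toℕ i
        split : ∀ a b → b ⊕ toℕ j ⊙ a ≡ (b ⊕ toℕ i ⊙ a) ⊕ δ ⊙ a
        split a b = trans (cong (b ⊕_) (⊙-⊖ (ℕₚ.<⇒≤ i<j) a)) (sym (⊕-assoc b (toℕ i ⊙ a) (δ ⊙ a)))
        a≡a′ : a ≡ a′
        a≡a′ = ⊙-injective (unit i j i<j 0<s) a a′ (⊕-cancelˡ (b ⊕ toℕ i ⊙ a) (δ ⊙ a) (δ ⊙ a′) (begin
          (b ⊕ toℕ i ⊙ a) ⊕ δ ⊙ a     ≡⟨ split a b ⟨
          b ⊕ toℕ j ⊙ a               ≡⟨ e′ ⟩
          b′ ⊕ toℕ j ⊙ a′             ≡⟨ split a′ b′ ⟩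
          (b′ ⊕ toℕ i ⊙ a′) ⊕ δ ⊙ a′  ≡⟨ cong (_⊕ δ ⊙ a′) e ⟨
          (b ⊕ toℕ i ⊙ a) ⊕ δ ⊙ a′    ∎))

      meet′ : ∀ {g h ℓ ℓ′} → g ≢ h → 0 < s g → 0 < s h → line g ℓ ≡ line g ℓ′ → line h ℓ ≡ line h ℓ′ → ℓ ≡ ℓ′
      meet′ {zero}  {zero}  g≢h _ _ _ _ = contradiction refl g≢h
      meet′ {zero}  {suc j} {ℓ} {ℓ′} _ _ _ e e′ = meet-slope j ℓ ℓ′ e e′
      meet′ {suc i} {zero}  {ℓ} {ℓ′} _ _ _ e e′ = meet-slope i ℓ ℓ′ e′ e
      meet′ {suc i} {suc j} {ℓ} {ℓ′} g≢h 0<g 0<h e e′ with Finₚ.<-cmp i j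
      ... | tri< i<j _ _  = meet-columns i j i<j 0<h ℓ ℓ′ e e′
      ... | tri≈ _ refl _ = contradiction refl g≢h
      ... | tri> _ _ j<i  = meet-columns j i j<i 0<g ℓ ℓ′ e′ e

      include : ∀ {g} → Fin (s g) → Fin M
      include {g} y = inject≤ y (s≤ g)

    linearTD : TruncatedTD M s
    linearTD = record
      { value = λ g ℓ → toℕ (line g ℓ)
      ; join = λ g≢h y z → proj₁ (solve g≢h y z (include y) (include z))
      ; join₁ = λ g≢h y z → trans (cong toℕ (proj₁ (proj₂ (solve g≢h y z (include y) (include z))))) (Finₚ.toℕ-inject≤ y _)
      ; join₂ = λ g≢h y z → trans (cong toℕ (proj₂ (proj₂ (solve g≢h y z (include y) (include z))))) (Finₚ.toℕ-inject≤ z _)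
      ; meet = λ {g} {h} {ℓ} {ℓ′} g≢h lt lt′ e e′ → meet′ {g} {h} {ℓ} {ℓ′} g≢h (ℕₚ.≤-<-trans z≤n lt) (ℕₚ.≤-<-trans z≤n lt′)
          (Finₚ.toℕ-injective e) (Finₚ.toℕ-injective e′)
      }

-- Filling the groups together with one new point

module _ {k : ℕ} (size : Fin k → ℕ) (D : GDD size) (E : ∀ g → DD (suc (size g))) where

  private
    open Inverse (Σ-Fin↔ k size) using (to; from; strictlyInverseˡ; strictlyInverseʳ)

    N : ℕ
    N = suc (sumFin k size)

    Y : Fin (suc k) → Set
    Y zero    = Σ (Fin k) (Fin ∘ size)
    Y (suc g) = Fin (suc (size g))

    Q : ∀ j → Y j → Y j → Set
    Q zero    P P′ = proj₁ P ≢ proj₁ P′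
    Q (suc g) y y′ = y ≢ y′

    piece : ∀ j → Design (Q j)
    piece zero    = D
    piece (suc g) = E g

    f : ∀ j → Y j → Fin N
    f zero    P       = suc (to P)
    -- `zero` is the new point. It lies in every filled group, so two filled groups share this point
    -- but no pair.
    f (suc g) zero    = zero
    f (suc g) (suc y) = suc (to (g , y))

    to-injective : ∀ {P P′} → to P ≡ to P′ → P ≡ P′
    to-injective e = trans (sym (strictlyInverseʳ _)) (trans (cong from e) (strictlyInverseʳ _))

    f-injective : ∀ j {y z} → f j y ≡ f j z → y ≡ z
    f-injective zero    e = to-injective (Finₚ.suc-injective e)
    f-injective (suc g) {zero}  {zero}  _ = refl
    f-injective (suc g) {suc y} {suc z} e = cong suc (drop (to-injective (Finₚ.suc-injective e)))
      where
      drop : ∀ {y z} → _≡_ {A = Σ (Fin k) (Fin ∘ size)} (g , y) (g , z) → y ≡ z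
      drop refl = refl

    Q⇒≢ : ∀ j {y z} → Q j y z → f j y ≢ f j z
    Q⇒≢ zero    q = λ e → q (cong proj₁ (to-injective (Finₚ.suc-injective e)))
    Q⇒≢ (suc g) q = q ∘ f-injective (suc g)

    Q-sym : ∀ j {y z} → Q j y z → Q j z y
    Q-sym zero    = ≢-sym
    Q-sym (suc g) = ≢-sym

    ownerAt : (P P′ : Σ (Fin k) (Fin ∘ size)) → Fin (suc k)
    ownerAt (g , _) (h , _) with g ≟ᶠ h
    ... | yes _ = suc g
    ... | no _  = zero

    owner : Fin N → Fin N → Fin (suc k)
    -- A default: the new point paired with itself is related in no piece.
    owner zero    zero    = zero
    owner zero    (suc b) = suc (proj₁ (from b))
    owner (suc a) zero    = suc (proj₁ (from a))
    owner (suc a) (suc b) = ownerAt (from a) (from b)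

    owner-correct : ∀ j {y z} → Q j y z → owner (f j y) (f j z) ≡ j
    owner-correct zero {P} {P′} q = trans (cong₂ ownerAt (strictlyInverseʳ P) (strictlyInverseʳ P′)) (differ P P′ q)
      where
      differ : ∀ P P′ → proj₁ P ≢ proj₁ P′ → ownerAt P P′ ≡ zero
      differ (g , _) (h , _) g≢h with g ≟ᶠ h
      ... | yes g≡h = contradiction g≡h g≢h
      ... | no _    = refl
    owner-correct (suc g) {zero}  {zero}  q = contradiction refl q
    owner-correct (suc g) {zero}  {suc z} q = cong (suc ∘ proj₁) (strictlyInverseʳ (g , z))
    owner-correct (suc g) {suc y} {zero}  q = cong (suc ∘ proj₁) (strictlyInverseʳ (g , y))
    owner-correct (suc g) {suc y} {suc z} q = trans (cong₂ ownerAt (strictlyInverseʳ (g , y)) (strictlyInverseʳ (g , z))) same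
      where
      same : ownerAt (g , y) (g , z) ≡ suc g
      same with g ≟ᶠ g
      ... | yes _   = refl
      ... | no g≢g  = contradiction refl g≢g

    located : ∀ {x x′} → x ≢ x′ → Σ (Fin (suc k)) λ j → Σ (Y j) λ y → Σ (Y j) λ y′ → f j y ≡ x × f j y′ ≡ x′ × Q j y y′
    located {zero} {zero} x≢x′ = contradiction refl x≢x′
    located {zero} {suc b} _ = let g , y = from b in
      suc g , zero , suc y , refl , cong suc (strictlyInverseˡ b) , λ ()
    located {suc a} {zero} _ = let g , y = from a in
      suc g , suc y , zero , cong suc (strictlyInverseˡ a) , refl , λ ()
    located {suc a} {suc b} a≢b with proj₁ (from a) ≟ᶠ proj₁ (from b)
    ... | no g≢h = zero , from a , from b , cong suc (strictlyInverseˡ a) , cong suc (strictlyInverseˡ b) , g≢h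
    ... | yes g≡h = within (from a) (from b) g≡h (strictlyInverseˡ a) (strictlyInverseˡ b) a≢b
      where
      within : ∀ P P′ → proj₁ P ≡ proj₁ P′ → ∀ {a b} → to P ≡ a → to P′ ≡ b → suc a ≢ suc b →
        Σ (Fin (suc k)) λ j → Σ (Y j) λ y → Σ (Y j) λ y′ → f j y ≡ suc a × f j y′ ≡ suc b × Q j y y′
      within (g , y) (_ , z) refl refl refl a≢b = suc g , suc y , suc z , refl , refl ,
        λ e → a≢b (cong (λ z → suc (to (g , z))) (Finₚ.suc-injective e))

  fillGroups : DD (suc (sumFin k size))
  fillGroups = glue (suc k , ↔-refl) piece f f-injective Q-sym Q⇒≢ located owner (λ {j} → owner-correct j)

-- Inflating a truncated transversal design

module _ {m : ℕ} {s : Fin 8 → ℕ} (T : TruncatedTD (suc m) s) (w : ℕ)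
  (full : ∀ g ℓ → toℕ g < 5 → TruncatedTD.value T g ℓ < s g)
  (ingredient : ∀ k → k ≤ 3 → GDD {5 + k} (λ _ → w)) where
  open TruncatedTD T

  private
    Line : Set
    Line = Fin (suc m) × Fin (suc m)

    meets? : ∀ ℓ (g : Fin 8) → Dec (value g ℓ < s g)
    meets? ℓ g = value g ℓ <? s g

    groups : Line → List (Fin 8)
    groups ℓ = filter (meets? ℓ) (allFin 8)

    -- The first five groups pass the test by `full` and not by computation, hence the explicit
    -- steps. The bound 3 counts the groups left to the filter.
    length-groups : ∀ ℓ → Σ ℕ λ k → k ≤ 3 × length (groups ℓ) ≡ 5 + k
    length-groups ℓ = length (filter (meets? ℓ) rest) , Listₚ.length-filter (meets? ℓ) rest , cong length (trans
        (accept zero _ (s≤s z≤n)) (cong (zero ∷_) (trans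
        (accept (suc zero) _ (s≤s (s≤s z≤n))) (cong (suc zero ∷_) (trans
        (accept (suc (suc zero)) _ (s≤s (s≤s (s≤s z≤n)))) (cong (suc (suc zero) ∷_) (trans
        (accept (suc (suc (suc zero))) _ (s≤s (s≤s (s≤s (s≤s z≤n))))) (cong (suc (suc (suc zero)) ∷_)
        (accept (suc (suc (suc (suc zero)))) rest (s≤s (s≤s (s≤s (s≤s (s≤s z≤n))))))))))))))
      where
      rest : List (Fin 8)
      rest = suc (suc (suc (suc (suc zero)))) ∷ suc (suc (suc (suc (suc (suc zero))))) ∷ suc (suc (suc (suc (suc (suc (suc zero)))))) ∷ []
      accept : ∀ g xs → toℕ g < 5 → filter (meets? ℓ) (g ∷ xs) ≡ g ∷ filter (meets? ℓ) xs
      accept g xs g<5 = Listₚ.filter-accept (meets? ℓ) (full g ℓ g<5)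

    Y : Line → Set
    Y ℓ = Fin (length (groups ℓ)) × Fin w

    piece : ∀ ℓ → Design {Y ℓ} (λ P Q → proj₁ P ≢ proj₁ Q)
    piece ℓ = let k , k≤3 , e = length-groups ℓ in
      subst (λ n → GDD {n} (λ _ → w)) (sym e) (ingredient k k≤3)

    X : Set
    X = Σ (Fin 8) λ g → Fin (s g * w)

    group : ∀ ℓ → Fin (length (groups ℓ)) → Fin 8
    group ℓ = lookupL (groups ℓ)

    meets : ∀ ℓ j → value (group ℓ j) ℓ < s (group ℓ j)
    meets ℓ j = proj₂ (∈-filter⁻ (meets? ℓ) {xs = allFin 8} (∈-lookup {xs = groups ℓ} j))

    place : ∀ g ℓ → value g ℓ < s g → Fin w → X
    place g ℓ p x = g , combine (fromℕ< p) x

    f : ∀ ℓ → Y ℓ → X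
    f ℓ (j , x) = place (group ℓ j) ℓ (meets ℓ j) x

    group-injective : ∀ ℓ {j j′} → group ℓ j ≡ group ℓ j′ → j ≡ j′
    group-injective ℓ = lookup-injective (Uniqueₚ.filter⁺ (meets? ℓ) (Uniqueₚ.allFin⁺ 8)) _ _

    weight : X → Fin w
    weight (g , a) = proj₂ (remQuot {s g} w a)

    f-injective : ∀ ℓ {y z} → f ℓ y ≡ f ℓ z → y ≡ z
    f-injective ℓ {j , x} {j′ , x′} e = cong₂ _,_ (group-injective ℓ (cong proj₁ e))
      (trans (sym (cong proj₂ (Finₚ.remQuot-combine (fromℕ< (meets ℓ j)) x)))
        (trans (cong weight e) (cong proj₂ (Finₚ.remQuot-combine (fromℕ< (meets ℓ j′)) x′))))

    owner : X → X → Line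
    owner (g , a) (h , b) with g ≟ᶠ h
    -- A default for two points of one group, a pair that no line covers.
    ... | yes _  = zero , zero
    ... | no g≢h = join g≢h (proj₁ (remQuot {s g} w a)) (proj₁ (remQuot {s h} w b))

    owner-place : ∀ {g h ℓ} → g ≢ h → ∀ p q x y → owner (place g ℓ p x) (place h ℓ q y) ≡ ℓ
    owner-place {g} {h} {ℓ} g≢h p q x y with g ≟ᶠ h
    ... | yes g≡h = contradiction g≡h g≢h
    ... | no g≢h = sym (meet g≢h p q (sym (trans (join₁ g≢h _ _) (at p x))) (sym (trans (join₂ g≢h _ _) (at q y))))
      where
      at : ∀ {g} (p : value g ℓ < s g) x → toℕ (proj₁ (remQuot {s g} w (combine (fromℕ< p) x))) ≡ value g ℓ
      at p x = trans (cong (toℕ ∘ proj₁) (Finₚ.remQuot-combine (fromℕ< p) x)) (Finₚ.toℕ-fromℕ< p)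

    locate : ∀ {x x′} → proj₁ x ≢ proj₁ x′ → Σ Line λ ℓ → Σ (Y ℓ) λ y → Σ (Y ℓ) λ y′ →
      f ℓ y ≡ x × f ℓ y′ ≡ x′ × proj₁ y ≢ proj₁ y′
    locate {g , a} {h , b} g≢h = ℓ , (j , proj₂ (remQuot {s g} w a)) , (j′ , proj₂ (remQuot {s h} w b)) ,
        placed (meets ℓ j) ej a (join₁ g≢h y z) , placed (meets ℓ j′) ej′ b (join₂ g≢h y z) ,
        λ e → g≢h (trans (sym ej) (trans (cong (group ℓ) e) ej′))
      where
      y = proj₁ (remQuot {s g} w a)
      z = proj₁ (remQuot {s h} w b)
      ℓ = join g≢h y z
      member : ∀ {g} (y : Fin (s g)) → value g ℓ ≡ toℕ y → g ∈ groups ℓ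
      member y e = ∈-filter⁺ (meets? ℓ) (∈-allFin _) (ℕₚ.≤-<-trans (ℕₚ.≤-reflexive e) (Finₚ.toℕ<n y))
      j  = index (member y (join₁ g≢h y z))
      j′ = index (member z (join₂ g≢h y z))
      ej : group ℓ j ≡ g
      ej = sym (lookup-index (member y (join₁ g≢h y z)))
      ej′ : group ℓ j′ ≡ h
      ej′ = sym (lookup-index (member z (join₂ g≢h y z)))
      placed : ∀ {g g′} (p : value g′ ℓ < s g′) → g′ ≡ g → (a : Fin (s g * w)) →
        value g ℓ ≡ toℕ (proj₁ (remQuot {s g} w a)) → place g′ ℓ p (proj₂ (remQuot {s g} w a)) ≡ (g , a)
      placed {g} p refl a e = cong (g ,_) (trans
        (cong (λ y → combine y (proj₂ (remQuot {s g} w a))) (Finₚ.toℕ-injective (trans (Finₚ.toℕ-fromℕ< p) e)))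
        (Finₚ.combine-remQuot {s g} w a))

  -- Points of different groups lie over exactly one line, so the ingredients on the lines are
  -- disjoint. Pairs inside a group remain for `fillGroups`.
  inflate : GDD {8} (λ g → s g * w)
  inflate = glue (×-finite (suc m , ↔-refl) (suc m , ↔-refl)) piece f f-injective
    (λ ℓ → ≢-sym) (λ ℓ q e → q (group-injective ℓ e)) locate owner
    (λ {ℓ} {y} {z} q → owner-place (q ∘ group-injective ℓ) (meets ℓ (proj₁ y)) (meets ℓ (proj₁ z)) (proj₂ y) (proj₂ z))

-- Small designs

-- A design on v = 10 n + 1 points has n v blocks, hence n rows modulo v. Here 0 1 4 14 16 is a
-- planar difference set modulo 21: read in order it yields one of d and -d for each nonzero d, and
-- its negative yields the other. Many lists below likewise consist of blocks and their negatives,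
-- whose first gaps are opposite; in others the rows are orbits under a group of multipliers.
dd2 : DD 21
dd2 = cyclicDD 20 1 rows refl
  where
  rows : Vec Row 2
  rows =
    row (0 ∷ 1 ∷ 4 ∷ 14 ∷ 16 ∷ []) 1 0 0 ∷
    row (0 ∷ 20 ∷ 17 ∷ 7 ∷ 5 ∷ []) 0 0 0 ∷
    []

-- The rows are the multiples of the first one by 1, 5 and 25, the cube roots of unity modulo 31.
-- The partner row is the multiple by 25, so partners run through a cycle of length three.
dd3 : DD 31
dd3 = cyclicDD 30 2 rows refl
  where
  rows : Vec Row 3
  rows =
    row (2 ∷ 22 ∷ 15 ∷ 0 ∷ 1 ∷ []) 2 0 1 ∷
    row (10 ∷ 17 ∷ 13 ∷ 0 ∷ 5 ∷ []) 0 0 1 ∷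
    row (19 ∷ 23 ∷ 3 ∷ 0 ∷ 25 ∷ []) 1 0 1 ∷
    []

dd4 : DD 41
dd4 = cyclicDD 40 3 rows refl
  where
  rows : Vec Row 4
  rows =
    row (0 ∷ 1 ∷ 4 ∷ 11 ∷ 29 ∷ []) 1 0 0 ∷
    row (0 ∷ 40 ∷ 37 ∷ 30 ∷ 12 ∷ []) 0 0 0 ∷
    row (0 ∷ 2 ∷ 8 ∷ 17 ∷ 22 ∷ []) 3 0 0 ∷
    row (0 ∷ 39 ∷ 33 ∷ 24 ∷ 19 ∷ []) 2 0 0 ∷
    []

dd5 : DD 51
dd5 = cyclicDD 50 4 rows refl
  where
  rows : Vec Row 5
  rows =
    row (43 ∷ 19 ∷ 41 ∷ 0 ∷ 1 ∷ []) 2 2 3 ∷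
    row (28 ∷ 46 ∷ 0 ∷ 15 ∷ 31 ∷ []) 4 1 3 ∷
    row (9 ∷ 0 ∷ 6 ∷ 2 ∷ 43 ∷ []) 0 3 2 ∷
    row (16 ∷ 0 ∷ 30 ∷ 29 ∷ 4 ∷ []) 1 0 3 ∷
    row (30 ∷ 0 ∷ 7 ∷ 24 ∷ 19 ∷ []) 3 0 1 ∷
    []

dd6 : DD 61
dd6 = cyclicDD 60 5 rows refl
  where
  rows : Vec Row 6
  rows =
    row (0 ∷ 1 ∷ 42 ∷ 47 ∷ 58 ∷ []) 1 0 0 ∷
    row (0 ∷ 60 ∷ 19 ∷ 14 ∷ 3 ∷ []) 0 0 0 ∷
    row (0 ∷ 28 ∷ 30 ∷ 36 ∷ 54 ∷ []) 3 0 0 ∷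
    row (0 ∷ 33 ∷ 31 ∷ 25 ∷ 7 ∷ []) 2 0 0 ∷
    row (0 ∷ 9 ∷ 21 ∷ 38 ∷ 48 ∷ []) 5 0 0 ∷
    row (0 ∷ 52 ∷ 40 ∷ 23 ∷ 13 ∷ []) 4 0 0 ∷
    []

dd7 : DD 71
dd7 = cyclicDD 70 6 rows refl
  where
  rows : Vec Row 7
  rows =
    row (7 ∷ 63 ∷ 2 ∷ 0 ∷ 1 ∷ []) 4 0 1 ∷
    row (69 ∷ 53 ∷ 40 ∷ 0 ∷ 20 ∷ []) 2 0 1 ∷
    row (68 ∷ 44 ∷ 60 ∷ 0 ∷ 30 ∷ []) 5 0 1 ∷
    row (11 ∷ 28 ∷ 64 ∷ 0 ∷ 32 ∷ []) 6 0 1 ∷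
    row (46 ∷ 59 ∷ 3 ∷ 0 ∷ 37 ∷ []) 1 0 1 ∷
    row (31 ∷ 66 ∷ 19 ∷ 0 ∷ 45 ∷ []) 3 0 1 ∷
    row (52 ∷ 42 ∷ 25 ∷ 0 ∷ 48 ∷ []) 0 0 1 ∷
    []

dd8 : DD 81
dd8 = cyclicDD 80 7 rows refl
  where
  rows : Vec Row 8
  rows =
    row (0 ∷ 1 ∷ 51 ∷ 59 ∷ 65 ∷ []) 1 0 0 ∷
    row (0 ∷ 80 ∷ 30 ∷ 22 ∷ 16 ∷ []) 0 0 0 ∷
    row (0 ∷ 4 ∷ 29 ∷ 48 ∷ 61 ∷ []) 3 0 0 ∷
    row (0 ∷ 77 ∷ 52 ∷ 33 ∷ 20 ∷ []) 2 0 0 ∷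
    row (0 ∷ 11 ∷ 21 ∷ 39 ∷ 66 ∷ []) 5 0 0 ∷
    row (0 ∷ 70 ∷ 60 ∷ 42 ∷ 15 ∷ []) 4 0 0 ∷
    row (0 ∷ 9 ∷ 2 ∷ 43 ∷ 78 ∷ []) 7 0 0 ∷
    row (0 ∷ 72 ∷ 79 ∷ 38 ∷ 3 ∷ []) 6 0 0 ∷
    []

dd10 : DD 101
dd10 = cyclicDD 100 9 rows refl
  where
  rows : Vec Row 10
  rows =
    row (0 ∷ 1 ∷ 35 ∷ 40 ∷ 77 ∷ []) 1 0 0 ∷
    row (0 ∷ 100 ∷ 66 ∷ 61 ∷ 24 ∷ []) 0 0 0 ∷
    row (0 ∷ 46 ∷ 53 ∷ 79 ∷ 98 ∷ []) 3 0 0 ∷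
    row (0 ∷ 55 ∷ 48 ∷ 22 ∷ 3 ∷ []) 2 0 0 ∷
    row (0 ∷ 17 ∷ 2 ∷ 30 ∷ 95 ∷ []) 5 0 0 ∷
    row (0 ∷ 84 ∷ 99 ∷ 71 ∷ 6 ∷ []) 4 0 0 ∷
    row (0 ∷ 44 ∷ 54 ∷ 58 ∷ 85 ∷ []) 7 0 0 ∷
    row (0 ∷ 57 ∷ 47 ∷ 43 ∷ 16 ∷ []) 6 0 0 ∷
    row (0 ∷ 11 ∷ 20 ∷ 32 ∷ 83 ∷ []) 9 0 0 ∷
    row (0 ∷ 90 ∷ 81 ∷ 69 ∷ 18 ∷ []) 8 0 0 ∷
    []

dd11 : DD 111
dd11 = cyclicDD 110 10 rows refl
  where
  rows : Vec Row 11
  rows =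
    row (0 ∷ 93 ∷ 42 ∷ 87 ∷ 37 ∷ []) 1 0 0 ∷
    row (0 ∷ 18 ∷ 69 ∷ 24 ∷ 74 ∷ []) 0 0 0 ∷
    row (92 ∷ 54 ∷ 88 ∷ 0 ∷ 2 ∷ []) 7 2 0 ∷
    row (32 ∷ 96 ∷ 103 ∷ 0 ∷ 20 ∷ []) 5 2 0 ∷
    row (98 ∷ 72 ∷ 31 ∷ 0 ∷ 89 ∷ []) 6 2 0 ∷
    row (7 ∷ 110 ∷ 0 ∷ 97 ∷ 53 ∷ []) 9 1 3 ∷
    row (70 ∷ 101 ∷ 0 ∷ 82 ∷ 86 ∷ []) 10 1 3 ∷
    row (34 ∷ 11 ∷ 0 ∷ 43 ∷ 83 ∷ []) 8 1 3 ∷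
    row (97 ∷ 81 ∷ 0 ∷ 22 ∷ 33 ∷ []) 4 2 3 ∷
    row (82 ∷ 33 ∷ 0 ∷ 109 ∷ 108 ∷ []) 2 2 3 ∷
    row (43 ∷ 108 ∷ 0 ∷ 91 ∷ 81 ∷ []) 3 2 3 ∷
    []

-- Modulo 121 the number 3 has order 5. The first row lists the successive multiples of 104 by
-- powers of 3, the second is its negative, and the other ten form the orbit of a single row under 3
-- and -1.
dd12 : DD 121
dd12 = cyclicDD 120 11 rows refl
  where
  rows : Vec Row 12
  rows =
    row (104 ∷ 70 ∷ 89 ∷ 25 ∷ 75 ∷ []) 1 0 0 ∷
    row (17 ∷ 51 ∷ 32 ∷ 96 ∷ 46 ∷ []) 0 0 0 ∷
    row (0 ∷ 2 ∷ 9 ∷ 32 ∷ 110 ∷ []) 11 0 0 ∷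
    row (0 ∷ 6 ∷ 27 ∷ 96 ∷ 88 ∷ []) 10 0 0 ∷
    row (0 ∷ 18 ∷ 81 ∷ 46 ∷ 22 ∷ []) 9 0 0 ∷
    row (0 ∷ 54 ∷ 1 ∷ 17 ∷ 66 ∷ []) 8 0 0 ∷
    row (0 ∷ 80 ∷ 118 ∷ 70 ∷ 44 ∷ []) 7 0 0 ∷
    row (0 ∷ 41 ∷ 3 ∷ 51 ∷ 77 ∷ []) 6 0 0 ∷
    row (0 ∷ 67 ∷ 120 ∷ 104 ∷ 55 ∷ []) 5 0 0 ∷
    row (0 ∷ 103 ∷ 40 ∷ 75 ∷ 99 ∷ []) 4 0 0 ∷
    row (0 ∷ 115 ∷ 94 ∷ 25 ∷ 33 ∷ []) 3 0 0 ∷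
    row (0 ∷ 119 ∷ 112 ∷ 89 ∷ 11 ∷ []) 2 0 0 ∷
    []

dd13 : DD 131
dd13 = cyclicDD 130 12 rows refl
  where
  rows : Vec Row 13
  rows =
    row (119 ∷ 13 ∷ 2 ∷ 0 ∷ 1 ∷ []) 4 1 2 ∷
    row (56 ∷ 114 ∷ 78 ∷ 0 ∷ 39 ∷ []) 12 1 2 ∷
    row (115 ∷ 61 ∷ 90 ∷ 0 ∷ 45 ∷ []) 7 1 2 ∷
    row (31 ∷ 21 ∷ 104 ∷ 0 ∷ 52 ∷ []) 10 1 2 ∷
    row (66 ∷ 125 ∷ 120 ∷ 0 ∷ 60 ∷ []) 6 1 2 ∷
    row (42 ∷ 20 ∷ 124 ∷ 0 ∷ 62 ∷ []) 3 1 2 ∷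
    row (30 ∷ 33 ∷ 126 ∷ 0 ∷ 63 ∷ []) 11 1 2 ∷
    row (88 ∷ 123 ∷ 29 ∷ 0 ∷ 80 ∷ []) 8 1 2 ∷
    row (40 ∷ 44 ∷ 37 ∷ 0 ∷ 84 ∷ []) 5 1 2 ∷
    row (122 ∷ 108 ∷ 67 ∷ 0 ∷ 99 ∷ []) 2 1 2 ∷
    row (26 ∷ 81 ∷ 83 ∷ 0 ∷ 107 ∷ []) 0 1 2 ∷
    row (97 ∷ 15 ∷ 93 ∷ 0 ∷ 112 ∷ []) 1 1 2 ∷
    row (85 ∷ 28 ∷ 95 ∷ 0 ∷ 113 ∷ []) 9 1 2 ∷
    []

dd14 : DD 141
dd14 = cyclicDD 140 13 rows refl
  where
  rows : Vec Row 14
  rows =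
    row (0 ∷ 49 ∷ 6 ∷ 80 ∷ 124 ∷ []) 1 0 0 ∷
    row (0 ∷ 92 ∷ 135 ∷ 61 ∷ 17 ∷ []) 0 0 0 ∷
    row (0 ∷ 2 ∷ 26 ∷ 35 ∷ 125 ∷ []) 3 0 0 ∷
    row (0 ∷ 139 ∷ 115 ∷ 106 ∷ 16 ∷ []) 2 0 0 ∷
    row (0 ∷ 3 ∷ 7 ∷ 103 ∷ 116 ∷ []) 5 0 0 ∷
    row (0 ∷ 138 ∷ 134 ∷ 38 ∷ 25 ∷ []) 4 0 0 ∷
    row (0 ∷ 53 ∷ 5 ∷ 39 ∷ 68 ∷ []) 7 0 0 ∷
    row (0 ∷ 88 ∷ 136 ∷ 102 ∷ 73 ∷ []) 6 0 0 ∷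
    row (0 ∷ 52 ∷ 60 ∷ 72 ∷ 122 ∷ []) 9 0 0 ∷
    row (0 ∷ 89 ∷ 81 ∷ 69 ∷ 19 ∷ []) 8 0 0 ∷
    row (0 ∷ 59 ∷ 1 ∷ 22 ∷ 86 ∷ []) 11 0 0 ∷
    row (0 ∷ 82 ∷ 140 ∷ 119 ∷ 55 ∷ []) 10 0 0 ∷
    row (0 ∷ 10 ∷ 40 ∷ 94 ∷ 105 ∷ []) 13 0 0 ∷
    row (0 ∷ 131 ∷ 101 ∷ 47 ∷ 36 ∷ []) 12 0 0 ∷
    []

dd15 : DD 151
dd15 = cyclicDD 150 14 rows refl
  where
  rows : Vec Row 15
  rows =
    row (28 ∷ 3 ∷ 0 ∷ 1 ∷ 82 ∷ []) 6 0 3 ∷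
    row (56 ∷ 6 ∷ 0 ∷ 2 ∷ 13 ∷ []) 9 0 3 ∷
    row (112 ∷ 12 ∷ 0 ∷ 4 ∷ 26 ∷ []) 14 0 3 ∷
    row (73 ∷ 24 ∷ 0 ∷ 8 ∷ 52 ∷ []) 12 0 3 ∷
    row (146 ∷ 48 ∷ 0 ∷ 16 ∷ 104 ∷ []) 8 0 3 ∷
    row (79 ∷ 57 ∷ 0 ∷ 19 ∷ 48 ∷ []) 2 0 3 ∷
    row (141 ∷ 96 ∷ 0 ∷ 32 ∷ 57 ∷ []) 13 0 3 ∷
    row (7 ∷ 114 ∷ 0 ∷ 38 ∷ 96 ∷ []) 3 0 3 ∷
    row (142 ∷ 26 ∷ 0 ∷ 59 ∷ 6 ∷ []) 10 0 3 ∷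
    row (131 ∷ 41 ∷ 0 ∷ 64 ∷ 114 ∷ []) 11 0 3 ∷
    row (14 ∷ 77 ∷ 0 ∷ 76 ∷ 41 ∷ []) 4 0 3 ∷
    row (115 ∷ 104 ∷ 0 ∷ 85 ∷ 24 ∷ []) 1 0 3 ∷
    row (71 ∷ 13 ∷ 0 ∷ 105 ∷ 3 ∷ []) 7 0 3 ∷
    row (133 ∷ 52 ∷ 0 ∷ 118 ∷ 12 ∷ []) 0 0 3 ∷
    row (111 ∷ 82 ∷ 0 ∷ 128 ∷ 77 ∷ []) 5 0 3 ∷
    []

dd16 : DD 161
dd16 = cyclicDD 160 15 rows refl
  where
  rows : Vec Row 16
  rows =
    row (0 ∷ 80 ∷ 95 ∷ 147 ∷ 159 ∷ []) 1 0 0 ∷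
    row (0 ∷ 81 ∷ 66 ∷ 14 ∷ 2 ∷ []) 0 0 0 ∷
    row (0 ∷ 78 ∷ 58 ∷ 120 ∷ 154 ∷ []) 3 0 0 ∷
    row (0 ∷ 83 ∷ 103 ∷ 41 ∷ 7 ∷ []) 2 0 0 ∷
    row (0 ∷ 3 ∷ 11 ∷ 21 ∷ 136 ∷ []) 5 0 0 ∷
    row (0 ∷ 158 ∷ 150 ∷ 140 ∷ 25 ∷ []) 4 0 0 ∷
    row (0 ∷ 4 ∷ 26 ∷ 128 ∷ 134 ∷ []) 7 0 0 ∷
    row (0 ∷ 157 ∷ 135 ∷ 33 ∷ 27 ∷ []) 6 0 0 ∷
    row (0 ∷ 17 ∷ 40 ∷ 72 ∷ 117 ∷ []) 9 0 0 ∷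
    row (0 ∷ 144 ∷ 121 ∷ 89 ∷ 44 ∷ []) 8 0 0 ∷
    row (0 ∷ 1 ∷ 50 ∷ 88 ∷ 93 ∷ []) 11 0 0 ∷
    row (0 ∷ 160 ∷ 111 ∷ 73 ∷ 68 ∷ []) 10 0 0 ∷
    row (0 ∷ 9 ∷ 39 ∷ 63 ∷ 110 ∷ []) 13 0 0 ∷
    row (0 ∷ 152 ∷ 122 ∷ 98 ∷ 51 ∷ []) 12 0 0 ∷
    row (0 ∷ 13 ∷ 29 ∷ 48 ∷ 104 ∷ []) 15 0 0 ∷
    row (0 ∷ 148 ∷ 132 ∷ 113 ∷ 57 ∷ []) 14 0 0 ∷
    []

dd17 : DD 171
dd17 = cyclicDD 170 16 rows refl
  where
  rows : Vec Row 17
  rows =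
    row (0 ∷ 139 ∷ 17 ∷ 13 ∷ 126 ∷ []) 2 0 2 ∷
    row (0 ∷ 4 ∷ 62 ∷ 148 ∷ 27 ∷ []) 0 0 2 ∷
    row (0 ∷ 85 ∷ 35 ∷ 67 ∷ 18 ∷ []) 1 0 2 ∷
    row (0 ∷ 84 ∷ 99 ∷ 118 ∷ 165 ∷ []) 4 0 0 ∷
    row (0 ∷ 87 ∷ 72 ∷ 53 ∷ 6 ∷ []) 3 0 0 ∷
    row (0 ∷ 5 ∷ 29 ∷ 73 ∷ 80 ∷ []) 6 0 0 ∷
    row (0 ∷ 166 ∷ 142 ∷ 98 ∷ 91 ∷ []) 5 0 0 ∷
    row (0 ∷ 3 ∷ 43 ∷ 57 ∷ 82 ∷ []) 8 0 0 ∷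
    row (0 ∷ 168 ∷ 128 ∷ 114 ∷ 89 ∷ []) 7 0 0 ∷
    row (0 ∷ 2 ∷ 28 ∷ 61 ∷ 102 ∷ []) 10 0 0 ∷
    row (0 ∷ 169 ∷ 143 ∷ 110 ∷ 69 ∷ []) 9 0 0 ∷
    row (0 ∷ 1 ∷ 10 ∷ 135 ∷ 151 ∷ []) 12 0 0 ∷
    row (0 ∷ 170 ∷ 161 ∷ 36 ∷ 20 ∷ []) 11 0 0 ∷
    row (0 ∷ 11 ∷ 42 ∷ 94 ∷ 106 ∷ []) 14 0 0 ∷
    row (0 ∷ 160 ∷ 129 ∷ 77 ∷ 65 ∷ []) 13 0 0 ∷
    row (0 ∷ 8 ∷ 56 ∷ 78 ∷ 116 ∷ []) 16 0 0 ∷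
    row (0 ∷ 163 ∷ 115 ∷ 93 ∷ 55 ∷ []) 15 0 0 ∷
    []

dd18 : DD 181
dd18 = cyclicDD 180 17 rows refl
  where
  rows : Vec Row 18
  rows =
    row (0 ∷ 1 ∷ 30 ∷ 84 ∷ 100 ∷ []) 5 0 0 ∷
    row (0 ∷ 48 ∷ 173 ∷ 50 ∷ 94 ∷ []) 4 0 0 ∷
    row (0 ∷ 49 ∷ 22 ∷ 134 ∷ 13 ∷ []) 3 0 0 ∷
    row (0 ∷ 132 ∷ 159 ∷ 47 ∷ 168 ∷ []) 2 0 0 ∷
    row (0 ∷ 133 ∷ 8 ∷ 131 ∷ 87 ∷ []) 1 0 0 ∷
    row (0 ∷ 180 ∷ 151 ∷ 97 ∷ 81 ∷ []) 0 0 0 ∷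
    row (0 ∷ 5 ∷ 11 ∷ 25 ∷ 37 ∷ []) 11 0 0 ∷
    row (0 ∷ 59 ∷ 166 ∷ 114 ∷ 147 ∷ []) 10 0 0 ∷
    row (0 ∷ 64 ∷ 177 ∷ 139 ∷ 3 ∷ []) 9 0 0 ∷
    row (0 ∷ 117 ∷ 4 ∷ 42 ∷ 178 ∷ []) 8 0 0 ∷
    row (0 ∷ 122 ∷ 15 ∷ 67 ∷ 34 ∷ []) 7 0 0 ∷
    row (0 ∷ 176 ∷ 170 ∷ 156 ∷ 144 ∷ []) 6 0 0 ∷
    row (0 ∷ 21 ∷ 39 ∷ 92 ∷ 116 ∷ []) 17 0 0 ∷
    row (0 ∷ 103 ∷ 62 ∷ 72 ∷ 138 ∷ []) 16 0 0 ∷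
    row (0 ∷ 124 ∷ 101 ∷ 164 ∷ 73 ∷ []) 15 0 0 ∷
    row (0 ∷ 57 ∷ 80 ∷ 17 ∷ 108 ∷ []) 14 0 0 ∷
    row (0 ∷ 78 ∷ 119 ∷ 109 ∷ 43 ∷ []) 13 0 0 ∷
    row (0 ∷ 160 ∷ 142 ∷ 89 ∷ 65 ∷ []) 12 0 0 ∷
    []

dd19 : DD 191
dd19 = cyclicDD 190 18 rows refl
  where
  rows : Vec Row 19
  rows =
    row (20 ∷ 2 ∷ 0 ∷ 59 ∷ 1 ∷ []) 12 1 2 ∷
    row (100 ∷ 10 ∷ 0 ∷ 104 ∷ 5 ∷ []) 9 1 2 ∷
    row (120 ∷ 12 ∷ 0 ∷ 163 ∷ 6 ∷ []) 7 1 2 ∷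
    row (118 ∷ 50 ∷ 0 ∷ 138 ∷ 25 ∷ []) 14 1 2 ∷
    row (27 ∷ 60 ∷ 0 ∷ 51 ∷ 30 ∷ []) 8 1 2 ∷
    row (67 ∷ 64 ∷ 0 ∷ 169 ∷ 32 ∷ []) 13 1 2 ∷
    row (147 ∷ 72 ∷ 0 ∷ 23 ∷ 36 ∷ []) 10 1 2 ∷
    row (85 ∷ 104 ∷ 0 ∷ 12 ∷ 52 ∷ []) 1 1 2 ∷
    row (43 ∷ 138 ∷ 0 ∷ 60 ∷ 69 ∷ []) 3 1 2 ∷
    row (39 ∷ 23 ∷ 0 ∷ 10 ∷ 107 ∷ []) 6 1 2 ∷
    row (128 ∷ 51 ∷ 0 ∷ 72 ∷ 121 ∷ []) 4 1 2 ∷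
    row (17 ∷ 59 ∷ 0 ∷ 117 ∷ 125 ∷ []) 0 1 2 ∷
    row (46 ∷ 81 ∷ 0 ∷ 2 ∷ 136 ∷ []) 16 1 2 ∷
    row (135 ∷ 109 ∷ 0 ∷ 64 ∷ 150 ∷ []) 15 1 2 ∷
    row (4 ∷ 115 ∷ 0 ∷ 50 ∷ 153 ∷ []) 18 1 2 ∷
    row (24 ∷ 117 ∷ 0 ∷ 109 ∷ 154 ∷ []) 11 1 2 ∷
    row (144 ∷ 129 ∷ 0 ∷ 81 ∷ 160 ∷ []) 17 1 2 ∷
    row (102 ∷ 163 ∷ 0 ∷ 129 ∷ 177 ∷ []) 2 1 2 ∷
    row (162 ∷ 169 ∷ 0 ∷ 115 ∷ 180 ∷ []) 5 1 2 ∷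
    []

dd20 : DD 201
dd20 = cyclicDD 200 19 rows refl
  where
  rows : Vec Row 20
  rows =
    row (0 ∷ 100 ∷ 9 ∷ 75 ∷ 171 ∷ []) 1 0 0 ∷
    row (0 ∷ 101 ∷ 192 ∷ 126 ∷ 30 ∷ []) 0 0 0 ∷
    row (0 ∷ 99 ∷ 19 ∷ 113 ∷ 189 ∷ []) 3 0 0 ∷
    row (0 ∷ 102 ∷ 182 ∷ 88 ∷ 12 ∷ []) 2 0 0 ∷
    row (0 ∷ 98 ∷ 47 ∷ 133 ∷ 151 ∷ []) 5 0 0 ∷
    row (0 ∷ 103 ∷ 154 ∷ 68 ∷ 50 ∷ []) 4 0 0 ∷
    row (0 ∷ 4 ∷ 40 ∷ 81 ∷ 123 ∷ []) 7 0 0 ∷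
    row (0 ∷ 197 ∷ 161 ∷ 120 ∷ 78 ∷ []) 6 0 0 ∷
    row (0 ∷ 1 ∷ 16 ∷ 59 ∷ 132 ∷ []) 9 0 0 ∷
    row (0 ∷ 200 ∷ 185 ∷ 142 ∷ 69 ∷ []) 8 0 0 ∷
    row (0 ∷ 5 ∷ 27 ∷ 84 ∷ 173 ∷ []) 11 0 0 ∷
    row (0 ∷ 196 ∷ 174 ∷ 117 ∷ 28 ∷ []) 10 0 0 ∷
    row (0 ∷ 3 ∷ 23 ∷ 137 ∷ 175 ∷ []) 13 0 0 ∷
    row (0 ∷ 198 ∷ 178 ∷ 64 ∷ 26 ∷ []) 12 0 0 ∷
    row (0 ∷ 2 ∷ 10 ∷ 56 ∷ 62 ∷ []) 15 0 0 ∷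
    row (0 ∷ 199 ∷ 191 ∷ 145 ∷ 139 ∷ []) 14 0 0 ∷
    row (0 ∷ 11 ∷ 32 ∷ 45 ∷ 138 ∷ []) 17 0 0 ∷
    row (0 ∷ 190 ∷ 169 ∷ 156 ∷ 63 ∷ []) 16 0 0 ∷
    row (0 ∷ 7 ∷ 24 ∷ 72 ∷ 164 ∷ []) 19 0 0 ∷
    row (0 ∷ 194 ∷ 177 ∷ 129 ∷ 37 ∷ []) 18 0 0 ∷
    []

dd21 : DD 211
dd21 = cyclicDD 210 20 rows refl
  where
  rows : Vec Row 21
  rows =
    row (34 ∷ 131 ∷ 0 ∷ 122 ∷ 1 ∷ []) 17 1 2 ∷
    row (73 ∷ 2 ∷ 0 ∷ 113 ∷ 58 ∷ []) 16 1 2 ∷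
    row (173 ∷ 77 ∷ 0 ∷ 25 ∷ 123 ∷ []) 20 1 2 ∷
    row (43 ∷ 85 ∷ 0 ∷ 55 ∷ 144 ∷ []) 15 1 2 ∷
    row (179 ∷ 187 ∷ 0 ∷ 121 ∷ 148 ∷ []) 14 1 2 ∷
    row (117 ∷ 35 ∷ 0 ∷ 184 ∷ 171 ∷ []) 18 1 2 ∷
    row (14 ∷ 116 ∷ 0 ∷ 13 ∷ 199 ∷ []) 19 1 2 ∷
    row (112 ∷ 28 ∷ 8 ∷ 0 ∷ 61 ∷ []) 4 2 0 ∷
    row (166 ∷ 147 ∷ 42 ∷ 0 ∷ 162 ∷ []) 3 2 0 ∷
    row (61 ∷ 68 ∷ 140 ∷ 0 ∷ 118 ∷ []) 1 2 0 ∷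
    row (92 ∷ 23 ∷ 97 ∷ 0 ∷ 133 ∷ []) 0 2 0 ∷
    row (118 ∷ 135 ∷ 129 ∷ 0 ∷ 166 ∷ []) 5 2 0 ∷
    row (162 ∷ 146 ∷ 102 ∷ 0 ∷ 92 ∷ []) 6 2 0 ∷
    row (133 ∷ 86 ∷ 115 ∷ 0 ∷ 112 ∷ []) 2 2 0 ∷
    row (32 ∷ 0 ∷ 84 ∷ 60 ∷ 3 ∷ []) 7 1 0 ∷
    row (168 ∷ 0 ∷ 19 ∷ 104 ∷ 174 ∷ []) 8 1 0 ∷
    row (138 ∷ 0 ∷ 204 ∷ 206 ∷ 158 ∷ []) 9 1 0 ∷
    row (177 ∷ 0 ∷ 69 ∷ 200 ∷ 10 ∷ []) 10 1 0 ∷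
    row (94 ∷ 0 ∷ 194 ∷ 18 ∷ 22 ∷ []) 11 1 0 ∷
    row (197 ∷ 0 ∷ 16 ∷ 132 ∷ 91 ∷ []) 12 1 0 ∷
    row (38 ∷ 0 ∷ 47 ∷ 124 ∷ 175 ∷ []) 13 1 0 ∷
    []

dd23 : DD 231
dd23 = cyclicDD 230 22 rows refl
  where
  rows : Vec Row 23
  rows =
    row (0 ∷ 162 ∷ 167 ∷ 141 ∷ 105 ∷ []) 2 1 2 ∷
    row (0 ∷ 204 ∷ 62 ∷ 15 ∷ 21 ∷ []) 3 1 2 ∷
    row (0 ∷ 120 ∷ 41 ∷ 36 ∷ 189 ∷ []) 4 1 2 ∷
    row (0 ∷ 57 ∷ 83 ∷ 225 ∷ 84 ∷ []) 0 1 2 ∷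
    row (0 ∷ 183 ∷ 230 ∷ 78 ∷ 63 ∷ []) 1 1 2 ∷
    row (0 ∷ 19 ∷ 127 ∷ 135 ∷ 207 ∷ []) 6 0 0 ∷
    row (0 ∷ 212 ∷ 104 ∷ 96 ∷ 24 ∷ []) 5 0 0 ∷
    row (0 ∷ 114 ∷ 125 ∷ 213 ∷ 227 ∷ []) 8 0 0 ∷
    row (0 ∷ 117 ∷ 106 ∷ 18 ∷ 4 ∷ []) 7 0 0 ∷
    row (0 ∷ 20 ∷ 50 ∷ 73 ∷ 180 ∷ []) 10 0 0 ∷
    row (0 ∷ 211 ∷ 181 ∷ 158 ∷ 51 ∷ []) 9 0 0 ∷
    row (0 ∷ 22 ∷ 59 ∷ 92 ∷ 192 ∷ []) 12 0 0 ∷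
    row (0 ∷ 209 ∷ 172 ∷ 139 ∷ 39 ∷ []) 11 0 0 ∷
    row (0 ∷ 7 ∷ 45 ∷ 164 ∷ 173 ∷ []) 14 0 0 ∷
    row (0 ∷ 224 ∷ 186 ∷ 67 ∷ 58 ∷ []) 13 0 0 ∷
    row (0 ∷ 2 ∷ 31 ∷ 56 ∷ 165 ∷ []) 16 0 0 ∷
    row (0 ∷ 229 ∷ 200 ∷ 175 ∷ 66 ∷ []) 15 0 0 ∷
    row (0 ∷ 3 ∷ 13 ∷ 94 ∷ 149 ∷ []) 18 0 0 ∷
    row (0 ∷ 228 ∷ 218 ∷ 137 ∷ 82 ∷ []) 17 0 0 ∷
    row (0 ∷ 16 ∷ 44 ∷ 76 ∷ 93 ∷ []) 20 0 0 ∷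
    row (0 ∷ 215 ∷ 187 ∷ 155 ∷ 138 ∷ []) 19 0 0 ∷
    row (0 ∷ 12 ∷ 46 ∷ 156 ∷ 191 ∷ []) 22 0 0 ∷
    row (0 ∷ 219 ∷ 185 ∷ 75 ∷ 40 ∷ []) 21 0 0 ∷
    []

dd24 : DD 241
dd24 = cyclicDD 240 23 rows refl
  where
  rows : Vec Row 24
  rows =
    row (0 ∷ 1 ∷ 186 ∷ 226 ∷ 232 ∷ []) 7 0 0 ∷
    row (0 ∷ 8 ∷ 42 ∷ 121 ∷ 169 ∷ []) 6 0 0 ∷
    row (0 ∷ 30 ∷ 37 ∷ 32 ∷ 212 ∷ []) 5 0 0 ∷
    row (0 ∷ 64 ∷ 95 ∷ 4 ∷ 147 ∷ []) 4 0 0 ∷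
    row (0 ∷ 177 ∷ 146 ∷ 237 ∷ 94 ∷ []) 3 0 0 ∷
    row (0 ∷ 211 ∷ 204 ∷ 209 ∷ 29 ∷ []) 2 0 0 ∷
    row (0 ∷ 233 ∷ 199 ∷ 120 ∷ 72 ∷ []) 1 0 0 ∷
    row (0 ∷ 240 ∷ 55 ∷ 15 ∷ 9 ∷ []) 0 0 0 ∷
    row (0 ∷ 77 ∷ 12 ∷ 97 ∷ 202 ∷ []) 15 0 0 ∷
    row (0 ∷ 134 ∷ 96 ∷ 53 ∷ 170 ∷ []) 14 0 0 ∷
    row (0 ∷ 141 ∷ 119 ∷ 18 ∷ 35 ∷ []) 13 0 0 ∷
    row (0 ∷ 108 ∷ 45 ∷ 183 ∷ 155 ∷ []) 12 0 0 ∷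
    row (0 ∷ 133 ∷ 196 ∷ 58 ∷ 86 ∷ []) 11 0 0 ∷
    row (0 ∷ 100 ∷ 122 ∷ 223 ∷ 206 ∷ []) 10 0 0 ∷
    row (0 ∷ 107 ∷ 145 ∷ 188 ∷ 71 ∷ []) 9 0 0 ∷
    row (0 ∷ 164 ∷ 229 ∷ 144 ∷ 39 ∷ []) 8 0 0 ∷
    row (0 ∷ 25 ∷ 69 ∷ 82 ∷ 93 ∷ []) 23 0 0 ∷
    row (0 ∷ 200 ∷ 70 ∷ 174 ∷ 21 ∷ []) 22 0 0 ∷
    row (0 ∷ 27 ∷ 142 ∷ 50 ∷ 139 ∷ []) 21 0 0 ∷
    row (0 ∷ 154 ∷ 78 ∷ 187 ∷ 168 ∷ []) 20 0 0 ∷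
    row (0 ∷ 87 ∷ 163 ∷ 54 ∷ 73 ∷ []) 19 0 0 ∷
    row (0 ∷ 214 ∷ 99 ∷ 191 ∷ 102 ∷ []) 18 0 0 ∷
    row (0 ∷ 41 ∷ 171 ∷ 67 ∷ 220 ∷ []) 17 0 0 ∷
    row (0 ∷ 216 ∷ 172 ∷ 159 ∷ 148 ∷ []) 16 0 0 ∷
    []

dd31 : DD 311
dd31 = cyclicDD 310 30 rows refl
  where
  rows : Vec Row 31
  rows =
    row (23 ∷ 2 ∷ 269 ∷ 0 ∷ 1 ∷ []) 9 0 1 ∷
    row (161 ∷ 14 ∷ 17 ∷ 0 ∷ 7 ∷ []) 7 0 1 ∷
    row (299 ∷ 26 ∷ 76 ∷ 0 ∷ 13 ∷ []) 3 0 1 ∷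
    row (34 ∷ 30 ∷ 303 ∷ 0 ∷ 15 ∷ []) 14 0 1 ∷
    row (103 ∷ 36 ∷ 177 ∷ 0 ∷ 18 ∷ []) 27 0 1 ∷
    row (149 ∷ 40 ∷ 93 ∷ 0 ∷ 20 ∷ []) 8 0 1 ∷
    row (241 ∷ 48 ∷ 236 ∷ 0 ∷ 24 ∷ []) 25 0 1 ∷
    row (114 ∷ 64 ∷ 211 ∷ 0 ∷ 32 ∷ []) 2 0 1 ∷
    row (148 ∷ 94 ∷ 203 ∷ 0 ∷ 47 ∷ []) 16 0 1 ∷
    row (194 ∷ 98 ∷ 119 ∷ 0 ∷ 49 ∷ []) 22 0 1 ∷
    row (43 ∷ 166 ∷ 246 ∷ 0 ∷ 83 ∷ []) 6 0 1 ∷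
    row (181 ∷ 178 ∷ 305 ∷ 0 ∷ 89 ∷ []) 1 0 1 ∷
    row (227 ∷ 182 ∷ 221 ∷ 0 ∷ 91 ∷ []) 13 0 1 ∷
    row (238 ∷ 210 ∷ 255 ∷ 0 ∷ 105 ∷ []) 20 0 1 ∷
    row (111 ∷ 226 ∷ 230 ∷ 0 ∷ 113 ∷ []) 26 0 1 ∷
    row (295 ∷ 242 ∷ 205 ∷ 0 ∷ 121 ∷ []) 5 0 1 ∷
    row (99 ∷ 252 ∷ 306 ∷ 0 ∷ 126 ∷ []) 28 0 1 ∷
    row (110 ∷ 280 ∷ 29 ∷ 0 ∷ 140 ∷ []) 4 0 1 ∷
    row (248 ∷ 292 ∷ 88 ∷ 0 ∷ 146 ∷ []) 0 0 1 ∷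
    row (132 ∷ 25 ∷ 97 ∷ 0 ∷ 168 ∷ []) 18 0 1 ∷
    row (155 ∷ 27 ∷ 55 ∷ 0 ∷ 169 ∷ []) 21 0 1 ∷
    row (131 ∷ 79 ∷ 207 ∷ 0 ∷ 195 ∷ []) 23 0 1 ∷
    row (176 ∷ 137 ∷ 233 ∷ 0 ∷ 224 ∷ []) 12 0 1 ∷
    row (199 ∷ 139 ∷ 191 ∷ 0 ∷ 225 ∷ []) 17 0 1 ∷
    row (95 ∷ 157 ∷ 124 ∷ 0 ∷ 234 ∷ []) 29 0 1 ∷
    row (302 ∷ 175 ∷ 57 ∷ 0 ∷ 243 ∷ []) 11 0 1 ∷
    row (152 ∷ 189 ∷ 74 ∷ 0 ∷ 250 ∷ []) 15 0 1 ∷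
    row (71 ∷ 209 ∷ 276 ∷ 0 ∷ 260 ∷ []) 30 0 1 ∷
    row (186 ∷ 219 ∷ 66 ∷ 0 ∷ 265 ∷ []) 24 0 1 ∷
    row (301 ∷ 229 ∷ 167 ∷ 0 ∷ 270 ∷ []) 19 0 1 ∷
    row (58 ∷ 289 ∷ 151 ∷ 0 ∷ 300 ∷ []) 10 0 1 ∷
    []

dd33 : DD 331
dd33 = cyclicDD 330 32 rows refl
  where
  rows : Vec Row 33
  rows =
    row (244 ∷ 0 ∷ 330 ∷ 1 ∷ 316 ∷ []) 11 2 2 ∷
    row (182 ∷ 0 ∷ 257 ∷ 74 ∷ 214 ∷ []) 12 2 2 ∷
    row (322 ∷ 0 ∷ 251 ∷ 80 ∷ 124 ∷ []) 13 2 2 ∷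
    row (218 ∷ 0 ∷ 246 ∷ 85 ∷ 49 ∷ []) 14 2 2 ∷
    row (273 ∷ 0 ∷ 220 ∷ 111 ∷ 321 ∷ []) 15 2 2 ∷
    row (152 ∷ 0 ∷ 211 ∷ 120 ∷ 186 ∷ []) 16 2 2 ∷
    row (35 ∷ 0 ∷ 164 ∷ 167 ∷ 143 ∷ []) 17 2 2 ∷
    row (228 ∷ 0 ∷ 151 ∷ 180 ∷ 279 ∷ []) 18 2 2 ∷
    row (11 ∷ 0 ∷ 61 ∷ 270 ∷ 253 ∷ []) 19 2 2 ∷
    row (325 ∷ 0 ∷ 57 ∷ 274 ∷ 193 ∷ []) 20 2 2 ∷
    row (327 ∷ 0 ∷ 38 ∷ 293 ∷ 239 ∷ []) 21 2 2 ∷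
    row (8 ∷ 33 ∷ 2 ∷ 0 ∷ 64 ∷ []) 0 2 2 ∷
    row (261 ∷ 125 ∷ 148 ∷ 0 ∷ 102 ∷ []) 1 2 2 ∷
    row (309 ∷ 323 ∷ 160 ∷ 0 ∷ 155 ∷ []) 2 2 2 ∷
    row (18 ∷ 157 ∷ 170 ∷ 0 ∷ 144 ∷ []) 3 2 2 ∷
    row (226 ∷ 22 ∷ 222 ∷ 0 ∷ 153 ∷ []) 4 2 2 ∷
    row (298 ∷ 319 ∷ 240 ∷ 0 ∷ 67 ∷ []) 5 2 2 ∷
    row (12 ∷ 215 ∷ 3 ∷ 0 ∷ 96 ∷ []) 6 2 2 ∷
    row (116 ∷ 313 ∷ 29 ∷ 0 ∷ 266 ∷ []) 7 2 2 ∷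
    row (174 ∷ 304 ∷ 209 ∷ 0 ∷ 68 ∷ []) 8 2 2 ∷
    row (206 ∷ 105 ∷ 217 ∷ 0 ∷ 324 ∷ []) 9 2 2 ∷
    row (27 ∷ 70 ∷ 255 ∷ 0 ∷ 216 ∷ []) 10 2 2 ∷
    row (290 ∷ 97 ∷ 137 ∷ 0 ∷ 53 ∷ []) 28 1 2 ∷
    row (276 ∷ 227 ∷ 208 ∷ 0 ∷ 281 ∷ []) 26 1 2 ∷
    row (30 ∷ 147 ∷ 37 ∷ 0 ∷ 268 ∷ []) 27 1 2 ∷
    row (156 ∷ 301 ∷ 60 ∷ 0 ∷ 202 ∷ []) 32 1 2 ∷
    row (83 ∷ 175 ∷ 312 ∷ 0 ∷ 256 ∷ []) 22 1 2 ∷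
    row (45 ∷ 55 ∷ 221 ∷ 0 ∷ 71 ∷ []) 29 1 2 ∷
    row (104 ∷ 311 ∷ 40 ∷ 0 ∷ 245 ∷ []) 25 1 2 ∷
    row (233 ∷ 248 ∷ 166 ∷ 0 ∷ 272 ∷ []) 30 1 2 ∷
    row (184 ∷ 41 ∷ 249 ∷ 0 ∷ 77 ∷ []) 23 1 2 ∷
    row (20 ∷ 98 ∷ 135 ∷ 0 ∷ 289 ∷ []) 24 1 2 ∷
    row (234 ∷ 286 ∷ 90 ∷ 0 ∷ 303 ∷ []) 31 1 2 ∷
    []

dd34 : DD 341
dd34 = cyclicDD 340 33 rows refl
  where
  rows : Vec Row 34
  rows =
    row (338 ∷ 329 ∷ 293 ∷ 149 ∷ 255 ∷ []) 1 0 0 ∷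
    row (3 ∷ 12 ∷ 48 ∷ 192 ∷ 86 ∷ []) 0 0 0 ∷
    row (153 ∷ 271 ∷ 61 ∷ 244 ∷ 294 ∷ []) 3 0 0 ∷
    row (188 ∷ 70 ∷ 280 ∷ 97 ∷ 47 ∷ []) 2 0 0 ∷
    row (0 ∷ 19 ∷ 47 ∷ 321 ∷ 329 ∷ []) 13 0 0 ∷
    row (0 ∷ 76 ∷ 188 ∷ 261 ∷ 293 ∷ []) 12 0 0 ∷
    row (0 ∷ 304 ∷ 70 ∷ 21 ∷ 149 ∷ []) 11 0 0 ∷
    row (0 ∷ 193 ∷ 280 ∷ 84 ∷ 255 ∷ []) 10 0 0 ∷
    row (0 ∷ 251 ∷ 244 ∷ 5 ∷ 3 ∷ []) 9 0 0 ∷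
    row (0 ∷ 90 ∷ 97 ∷ 336 ∷ 338 ∷ []) 8 0 0 ∷
    row (0 ∷ 148 ∷ 61 ∷ 257 ∷ 86 ∷ []) 7 0 0 ∷
    row (0 ∷ 37 ∷ 271 ∷ 320 ∷ 192 ∷ []) 6 0 0 ∷
    row (0 ∷ 265 ∷ 153 ∷ 80 ∷ 48 ∷ []) 5 0 0 ∷
    row (0 ∷ 322 ∷ 294 ∷ 20 ∷ 12 ∷ []) 4 0 0 ∷
    row (0 ∷ 15 ∷ 1 ∷ 206 ∷ 216 ∷ []) 23 0 0 ∷
    row (0 ∷ 60 ∷ 4 ∷ 142 ∷ 182 ∷ []) 22 0 0 ∷
    row (0 ∷ 240 ∷ 16 ∷ 227 ∷ 46 ∷ []) 21 0 0 ∷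
    row (0 ∷ 278 ∷ 64 ∷ 226 ∷ 184 ∷ []) 20 0 0 ∷
    row (0 ∷ 252 ∷ 85 ∷ 119 ∷ 287 ∷ []) 19 0 0 ∷
    row (0 ∷ 89 ∷ 256 ∷ 222 ∷ 54 ∷ []) 18 0 0 ∷
    row (0 ∷ 63 ∷ 277 ∷ 115 ∷ 157 ∷ []) 17 0 0 ∷
    row (0 ∷ 101 ∷ 325 ∷ 114 ∷ 295 ∷ []) 16 0 0 ∷
    row (0 ∷ 281 ∷ 337 ∷ 199 ∷ 159 ∷ []) 15 0 0 ∷
    row (0 ∷ 326 ∷ 340 ∷ 135 ∷ 125 ∷ []) 14 0 0 ∷
    row (0 ∷ 57 ∷ 81 ∷ 110 ∷ 132 ∷ []) 33 0 0 ∷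
    row (0 ∷ 228 ∷ 324 ∷ 99 ∷ 187 ∷ []) 32 0 0 ∷
    row (0 ∷ 230 ∷ 273 ∷ 55 ∷ 66 ∷ []) 31 0 0 ∷
    row (0 ∷ 238 ∷ 69 ∷ 220 ∷ 264 ∷ []) 30 0 0 ∷
    row (0 ∷ 71 ∷ 65 ∷ 143 ∷ 308 ∷ []) 29 0 0 ∷
    row (0 ∷ 270 ∷ 276 ∷ 198 ∷ 33 ∷ []) 28 0 0 ∷
    row (0 ∷ 103 ∷ 272 ∷ 121 ∷ 77 ∷ []) 27 0 0 ∷
    row (0 ∷ 111 ∷ 68 ∷ 286 ∷ 275 ∷ []) 26 0 0 ∷
    row (0 ∷ 113 ∷ 17 ∷ 242 ∷ 154 ∷ []) 25 0 0 ∷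
    row (0 ∷ 284 ∷ 260 ∷ 231 ∷ 209 ∷ []) 24 0 0 ∷
    []

dd36 : DD 361
dd36 = cyclicDD 360 35 rows refl
  where
  rows : Vec Row 36
  rows =
    row (0 ∷ 1 ∷ 3 ∷ 7 ∷ 15 ∷ []) 17 0 0 ∷
    row (0 ∷ 28 ∷ 84 ∷ 196 ∷ 59 ∷ []) 16 0 0 ∷
    row (0 ∷ 54 ∷ 162 ∷ 17 ∷ 88 ∷ []) 15 0 0 ∷
    row (0 ∷ 62 ∷ 186 ∷ 73 ∷ 208 ∷ []) 14 0 0 ∷
    row (0 ∷ 68 ∷ 204 ∷ 115 ∷ 298 ∷ []) 13 0 0 ∷
    row (0 ∷ 69 ∷ 207 ∷ 122 ∷ 313 ∷ []) 12 0 0 ∷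
    row (0 ∷ 99 ∷ 297 ∷ 332 ∷ 41 ∷ []) 11 0 0 ∷
    row (0 ∷ 116 ∷ 348 ∷ 90 ∷ 296 ∷ []) 10 0 0 ∷
    row (0 ∷ 127 ∷ 20 ∷ 167 ∷ 100 ∷ []) 9 0 0 ∷
    row (0 ∷ 234 ∷ 341 ∷ 194 ∷ 261 ∷ []) 8 0 0 ∷
    row (0 ∷ 245 ∷ 13 ∷ 271 ∷ 65 ∷ []) 7 0 0 ∷
    row (0 ∷ 262 ∷ 64 ∷ 29 ∷ 320 ∷ []) 6 0 0 ∷
    row (0 ∷ 292 ∷ 154 ∷ 239 ∷ 48 ∷ []) 5 0 0 ∷
    row (0 ∷ 293 ∷ 157 ∷ 246 ∷ 63 ∷ []) 4 0 0 ∷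
    row (0 ∷ 299 ∷ 175 ∷ 288 ∷ 153 ∷ []) 3 0 0 ∷
    row (0 ∷ 307 ∷ 199 ∷ 344 ∷ 273 ∷ []) 2 0 0 ∷
    row (0 ∷ 333 ∷ 277 ∷ 165 ∷ 302 ∷ []) 1 0 0 ∷
    row (0 ∷ 360 ∷ 358 ∷ 354 ∷ 346 ∷ []) 0 0 0 ∷
    row (0 ∷ 24 ∷ 5 ∷ 144 ∷ 174 ∷ []) 35 0 0 ∷
    row (0 ∷ 311 ∷ 140 ∷ 61 ∷ 179 ∷ []) 34 0 0 ∷
    row (0 ∷ 213 ∷ 270 ∷ 195 ∷ 10 ∷ []) 33 0 0 ∷
    row (0 ∷ 44 ∷ 310 ∷ 264 ∷ 319 ∷ []) 32 0 0 ∷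
    row (0 ∷ 188 ∷ 340 ∷ 45 ∷ 280 ∷ []) 31 0 0 ∷
    row (0 ∷ 212 ∷ 345 ∷ 189 ∷ 93 ∷ []) 30 0 0 ∷
    row (0 ∷ 210 ∷ 134 ∷ 177 ∷ 259 ∷ []) 29 0 0 ∷
    row (0 ∷ 257 ∷ 219 ∷ 98 ∷ 329 ∷ []) 28 0 0 ∷
    row (0 ∷ 160 ∷ 274 ∷ 238 ∷ 77 ∷ []) 27 0 0 ∷
    row (0 ∷ 201 ∷ 87 ∷ 123 ∷ 284 ∷ []) 26 0 0 ∷
    row (0 ∷ 104 ∷ 142 ∷ 263 ∷ 32 ∷ []) 25 0 0 ∷
    row (0 ∷ 151 ∷ 227 ∷ 184 ∷ 102 ∷ []) 24 0 0 ∷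
    row (0 ∷ 149 ∷ 16 ∷ 172 ∷ 268 ∷ []) 23 0 0 ∷
    row (0 ∷ 173 ∷ 21 ∷ 316 ∷ 81 ∷ []) 22 0 0 ∷
    row (0 ∷ 317 ∷ 51 ∷ 97 ∷ 42 ∷ []) 21 0 0 ∷
    row (0 ∷ 148 ∷ 91 ∷ 166 ∷ 351 ∷ []) 20 0 0 ∷
    row (0 ∷ 50 ∷ 221 ∷ 300 ∷ 182 ∷ []) 19 0 0 ∷
    row (0 ∷ 337 ∷ 356 ∷ 217 ∷ 187 ∷ []) 18 0 0 ∷
    []

-- Group divisible designs with equal groups

gdd5×10 : GDD {5} (λ _ → 10)
gdd5×10 = developedGDD 4 9 19 (develop 3 5 (productAct 4 9) (productRatio 4 9) rows) refl
  where
  rows : Vec Row 4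
  rows =
    row (35 ∷ 20 ∷ 49 ∷ 0 ∷ 19 ∷ []) 2 3 2 ∷
    row (18 ∷ 0 ∷ 47 ∷ 31 ∷ 24 ∷ []) 3 1 2 ∷
    row (33 ∷ 43 ∷ 19 ∷ 0 ∷ 21 ∷ []) 0 2 3 ∷
    row (0 ∷ 32 ∷ 15 ∷ 28 ∷ 40 ∷ []) 1 2 1 ∷
    []

gdd6×10 : GDD {6} (λ _ → 10)
gdd6×10 = developedGDD 5 9 29 (develop 4 6 (cyclicAct 5 9) (cyclicRatio 5 9) rows) refl
  where
  rows : Vec Row 5
  rows =
    row (0 ∷ 56 ∷ 58 ∷ 55 ∷ 47 ∷ []) 3 0 1 ∷
    row (0 ∷ 15 ∷ 5 ∷ 26 ∷ 43 ∷ []) 4 2 3 ∷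
    row (0 ∷ 3 ∷ 32 ∷ 16 ∷ 25 ∷ []) 0 0 2 ∷
    row (29 ∷ 0 ∷ 4 ∷ 14 ∷ 37 ∷ []) 2 0 1 ∷
    row (0 ∷ 34 ∷ 1 ∷ 41 ∷ 20 ∷ []) 1 3 2 ∷
    []

gdd7×10 : GDD {7} (λ _ → 10)
gdd7×10 = developedGDD 6 9 41 (develop 5 7 (cyclicAct 6 9) (cyclicRatio 6 9) rows) refl
  where
  rows : Vec Row 6
  rows =
    row (25 ∷ 5 ∷ 2 ∷ 0 ∷ 1 ∷ []) 3 0 3 ∷
    row (65 ∷ 55 ∷ 22 ∷ 0 ∷ 11 ∷ []) 4 0 3 ∷
    row (15 ∷ 45 ∷ 32 ∷ 0 ∷ 51 ∷ []) 5 0 3 ∷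
    row (41 ∷ 29 ∷ 0 ∷ 53 ∷ 3 ∷ []) 0 3 0 ∷
    row (31 ∷ 39 ∷ 0 ∷ 23 ∷ 33 ∷ []) 1 3 0 ∷
    row (61 ∷ 9 ∷ 0 ∷ 43 ∷ 13 ∷ []) 2 3 0 ∷
    []

gdd8×10 : GDD {8} (λ _ → 10)
gdd8×10 = developedGDD 7 9 55 (develop 6 8 (cyclicAct 7 9) (cyclicRatio 7 9) rows) refl
  where
  rows : Vec Row 7
  rows =
    row (0 ∷ 39 ∷ 43 ∷ 66 ∷ 77 ∷ []) 1 0 0 ∷
    row (0 ∷ 41 ∷ 37 ∷ 14 ∷ 3 ∷ []) 0 0 0 ∷
    row (0 ∷ 71 ∷ 35 ∷ 22 ∷ 20 ∷ []) 4 1 1 ∷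
    row (0 ∷ 13 ∷ 7 ∷ 25 ∷ 6 ∷ []) 2 0 2 ∷
    row (0 ∷ 45 ∷ 1 ∷ 55 ∷ 60 ∷ []) 6 2 1 ∷
    row (0 ∷ 2 ∷ 19 ∷ 70 ∷ 52 ∷ []) 3 3 2 ∷
    row (0 ∷ 63 ∷ 9 ∷ 30 ∷ 58 ∷ []) 5 0 1 ∷
    []

gdd11×20 : GDD {11} (λ _ → 20)
gdd11×20 = developedGDD 10 19 219 (develop 19 11 (cyclicAct 10 19) (cyclicRatio 10 19) rows) refl
  where
  rows : Vec Row 20
  rows =
    row (195 ∷ 0 ∷ 1 ∷ 149 ∷ 161 ∷ []) 11 1 1 ∷
    row (175 ∷ 0 ∷ 81 ∷ 189 ∷ 61 ∷ []) 13 1 1 ∷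
    row (215 ∷ 0 ∷ 141 ∷ 109 ∷ 41 ∷ []) 14 1 1 ∷
    row (95 ∷ 0 ∷ 181 ∷ 129 ∷ 101 ∷ []) 12 1 1 ∷
    row (35 ∷ 0 ∷ 201 ∷ 29 ∷ 21 ∷ []) 10 1 1 ∷
    row (118 ∷ 207 ∷ 192 ∷ 0 ∷ 10 ∷ []) 15 1 2 ∷
    row (98 ∷ 47 ∷ 152 ∷ 0 ∷ 150 ∷ []) 16 1 2 ∷
    row (138 ∷ 147 ∷ 12 ∷ 0 ∷ 90 ∷ []) 17 1 2 ∷
    row (18 ∷ 67 ∷ 212 ∷ 0 ∷ 50 ∷ []) 18 1 2 ∷
    row (178 ∷ 27 ∷ 92 ∷ 0 ∷ 30 ∷ []) 19 1 2 ∷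
    row (3 ∷ 0 ∷ 19 ∷ 183 ∷ 70 ∷ []) 4 1 1 ∷
    row (23 ∷ 0 ∷ 219 ∷ 83 ∷ 170 ∷ []) 0 1 1 ∷
    row (203 ∷ 0 ∷ 39 ∷ 63 ∷ 190 ∷ []) 3 1 1 ∷
    row (103 ∷ 0 ∷ 139 ∷ 123 ∷ 130 ∷ []) 1 1 1 ∷
    row (163 ∷ 0 ∷ 79 ∷ 43 ∷ 210 ∷ []) 2 1 1 ∷
    row (58 ∷ 76 ∷ 0 ∷ 15 ∷ 111 ∷ []) 5 2 1 ∷
    row (78 ∷ 216 ∷ 0 ∷ 115 ∷ 191 ∷ []) 6 2 1 ∷
    row (38 ∷ 156 ∷ 0 ∷ 135 ∷ 31 ∷ []) 7 2 1 ∷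
    row (158 ∷ 116 ∷ 0 ∷ 75 ∷ 71 ∷ []) 8 2 1 ∷
    row (218 ∷ 96 ∷ 0 ∷ 155 ∷ 91 ∷ []) 9 2 1 ∷
    []

gdd13×20 : GDD {13} (λ _ → 20)
gdd13×20 = developedGDD 12 19 311 (develop 23 13 (cyclicAct 12 19) (cyclicRatio 12 19) rows) refl
  where
  rows : Vec Row 24
  rows =
    row (228 ∷ 123 ∷ 0 ∷ 1 ∷ 140 ∷ []) 17 1 1 ∷
    row (128 ∷ 223 ∷ 0 ∷ 61 ∷ 220 ∷ []) 16 1 1 ∷
    row (8 ∷ 83 ∷ 0 ∷ 81 ∷ 160 ∷ []) 15 1 1 ∷
    row (148 ∷ 203 ∷ 0 ∷ 101 ∷ 100 ∷ []) 14 1 1 ∷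
    row (28 ∷ 63 ∷ 0 ∷ 121 ∷ 40 ∷ []) 13 1 1 ∷
    row (188 ∷ 163 ∷ 0 ∷ 181 ∷ 120 ∷ []) 12 1 1 ∷
    row (224 ∷ 191 ∷ 0 ∷ 50 ∷ 175 ∷ []) 11 2 2 ∷
    row (144 ∷ 211 ∷ 0 ∷ 190 ∷ 15 ∷ []) 10 2 2 ∷
    row (204 ∷ 131 ∷ 0 ∷ 150 ∷ 135 ∷ []) 9 2 2 ∷
    row (4 ∷ 51 ∷ 0 ∷ 110 ∷ 255 ∷ []) 8 2 2 ∷
    row (64 ∷ 231 ∷ 0 ∷ 70 ∷ 115 ∷ []) 7 2 2 ∷
    row (244 ∷ 251 ∷ 0 ∷ 210 ∷ 215 ∷ []) 6 2 2 ∷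
    row (239 ∷ 97 ∷ 0 ∷ 127 ∷ 3 ∷ []) 5 1 1 ∷
    row (19 ∷ 197 ∷ 0 ∷ 207 ∷ 183 ∷ []) 4 1 1 ∷
    row (119 ∷ 57 ∷ 0 ∷ 147 ∷ 243 ∷ []) 3 1 1 ∷
    row (219 ∷ 177 ∷ 0 ∷ 87 ∷ 43 ∷ []) 2 1 1 ∷
    row (59 ∷ 37 ∷ 0 ∷ 27 ∷ 103 ∷ []) 1 1 1 ∷
    row (99 ∷ 137 ∷ 0 ∷ 107 ∷ 23 ∷ []) 0 1 1 ∷
    row (11 ∷ 0 ∷ 31 ∷ 25 ∷ 113 ∷ []) 21 0 1 ∷
    row (151 ∷ 0 ∷ 71 ∷ 225 ∷ 133 ∷ []) 23 0 1 ∷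
    row (111 ∷ 0 ∷ 171 ∷ 205 ∷ 53 ∷ []) 22 0 1 ∷
    row (71 ∷ 0 ∷ 11 ∷ 185 ∷ 233 ∷ []) 19 0 1 ∷
    row (31 ∷ 0 ∷ 111 ∷ 165 ∷ 153 ∷ []) 18 0 1 ∷
    row (171 ∷ 0 ∷ 151 ∷ 105 ∷ 173 ∷ []) 20 0 1 ∷
    []

-- With (ℤ/2)³ read as the field of eight elements in which x³ = x + 1, each run of seven rows is
-- the orbit of its first row when the first coordinates are multiplied by the nonzero field
-- elements.
gdd8×40 : GDD {8} (λ _ → 40)
gdd8×40 = developedGDD 7 39 223 (develop 27 8 (binaryAct 39) (binaryRatio 39) rows) refl
  where
  rows : Vec Row 28
  rows =
    row (280 ∷ 27 ∷ 208 ∷ 270 ∷ 120 ∷ []) 10 1 2 ∷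
    row (200 ∷ 27 ∷ 48 ∷ 310 ∷ 240 ∷ []) 9 1 2 ∷
    row (80 ∷ 27 ∷ 168 ∷ 70 ∷ 200 ∷ []) 13 1 2 ∷
    row (40 ∷ 27 ∷ 88 ∷ 230 ∷ 280 ∷ []) 12 1 2 ∷
    row (240 ∷ 27 ∷ 288 ∷ 150 ∷ 160 ∷ []) 8 1 2 ∷
    row (160 ∷ 27 ∷ 128 ∷ 110 ∷ 40 ∷ []) 11 1 2 ∷
    row (120 ∷ 27 ∷ 248 ∷ 190 ∷ 80 ∷ []) 7 1 2 ∷
    row (80 ∷ 291 ∷ 266 ∷ 5 ∷ 57 ∷ []) 6 2 1 ∷
    row (160 ∷ 211 ∷ 306 ∷ 5 ∷ 97 ∷ []) 4 2 1 ∷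
    row (240 ∷ 91 ∷ 66 ∷ 5 ∷ 137 ∷ []) 1 2 1 ∷
    row (120 ∷ 51 ∷ 226 ∷ 5 ∷ 177 ∷ []) 0 2 1 ∷
    row (40 ∷ 251 ∷ 146 ∷ 5 ∷ 217 ∷ []) 5 2 1 ∷
    row (280 ∷ 171 ∷ 106 ∷ 5 ∷ 257 ∷ []) 3 2 1 ∷
    row (200 ∷ 131 ∷ 186 ∷ 5 ∷ 297 ∷ []) 2 2 1 ∷
    row (73 ∷ 222 ∷ 266 ∷ 120 ∷ 282 ∷ []) 24 3 2 ∷
    row (113 ∷ 62 ∷ 306 ∷ 240 ∷ 202 ∷ []) 23 3 2 ∷
    row (153 ∷ 182 ∷ 66 ∷ 200 ∷ 82 ∷ []) 27 3 2 ∷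
    row (193 ∷ 102 ∷ 226 ∷ 280 ∷ 42 ∷ []) 26 3 2 ∷
    row (233 ∷ 302 ∷ 146 ∷ 160 ∷ 242 ∷ []) 22 3 2 ∷
    row (273 ∷ 142 ∷ 106 ∷ 40 ∷ 162 ∷ []) 25 3 2 ∷
    row (313 ∷ 262 ∷ 186 ∷ 80 ∷ 122 ∷ []) 21 3 2 ∷
    row (217 ∷ 5 ∷ 82 ∷ 120 ∷ 161 ∷ []) 20 2 3 ∷
    row (57 ∷ 5 ∷ 162 ∷ 240 ∷ 121 ∷ []) 18 2 3 ∷
    row (177 ∷ 5 ∷ 242 ∷ 200 ∷ 281 ∷ []) 15 2 3 ∷
    row (97 ∷ 5 ∷ 122 ∷ 280 ∷ 241 ∷ []) 14 2 3 ∷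
    row (297 ∷ 5 ∷ 42 ∷ 160 ∷ 81 ∷ []) 19 2 3 ∷
    row (137 ∷ 5 ∷ 282 ∷ 40 ∷ 201 ∷ []) 17 2 3 ∷
    row (257 ∷ 5 ∷ 202 ∷ 80 ∷ 41 ∷ []) 16 2 3 ∷
    []

-- The recursion

DD₁₀₊₁ : ℕ → Set₁
DD₁₀₊₁ n = DD (suc (n * 10))

-- A group truncated to no points, together with the new point, is filled by this design without
-- blocks.
point₁ : DD 1
point₁ = record
  { Index = ⊥
  ; finite = 0 , record { to = λ () ; from = λ () ; to-cong = λ { refl → refl } ; from-cong = λ { refl → refl }
                        ; inverse = (λ { {()} }) , λ { {()} } }
  ; block = λ ()
  ; sound = λ ()
  ; cover = λ { {zero} {zero} 0≢0 → contradiction refl 0≢0 }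
  ; unique = λ { {()} }
  ; noReversal = λ { {()} }
  ; partner = λ ()
  ; partner-injective = λ { {()} }
  ; partner-swap = λ ()
  }

gdd×10 : ∀ k → k ≤ 3 → GDD {5 + k} (λ _ → 10)
gdd×10 0 _ = gdd5×10
gdd×10 1 _ = gdd6×10
gdd×10 2 _ = gdd7×10
gdd×10 3 _ = gdd8×10
gdd×10 (suc (suc (suc (suc _)))) (s≤s (s≤s (s≤s ())))

total : ∀ M a b c → M * 10 + (M * 10 + (M * 10 + (M * 10 + (M * 10 + (a * 10 + (b * 10 + (c * 10 + 0))))))) ≡
  (5 * M + (a + b + c)) * 10
total = solve-∀

module Wilson (m : ℕ) (unit₂ : Unit m 2) (unit₃ : Unit m 3)
  (a b c : ℕ) (unit₅ : 0 < b + c → Unit m 5) where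

  M : ℕ
  M = suc m

  s : Fin 8 → ℕ
  s = lookup (M ∷ M ∷ M ∷ M ∷ M ∷ a ∷ b ∷ c ∷ [])

  smallUnit : ∀ δ → 0 < δ → δ ≤ 6 → (δ ≡ 5 → Unit m 5) → Unit m δ
  smallUnit 1 _ _ _ = 1 , 0 , refl
  smallUnit 2 _ _ _ = unit₂
  smallUnit 3 _ _ _ = unit₃
  smallUnit 4 _ _ _ = Unit-* {m} {2} {2} unit₂ unit₂
  smallUnit 5 _ _ u = u refl
  smallUnit 6 _ _ _ = Unit-* {m} {2} {3} unit₂ unit₃
  smallUnit (suc (suc (suc (suc (suc (suc (suc _))))))) _ (s≤s (s≤s (s≤s (s≤s (s≤s (s≤s ())))))) _

  difference≢5 : ∀ {j i} → j < 5 → j ∸ i ≢ 5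
  difference≢5 {j} {i} j<5 e = ℕₚ.<⇒≱ j<5 (subst (_≤ j) e (ℕₚ.m∸n≤m j i))

  -- The columns 0 to 4 differ by at most 4, so a difference 5 involves column 5 or 6, which belong
  -- to the groups of `b` and `c` points.
  five : (i j : Fin 7) → 0 < s (suc j) → toℕ j ∸ toℕ i ≡ 5 → Unit m 5
  five i zero                               _ e = contradiction e (difference≢5 {0} {toℕ i} (s≤s z≤n))
  five i (suc zero)                         _ e = contradiction e (difference≢5 {1} {toℕ i} (s≤s (s≤s z≤n)))
  five i (suc (suc zero))                   _ e = contradiction e (difference≢5 {2} {toℕ i} (s≤s (s≤s (s≤s z≤n))))
  five i (suc (suc (suc zero)))             _ e = contradiction e (difference≢5 {3} {toℕ i} (s≤s (s≤s (s≤s (s≤s z≤n)))))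
  five i (suc (suc (suc (suc zero))))       _ e = contradiction e (difference≢5 {4} {toℕ i} (s≤s (s≤s (s≤s (s≤s (s≤s z≤n))))))
  five i (suc (suc (suc (suc (suc zero))))) 0<b _ = unit₅ (ℕₚ.<-≤-trans 0<b (ℕₚ.m≤m+n b c))
  five i (suc (suc (suc (suc (suc (suc zero)))))) 0<c _ = unit₅ (ℕₚ.<-≤-trans 0<c (ℕₚ.m≤n+m c b))

  unit : (i j : Fin 7) → i <ᶠ j → 0 < s (suc j) → Unit m (toℕ j ∸ toℕ i)
  unit i j i<j 0<s = smallUnit (toℕ j ∸ toℕ i) (ℕₚ.m<n⇒0<n∸m i<j)
    (ℕₚ.≤-trans (ℕₚ.m∸n≤m (toℕ j) (toℕ i)) (ℕₚ.≤-pred (Finₚ.toℕ<n j))) (five i j 0<s)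

  module _ (a≤ : a ≤ M) (b≤ : b ≤ M) (c≤ : c ≤ M) (DM : DD₁₀₊₁ M) (Da : DD₁₀₊₁ a) (Db : DD₁₀₊₁ b) (Dc : DD₁₀₊₁ c) where

    s≤ : ∀ g → s g ≤ M
    s≤ zero = ℕₚ.≤-refl
    s≤ (suc zero) = ℕₚ.≤-refl
    s≤ (suc (suc zero)) = ℕₚ.≤-refl
    s≤ (suc (suc (suc zero))) = ℕₚ.≤-refl
    s≤ (suc (suc (suc (suc zero)))) = ℕₚ.≤-refl
    s≤ (suc (suc (suc (suc (suc zero))))) = a≤
    s≤ (suc (suc (suc (suc (suc (suc zero)))))) = b≤
    s≤ (suc (suc (suc (suc (suc (suc (suc zero))))))) = c≤

    td : TruncatedTD M s
    td = LinearTD.linearTD m s s≤ unit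

    full : ∀ g ℓ → toℕ g < 5 → TruncatedTD.value td g ℓ < s g
    full zero ℓ _ = Finₚ.toℕ<n (LinearTD.line m zero ℓ)
    full (suc zero) ℓ _ = Finₚ.toℕ<n (LinearTD.line m (suc zero) ℓ)
    full (suc (suc zero)) ℓ _ = Finₚ.toℕ<n (LinearTD.line m (suc (suc zero)) ℓ)
    full (suc (suc (suc zero))) ℓ _ = Finₚ.toℕ<n (LinearTD.line m (suc (suc (suc zero))) ℓ)
    full (suc (suc (suc (suc zero)))) ℓ _ = Finₚ.toℕ<n (LinearTD.line m (suc (suc (suc (suc zero)))) ℓ)
    full (suc (suc (suc (suc (suc g))))) ℓ (s≤s (s≤s (s≤s (s≤s (s≤s ())))))

    fill : ∀ g → DD₁₀₊₁ (s g)
    fill zero = DM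
    fill (suc zero) = DM
    fill (suc (suc zero)) = DM
    fill (suc (suc (suc zero))) = DM
    fill (suc (suc (suc (suc zero)))) = DM
    fill (suc (suc (suc (suc (suc zero))))) = Da
    fill (suc (suc (suc (suc (suc (suc zero)))))) = Db
    fill (suc (suc (suc (suc (suc (suc (suc zero))))))) = Dc

    wilson : DD₁₀₊₁ (5 * M + (a + b + c))
    wilson = subst DD (cong suc (total M a b c)) (fillGroups (λ g → s g * 10) (inflate td 10 full gdd×10) fill)

-- The two excluded values are those of v = 11 and v = 91; they must also be avoided as sizes of
-- groups.
Good : ℕ → Set
Good n = n ≢ 1 × n ≢ 9

good? : ∀ n → Dec (Good n)
good? n = ¬? (n ≟ 1) ×-dec ¬? (n ≟ 9)

record Split (M r : ℕ) : Set where
  field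
    a b c : ℕ
    a≤ : a ≤ M
    b≤ : b ≤ M
    c≤ : c ≤ M
    a-good : Good a
    b-good : Good b
    c-good : Good c
    sum : r ≡ a + b + c

-- The sum is tested along with the rest, so a subtraction cut off at 0 in the search below can only
-- make a candidate fail.
trySplit : ∀ M r a b c → Maybe (Split M r)
trySplit M r a b c with a ≤? M | b ≤? M | c ≤? M | good? a | good? b | good? c | r ≟ a + b + c
... | yes a≤ | yes b≤ | yes c≤ | yes ga | yes gb | yes gc | yes e =
  just (record { a≤ = a≤ ; b≤ = b≤ ; c≤ = c≤ ; a-good = ga ; b-good = gb ; c-good = gc ; sum = e })
... | _ | _ | _ | _ | _ | _ | _ = nothing

findSplit : ∀ M r → Maybe (Split M r)
findSplit M r = search M M
  where
  inner : ℕ → ℕ → Maybe (Split M r)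
  inner a zero    = trySplit M r a 0 (r ∸ a)
  inner a (suc b) = trySplit M r a (suc b) (r ∸ a ∸ suc b) <∣> inner a b
  search : ℕ → ℕ → Maybe (Split M r)
  search zero    b = inner 0 b
  search (suc a) b = inner (suc a) b <∣> search a b

fromIsJust : ∀ {A : Set} (x : Maybe A) → is-just x ≡ true → A
fromIsJust (just a) _ = a

splits : ∀ M lo k → every k (λ i → is-just (findSplit M (lo + toℕ i))) ≡ true → ∀ r → lo ≤ r → r < lo + k → Split M r
splits M lo k ok r lo≤r r<hi = subst (Split M) (trans (cong (lo +_) (Finₚ.toℕ-fromℕ< i<k)) (ℕₚ.m+[n∸m]≡n lo≤r))
  (fromIsJust (findSplit M (lo + toℕ (fromℕ< i<k))) (every-sound k (λ i → is-just (findSplit M (lo + toℕ i))) ok (fromℕ< i<k)))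
  where
  i<k : r ∸ lo < k
  i<k = ℕₚ.+-cancelˡ-< lo (r ∸ lo) k (subst (_< lo + k) (sym (ℕₚ.m+[n∸m]≡n lo≤r)) r<hi)

-- M = 5 makes 2 and 3 invertible but not 5, so just one truncated group is available.
fiveTimes : ∀ t → t ≤ 5 → DD₁₀₊₁ t → DD₁₀₊₁ (25 + t)
fiveTimes t t≤5 D = subst (λ k → DD₁₀₊₁ (25 + k)) (trans (ℕₚ.+-identityʳ (t + 0)) (ℕₚ.+-identityʳ t))
  (Wilson.wilson 4 (3 , 1 , refl) (2 , 1 , refl) t 0 0 (λ ()) t≤5 z≤n z≤n dd5 D point₁ point₁)

-- Groups of 5 give 25 and 27 to 30, but not 26, for which the truncated group would have size 1;
-- five groups of 7 give 35. The values 22 = 11 * 2, 26 = 13 * 2 and 32 = 8 * 4 come from groups of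
-- 20 or 40 points filled with `dd2` or `dd4`, the remaining ones from cyclic designs.
high : ∀ k → k ≤ 15 → DD₁₀₊₁ (21 + k)
high 0 _ = dd21
high 1 _ = fillGroups (λ _ → 20) gdd11×20 (λ _ → dd2)
high 2 _ = dd23
high 3 _ = dd24
high 4 _ = fiveTimes 0 z≤n point₁
high 5 _ = fillGroups (λ _ → 20) gdd13×20 (λ _ → dd2)
high 6 _ = fiveTimes 2 (s≤s (s≤s z≤n)) dd2
high 7 _ = fiveTimes 3 (s≤s (s≤s (s≤s z≤n))) dd3
high 8 _ = fiveTimes 4 (s≤s (s≤s (s≤s (s≤s z≤n)))) dd4
high 9 _ = fiveTimes 5 ℕₚ.≤-refl dd5
high 10 _ = dd31
high 11 _ = fillGroups (λ _ → 40) gdd8×40 (λ _ → dd4)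
high 12 _ = dd33
high 13 _ = dd34
high 14 _ = Wilson.wilson 6 (4 , 1 , refl) (5 , 2 , refl) 0 0 0 (λ ()) z≤n z≤n z≤n dd7 point₁ point₁ point₁
high 15 _ = dd36
high (suc (suc (suc (suc (suc (suc (suc (suc (suc (suc (suc (suc (suc (suc (suc (suc k)))))))))))))))) k≤15 =
  contradiction k≤15 (ℕₚ.<⇒≱ (ℕₚ.m≤m+n 16 k))

low : ∀ n → n < 21 → Good n → DD₁₀₊₁ n
low 0 _ _ = point₁
low 1 _ (1≢1 , _) = contradiction refl 1≢1
low 2 _ _ = dd2
low 3 _ _ = dd3
low 4 _ _ = dd4
low 5 _ _ = dd5
low 6 _ _ = dd6
low 7 _ _ = dd7
low 8 _ _ = dd8
low 9 _ (_ , 9≢9) = contradiction refl 9≢9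
low 10 _ _ = dd10
low 11 _ _ = dd11
low 12 _ _ = dd12
low 13 _ _ = dd13
low 14 _ _ = dd14
low 15 _ _ = dd15
low 16 _ _ = dd16
low 17 _ _ = dd17
low 18 _ _ = dd18
low 19 _ _ = dd19
low 20 _ _ = dd20
low (suc (suc (suc (suc (suc (suc (suc (suc (suc (suc (suc (suc (suc (suc (suc (suc (suc (suc (suc (suc (suc n))))))))))))))))))))) n<21 _ =
  contradiction n<21 (ℕₚ.≤⇒≯ (ℕₚ.m≤m+n 21 n))

base : ∀ n → n ≤ 36 → Good n → DD₁₀₊₁ n
base n n≤36 good with n <? 21
... | yes n<21 = low n n<21 good
... | no n≮21  = subst DD₁₀₊₁ (ℕₚ.m+[n∸m]≡n (ℕₚ.≮⇒≥ n≮21)) (high (n ∸ 21) (ℕₚ.∸-monoˡ-≤ 21 n≤36))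

IH : ℕ → Set₁
IH n = ∀ {k} → k < n → Good k → DD₁₀₊₁ k

module _ (m : ℕ) (unit₂ : Unit m 2) (unit₃ : Unit m 3) (unit₅ : Unit m 5) (good : Good (suc m)) where

  middle : ∀ n → IH n → ∀ lo k → every k (λ i → is-just (findSplit (suc m) (lo + toℕ i))) ≡ true →
    5 * suc m + lo ≤ n → n < 5 * suc m + (lo + k) → DD₁₀₊₁ n
  middle n ih lo k ok lo≤n n<hi = subst DD₁₀₊₁ (trans (cong (5 * suc m +_) (sym sum)) 5M+r≡n)
    (Wilson.wilson m unit₂ unit₃ a b c (λ _ → unit₅) a≤ b≤ c≤ (ih M<n good) (smaller a≤ a-good) (smaller b≤ b-good) (smaller c≤ c-good))
    where
    r = n ∸ 5 * suc m
    5M≤n : 5 * suc m ≤ n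
    5M≤n = ℕₚ.≤-trans (ℕₚ.m≤m+n (5 * suc m) lo) lo≤n
    5M+r≡n : 5 * suc m + r ≡ n
    5M+r≡n = ℕₚ.m+[n∸m]≡n 5M≤n
    M<n : suc m < n
    M<n = ℕₚ.<-≤-trans (ℕₚ.m<m+n (suc m) z<s) 5M≤n
    smaller : ∀ {k} → k ≤ suc m → Good k → DD₁₀₊₁ k
    smaller k≤M = ih (ℕₚ.≤-<-trans k≤M M<n)
    open Split (splits (suc m) lo k ok r
      (ℕₚ.+-cancelˡ-≤ (5 * suc m) lo r (subst (5 * suc m + lo ≤_) (sym 5M+r≡n) lo≤n))
      (ℕₚ.+-cancelˡ-< (5 * suc m) r (lo + k) (subst (_< 5 * suc m + (lo + k)) (sym 5M+r≡n) n<hi)))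

-- The values 7, 11, 17, 19, 29 of M are prime to 30, so all three truncated groups can be used, up
-- to n = 8 M. The windows abut; M = 19 bridges 137 to 146, above 8 * 17 = 136 and below 5 * 29 + 2
-- = 147.
middleRange : ∀ n → IH n → 36 < n → n < 215 → DD₁₀₊₁ n
middleRange n ih 36<n n<215 with n <? 57 | n <? 89 | n <? 137 | n <? 147
... | yes lt | _ | _ | _ = middle 6 (4 , 1 , refl) (5 , 2 , refl) (3 , 2 , refl) ((λ ()) , λ ()) n ih 2 20 refl 36<n lt
... | no ≥57 | yes lt | _ | _ = middle 10 (6 , 1 , refl) (4 , 1 , refl) (9 , 4 , refl) ((λ ()) , λ ()) n ih 2 32 refl (ℕₚ.≮⇒≥ ≥57) lt
... | _ | no ≥89 | yes lt | _ = middle 16 (9 , 1 , refl) (6 , 1 , refl) (7 , 2 , refl) ((λ ()) , λ ()) n ih 4 48 refl (ℕₚ.≮⇒≥ ≥89) lt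
... | _ | _ | no ≥137 | yes lt = middle 18 (10 , 1 , refl) (13 , 2 , refl) (4 , 1 , refl) ((λ ()) , λ ()) n ih 42 10 refl (ℕₚ.≮⇒≥ ≥137) lt
... | _ | _ | _ | no ≥147 = middle 28 (15 , 1 , refl) (10 , 1 , refl) (6 , 1 , refl) ((λ ()) , λ ()) n ih 2 68 refl (ℕₚ.≮⇒≥ ≥147) n<215

-- One truncated group suffices here, so M only has to be prime to 6. A step of 6 in M moves 5 M by
-- 30, hence 30 consecutive sizes of the truncated group reach every n. They start at 10 to stay
-- clear of 1 and 9 and end at 39, which M ≥ 41 accommodates; the least case is 5 * 41 + 10 = 215.
largeRange : ∀ n → IH n → 215 ≤ n → DD₁₀₊₁ n
largeRange n ih 215≤n = subst DD₁₀₊₁ n≡ (Wilson.wilson m unit₂ unit₃ t 0 0 (λ ()) t≤M z≤n z≤n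
  (ih M<n ((λ ()) , λ ())) (ih (ℕₚ.≤-<-trans t≤M M<n) ((λ ()) , λ e → 9≢10+ r (sym e))) point₁ point₁)
  where
  -- n = 215 + 30 q + r with r < 30, M = 6 q + 41 and t = 10 + r.
  q r m t : ℕ
  q = (n ∸ 215) / 30
  r = (n ∸ 215) % 30
  m = 40 + 6 * q
  t = 10 + r
  unit₂ : Unit m 2
  unit₂ = 21 + 3 * q , 1 , two q
    where
    two : ∀ q → (21 + 3 * q) * 2 ≡ 1 + 1 * suc (40 + 6 * q)
    two = solve-∀
  unit₃ : Unit m 3
  unit₃ = 14 + 2 * q , 1 , three q
    where
    three : ∀ q → (14 + 2 * q) * 3 ≡ 1 + 1 * suc (40 + 6 * q)
    three = solve-∀
  n≡ : 5 * suc m + (t + 0 + 0) ≡ n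
  n≡ = trans (rearrange q r) (trans (cong (215 +_) (sym (m≡m%n+[m/n]*n (n ∸ 215) 30))) (ℕₚ.m+[n∸m]≡n 215≤n))
    where
    rearrange : ∀ q r → 5 * suc (40 + 6 * q) + (10 + r + 0 + 0) ≡ 215 + (r + q * 30)
    rearrange = solve-∀
  t≤M : t ≤ suc m
  t≤M = ℕₚ.≤-trans (ℕₚ.+-monoʳ-≤ 10 (ℕₚ.≤-pred (m%n<n (n ∸ 215) 30))) (ℕₚ.≤-trans (ℕₚ.m≤m+n 39 2) (ℕₚ.m≤m+n 41 (6 * q)))
  M<n : suc m < n
  M<n = subst (suc m <_) n≡ (ℕₚ.<-≤-trans (ℕₚ.m<m+n (suc m) z<s) (ℕₚ.m≤m+n (5 * suc m) (t + 0 + 0)))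
  9≢10+ : ∀ r → 9 ≢ 10 + r
  9≢10+ r ()

design-exists : ∀ n → Good n → DD₁₀₊₁ n
design-exists = <-rec _ step
  where
  step : ∀ n → IH n → Good n → DD₁₀₊₁ n
  step n ih good with n ≤? 36 | n <? 215
  ... | yes n≤36 | _        = base n n≤36 good
  ... | no n≰36  | yes n<   = middleRange n ih (ℕₚ.≰⇒> n≰36) n<
  ... | no _     | no n≮    = largeRange n ih (ℕₚ.≮⇒≥ n≮)

theorem3p1 : (v : ℕ) → v % 10 ≡ 1 → 11 < v → v ≢ 91 →
    Σ (List (Block v)) λ B → IsDD v B × SuperSimple B × HalfDefiningRatio v B
theorem3p1 v v%10≡1 11<v v≢91 = Realise.realise (subst DD (sym v≡) (design-exists n
  ((λ n≡1 → ℕₚ.<⇒≢ 11<v (sym (value 1 n≡1))) , (λ n≡9 → v≢91 (value 9 n≡9)))))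
  where
  n : ℕ
  n = v / 10
  v≡ : v ≡ suc (n * 10)
  v≡ = trans (m≡m%n+[m/n]*n v 10) (cong (_+ n * 10) v%10≡1)
  value : ∀ k → n ≡ k → v ≡ suc (k * 10)
  value k e = trans v≡ (cong (λ k → suc (k * 10)) e)
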